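{- We have $$A^{2314}(x,q)=1+I^{2314}(x,q)+I^{231}(x,q)\left(A^{2314}(x,q)-1\right),$$ $$A^{3124}(x,q)=1+I^{3124}(x,q)+I^{312}(x,q)\left(A^{3124}(x,q)-1\right).$$ Further, for $\sigma\in\{2314,3124\}$, $$I^\sigma(x)=\frac12\left(\sqrt{1-4x}+1\right)\left(\frac{32x}{1+20x-8x^2-(1-8x)^{3/2}}-1\right),$$ $I^\sigma_1=1$, and for $n\ge2$, $$I^\sigma_n=F_n-\sum_{i=0}^{n-2}C_iF_{n-1-i},$$ where $C_i=\frac1{i+1}\binom{2i}i$ is the $i$-th Catalan number and $F_m$ is the number of $1342$-avoiding permutations of $[m]$.
   Context: For a permutation $\pi=\pi_1\cdots\pi_n$ of $[n]$, let $i_\pi$ be the smallest index $i$ with $\{\pi_1,\dots,\pi_i\}=\{1,\dots,i\}$; $\pi$ is indecomposable if $i_\pi=n$ (the empty permutation is not indecomposable). A permutation $\pi$ avoids a pattern $\tau\in\mathfrak S_k$ if no subsequence $\pi_{j_1}\cdots\pi_{j_k}$ ($j_1<\cdots<j_k$) is order-isomorphic to $\tau$. A descent of $\pi$ is an index $i$ with $\pi_i>\pi_{i+1}$. For a pattern $\sigma$, $A^\sigma_{n,i}$ (resp. $I^\sigma_{n,i}$) is the number of $\sigma$-avoiding permutations (resp. $\sigma$-avoiding indecomposable permutations) of $[n]$ with $i$ descents; $A^\sigma(x,q)=1+\sum_{n\ge1}\sum_iA^\sigma_{n,i}x^nq^i$, $I^\sigma(x,q)=\sum_{n\ge1}\sum_iI^\sigma_{n,i}x^nq^i$,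 $I^\sigma(x)=I^\sigma(x,1)=\sum_{n\ge1}I^\sigma_nx^n$. It is known (Bóna) that the patterns $1342,2314,3124$ are Wilf-equivalent and that $\sum_{m\ge0}F_mx^m=\frac{32x}{1+20x-8x^2-(1-8x)^{3/2}}$, with $F_0=1$. -}

module Defs where

open import Data.Bool using (Bool; true; false; _∧_; _∨_; not; if_then_else_)
open import Data.Nat using (ℕ; zero; suc; _+_; _*_; _∸_; _<ᵇ_; _≤ᵇ_; _≡ᵇ_)
open import Data.Nat.Combinatorics using (_C_)
open import Data.Nat.DivMod using (_/_)
open import Data.List using (List; []; _∷_; length; map; filterᵇ; upTo; take; drop; foldr; concatMap)
open import Data.Bool.ListAction using (all; any)
open import Relation.Binary.PropositionalEquality using (_≡_)
open import Data.Integer as ℤ using (ℤ; +_)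

words : List ℕ → ℕ → List (List ℕ)
words xs zero    = [] ∷ []
words xs (suc n) = concatMap (λ x → map (x ∷_) (words xs n)) xs

range1 : ℕ → List ℕ
range1 n = map suc (upTo n)

elemᵇ : ℕ → List ℕ → Bool
elemᵇ v xs = any (λ x → x ≡ᵇ v) xs

distinctᵇ : List ℕ → Bool
distinctᵇ []       = true
distinctᵇ (x ∷ xs) = not (elemᵇ x xs) ∧ distinctᵇ xs

perms : ℕ → List (List ℕ)
perms n = filterᵇ distinctᵇ (words (range1 n) n)

subseqs : List ℕ → List (List ℕ)
subseqs []       = [] ∷ []
subseqs (x ∷ xs) = map (x ∷_) (subseqs xs) Data.List.++ subseqs xs

sameOrderWith : ℕ → ℕ → List ℕ → List ℕ → Bool
sameOrderWith u a (v ∷ vs) (b ∷ bs) =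
  ((u <ᵇ v) ≡ᵇᴮ (a <ᵇ b)) ∧ ((v <ᵇ u) ≡ᵇᴮ (b <ᵇ a)) ∧ sameOrderWith u a vs bs
  where
  _≡ᵇᴮ_ : Bool → Bool → Bool
  true  ≡ᵇᴮ y = y
  false ≡ᵇᴮ y = not y
sameOrderWith u a _ _ = true

orderIsoᵇ : List ℕ → List ℕ → Bool
orderIsoᵇ []       []       = true
orderIsoᵇ (u ∷ us) (a ∷ as) = sameOrderWith u a us as ∧ orderIsoᵇ us as
orderIsoᵇ _        _        = false

containsᵇ : List ℕ → List ℕ → Bool
containsᵇ τ π = any (λ s → orderIsoᵇ s τ) (subseqs π)

avoidsᵇ : List ℕ → List ℕ → Bool
avoidsᵇ τ π = not (containsᵇ τ π)

des : List ℕ → ℕ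
des (x ∷ y ∷ xs) = (if y <ᵇ x then 1 else 0) + des (y ∷ xs)
des _            = 0

prefixIsInitialᵇ : List ℕ → ℕ → Bool
prefixIsInitialᵇ π i =
  all (λ x → elemᵇ x (range1 i)) (take i π) ∧ all (λ v → elemᵇ v (take i π)) (range1 i)

-- smallest i ∈ {1,…,|π|} with {π₁,…,πᵢ} = {1,…,i}  (for a permutation of
-- [n], n ≥ 1, such an i always exists since i = n works; default n)
firstFrom : List ℕ → List ℕ → ℕ → ℕ
firstFrom π []       d = d
firstFrom π (i ∷ is) d = if prefixIsInitialᵇ π i then i else firstFrom π is d

iπ : List ℕ → ℕ
iπ π = firstFrom π (range1 (length π)) (length π)

indecomposableᵇ : List ℕ → Bool
indecomposableᵇ []       = false
indecomposableᵇ (x ∷ xs) = iπ (x ∷ xs) ≡ᵇ length (x ∷ xs)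

count : (List ℕ → Bool) → List (List ℕ) → ℕ
count p xs = length (filterᵇ p xs)

Acoef : List ℕ → ℕ → ℕ → ℕ
Acoef σ n i = count (λ π → avoidsᵇ σ π ∧ (des π ≡ᵇ i)) (perms n)

Icoef : List ℕ → ℕ → ℕ → ℕ
Icoef σ n i = count (λ π → avoidsᵇ σ π ∧ indecomposableᵇ π ∧ (des π ≡ᵇ i)) (perms n)

-- I^σ_n = I^σ_{n,·} summed over descents (coefficients of I^σ(x,1))
Icount : List ℕ → ℕ → ℕ
Icount σ n = count (λ π → avoidsᵇ σ π ∧ indecomposableᵇ π) (perms n)

F : ℕ → ℕ
F m = count (avoidsᵇ (1 ∷ 3 ∷ 4 ∷ 2 ∷ [])) (perms m)

catalan : ℕ → ℕ
catalan i = ((2 * i) C i) / suc i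

sumℤ : List ℤ → ℤ
sumℤ = foldr ℤ._+_ (+ 0)

Σ< : ℕ → (ℕ → ℤ) → ℤ
Σ< n f = sumℤ (map f (upTo n))

Series : Set
Series = ℕ → ℤ

_≋_ : Series → Series → Set
f ≋ g = ∀ n → f n ≡ g n

infix 4 _≋_
infixl 6 _⊕_ _⊖_
infixl 7 _⊗_

_⊕_ _⊖_ _⊗_ : Series → Series → Series
(f ⊕ g) n = f n ℤ.+ g n
(f ⊖ g) n = f n ℤ.- g n
(f ⊗ g) n = Σ< (suc n) (λ k → f k ℤ.* g (n ∸ k))

monoS : ℤ → ℕ → Series
monoS c k n = if n ≡ᵇ k then c else + 0

constS : ℤ → Series
constS c = monoS c 0

Series2 : Set
Series2 = ℕ → ℕ → ℤ

_≋₂_ : Series2 → Series2 → Set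
f ≋₂ g = ∀ n i → f n i ≡ g n i

infix 4 _≋₂_
infixl 6 _⊕₂_ _⊖₂_
infixl 7 _⊗₂_

_⊕₂_ _⊖₂_ _⊗₂_ : Series2 → Series2 → Series2
(f ⊕₂ g) n i = f n i ℤ.+ g n i
(f ⊖₂ g) n i = f n i ℤ.- g n i
(f ⊗₂ g) n i = Σ< (suc n) (λ m → Σ< (suc i) (λ j → f m j ℤ.* g (n ∸ m) (i ∸ j)))

one₂ : Series2
one₂ n i = if (n ≡ᵇ 0) ∧ (i ≡ᵇ 0) then + 1 else + 0

Agf : List ℕ → Series2
Agf σ zero    i = one₂ 0 i
Agf σ (suc n) i = + Acoef σ (suc n) i

Igf : List ℕ → Series2
Igf σ zero    i = + 0
Igf σ (suc n) i = + Icoef σ (suc n) i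

Igf₁ : List ℕ → Series
Igf₁ σ zero    = + 0
Igf₁ σ (suc n) = + Icount σ (suc n)

{-# OPTIONS --safe #-}
module Submission where

-- In a direct sum π = α ⊕ β with α the first indecomposable component and β nonempty, π avoids σ ⊕ 1
-- (σ = 231 or 312) exactly when α avoids σ and β avoids σ ⊕ 1, and descents add up.
--
-- Reverse-complement and inverse reduce all counts to the avoiders of 312 and 1423, which are built
-- by inserting new first entries c.  Such an insertion preserves 1423-avoidance iff the values above c
-- avoid 312.  Above the least threshold with this property, the values split into blocks that occur in
-- decreasing order; inserting c into a block of size r, above j of its values, turns it into blocks
-- of sizes j + 1 and r - j and kills all lower blocks.  Hence the avoiders are counted by histories of
-- a stack.  Their generating function solves a quadratic equation with one catalytic variable, which
-- gives F (1 - U)³ = 1 - 2U for U = x + 2U².  For 312 only the lowest block matters: ballot numbers.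

-- The closed form of `I^σ` contains the algebraic series of `F`, and establishing that series
-- shapes the proof. Let `u` mark the size of a stack entry and let `Φ` collect the contributions of
-- single entries. Then `F (1 - u) Φ (u + x - xΦ) = u`, where `F` and `Φ` are both unknown. Written
-- as `xΦ² - (u + x)Φ + u/(F(1 - u)) = 0`, the quadratic has a discriminant that becomes, after
-- multiplication by `1 - u`, the cubic `(1 - u)(u + x)² - 4xu/F` in `u`. A double root at `u = U`
-- turns the cubic into `(U - u)²((1 - 2U)² - u)`; this is the origin of `x = U(1 - 2U)` and
-- `F = (1 - 2U)/(1 - U)³`. The proof runs the computation backwards: the series are built from
-- contracting equations with integer coefficients, the quadratic equation is verified as a ring
-- identity, and its coefficients in `u` give exactly the recurrences that count histories.
-- Induction on the length of a history then identifies the two.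

module FormalSeries where

  open import Algebra.Bundles using (CommutativeRing; RawRing)
  open import Data.Maybe.Base using (Maybe; just; nothing)
  open import Data.Nat.Base as ℕ using (ℕ; zero; suc)
  import Data.Nat.Properties as ℕ
  open import Data.Product.Base using (_×_; _,_)
  open import Relation.Nullary using (yes; no)
  import Relation.Binary.PropositionalEquality as ≡

  -- Ring identities with integer coefficients.

  module IntegralSolver {c ℓ} (R : CommutativeRing c ℓ) where

    open CommutativeRing R
    open import Algebra.Properties.Ring ring
    open import Algebra.Properties.AbelianGroup +-abelianGroup using (⁻¹-∙-comm)
    open import Algebra.Properties.Semiring.Mult.TCOptimised semiring using (×-homo-+; ×1-homo-*) renaming (_×_ to _·_)
    open import Algebra.Properties.CommutativeSemigroup +-commutativeSemigroup using (interchange)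
    open import Algebra.Solver.Ring.AlmostCommutativeRing
    open import Relation.Binary.Reasoning.Setoid setoid

    -- The pair (a , b) stands for the integer a - b.  The solver compares normal
    -- forms up to definitional equality, so pairs are kept reduced.
    reduce : ℕ × ℕ → ℕ × ℕ
    reduce (a , b) = a ℕ.∸ b , b ℕ.∸ a

    differences : RawRing _ _
    differences = record
      { Carrier = ℕ × ℕ
      ; _≈_ = ≡._≡_
      ; _+_ = λ { (a , b) (c , d) → reduce (a ℕ.+ c , b ℕ.+ d) }
      ; _*_ = λ { (a , b) (c , d) → reduce (a ℕ.* c ℕ.+ b ℕ.* d , a ℕ.* d ℕ.+ b ℕ.* c) }
      ; -_  = λ { (a , b) → b , a }
      ; 0#  = 0 , 0
      ; 1#  = 1 , 0
      }

    nat : ℕ → Carrier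
    nat n = n · 1#

    -- The separate clause for a zero subtrahend lets `κ n` mean `nat n` itself rather than
    -- `nat n - nat 0`, so that solved identities have the form in which they are used.
    difference : ℕ × ℕ → Carrier
    difference (a , zero)  = nat a
    difference (a , suc b) = nat a - nat (suc b)

    difference≈ : ∀ a b → difference (a , b) ≈ nat a - nat b
    difference≈ a zero    = sym (trans (+-congˡ -0#≈0#) (+-identityʳ _))
    difference≈ a (suc b) = refl

    nat-+ : ∀ m n → nat (m ℕ.+ n) ≈ nat m + nat n
    nat-+ = ×-homo-+ 1#

    +-homo : ∀ a b c d → nat (a ℕ.+ c) - nat (b ℕ.+ d) ≈ (nat a - nat b) + (nat c - nat d)
    +-homo a b c d = begin
      nat (a ℕ.+ c) - nat (b ℕ.+ d)          ≈⟨ +-cong (nat-+ a c) (-‿cong (nat-+ b d)) ⟩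
      (nat a + nat c) - (nat b + nat d)      ≈⟨ +-congˡ (⁻¹-∙-comm _ _) ⟨
      (nat a + nat c) + (- nat b + - nat d)  ≈⟨ interchange _ _ _ _ ⟩
      (nat a - nat b) + (nat c - nat d)      ∎

    nat-* : ∀ m n → nat (m ℕ.* n) ≈ nat m * nat n
    nat-* = ×1-homo-*

    *-homo : ∀ a b c d → nat (a ℕ.* c ℕ.+ b ℕ.* d) - nat (a ℕ.* d ℕ.+ b ℕ.* c)
                       ≈ (nat a - nat b) * (nat c - nat d)
    *-homo a b c d = begin
      nat (a ℕ.* c ℕ.+ b ℕ.* d) - nat (a ℕ.* d ℕ.+ b ℕ.* c)
        ≈⟨ +-cong (trans (nat-+ (a ℕ.* c) _) (+-cong (nat-* a c) (nat-* b d)))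
                  (-‿cong (trans (nat-+ (a ℕ.* d) _) (+-cong (nat-* a d) (nat-* b c)))) ⟩
      (A * C + B * D) - (A * D + B * C)
        ≈⟨ +-congˡ (⁻¹-∙-comm _ _) ⟨
      (A * C + B * D) + (- (A * D) + - (B * C))
        ≈⟨ interchange _ _ _ _ ⟩
      (A * C + - (A * D)) + (B * D + - (B * C))
        ≈⟨ +-cong (+-congˡ (-‿distribʳ-* A D)) (trans (+-comm _ _) (+-cong (-‿distribʳ-* B C) (sym (trans (sym (-‿distribʳ-* B (- D))) (trans (-‿cong (sym (-‿distribʳ-* B D))) (-‿involutive _)))))) ⟩
      (A * C + A * (- D)) + (B * (- C) + B * (- - D))
        ≈⟨ +-cong (sym (distribˡ A C (- D))) (sym (distribˡ B (- C) (- - D))) ⟩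
      A * (C - D) + B * (- C + - - D)
        ≈⟨ +-congˡ (*-congˡ (⁻¹-∙-comm C (- D))) ⟩
      A * (C - D) + B * (- (C - D))
        ≈⟨ +-congˡ (trans (sym (-‿distribʳ-* B (C - D))) (-‿distribˡ-* B (C - D))) ⟩
      A * (C - D) + - B * (C - D)
        ≈⟨ distribʳ (C - D) A (- B) ⟨
      (A - B) * (C - D) ∎
      where
      A = nat a
      B = nat b
      C = nat c
      D = nat d

    neg-homo : ∀ a b → nat b - nat a ≈ - (nat a - nat b)
    neg-homo a b = begin
      nat b - nat a         ≈⟨ +-comm _ _ ⟩
      - nat a + nat b       ≈⟨ +-congˡ (-‿involutive _) ⟨
      - nat a + - - nat b   ≈⟨ ⁻¹-∙-comm _ _ ⟩
      - (nat a - nat b)     ∎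

    sameDifference : ∀ a b c d → a ℕ.+ d ≡.≡ c ℕ.+ b → nat a - nat b ≈ nat c - nat d
    sameDifference a b c d eq = begin
      nat a - nat b                        ≈⟨ +-congʳ (+-identityʳ _) ⟨
      (nat a + 0#) - nat b                 ≈⟨ +-congʳ (+-congˡ (-‿inverseʳ (nat d))) ⟨
      (nat a + (nat d - nat d)) - nat b    ≈⟨ +-congʳ (+-assoc _ _ _) ⟨
      ((nat a + nat d) - nat d) - nat b    ≈⟨ +-congʳ (+-congʳ (nat-+ a d)) ⟨
      (nat (a ℕ.+ d) - nat d) - nat b      ≡⟨ ≡.cong (λ t → (nat t - nat d) - nat b) eq ⟩
      (nat (c ℕ.+ b) - nat d) - nat b      ≈⟨ +-congʳ (+-congʳ (nat-+ c b)) ⟩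
      ((nat c + nat b) - nat d) - nat b    ≈⟨ +-assoc _ _ _ ⟩
      (nat c + nat b) + (- nat d - nat b)  ≈⟨ interchange _ _ _ _ ⟩
      (nat c - nat d) + (nat b - nat b)    ≈⟨ +-congˡ (-‿inverseʳ (nat b)) ⟩
      (nat c - nat d) + 0#                 ≈⟨ +-identityʳ _ ⟩
      nat c - nat d                        ∎

    m+[n∸m]≡[m∸n]+n : ∀ m n → m ℕ.+ (n ℕ.∸ m) ≡.≡ (m ℕ.∸ n) ℕ.+ n
    m+[n∸m]≡[m∸n]+n m       zero    = ≡.trans (≡.cong (m ℕ.+_) (ℕ.0∸n≡0 m)) ≡.refl
    m+[n∸m]≡[m∸n]+n zero    (suc n) = ≡.refl
    m+[n∸m]≡[m∸n]+n (suc m) (suc n) = ≡.trans (≡.cong suc (m+[n∸m]≡[m∸n]+n m n)) (≡.sym (ℕ.+-suc (m ℕ.∸ n) n))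

    difference-reduce : ∀ a b → difference (reduce (a , b)) ≈ nat a - nat b
    difference-reduce a b = trans (difference≈ (a ℕ.∸ b) (b ℕ.∸ a))
      (sym (sameDifference a b (a ℕ.∸ b) (b ℕ.∸ a) (m+[n∸m]≡[m∸n]+n a b)))

    morphism : differences -Raw-AlmostCommutative⟶ fromCommutativeRing R
    morphism = record
      { ⟦_⟧    = difference
      ; +-homo = λ { (a , b) (c , d) → trans (difference-reduce (a ℕ.+ c) (b ℕ.+ d)) (trans (+-homo a b c d)
                   (sym (+-cong (difference≈ a b) (difference≈ c d)))) }
      ; *-homo = λ { (a , b) (c , d) → trans (difference-reduce (a ℕ.* c ℕ.+ b ℕ.* d) (a ℕ.* d ℕ.+ b ℕ.* c)) (trans (*-homo a b c d)
                   (sym (*-cong (difference≈ a b) (difference≈ c d)))) }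
      ; -‿homo = λ { (a , b) → trans (difference≈ b a) (trans (neg-homo a b) (-‿cong (sym (difference≈ a b)))) }
      ; 0-homo = refl
      ; 1-homo = refl
      }

    _≟_ : ∀ x y → Maybe (difference x ≈ difference y)
    (a , b) ≟ (c , d) with a ℕ.+ d ℕ.≟ c ℕ.+ b
    ... | yes eq = just (trans (difference≈ a b) (trans (sameDifference a b c d eq) (sym (difference≈ c d))))
    ... | no _   = nothing

    open import Algebra.Solver.Ring differences (fromCommutativeRing R) morphism _≟_ public using (Polynomial; solve; _:=_; _:+_; _:*_; _:-_; :-_; con)

    κ : ∀ {n} → ℕ → Polynomial n
    κ n = con (n , 0)

  -- Convolution and rings of formal power series.

  module Convolution {a} {A : Set a} (_+_ _*_ : A → A → A) where

    infixl 7 _⋆_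
    -- Shifting the first factor and recursing on the degree replaces finite sums, so the ring laws
    -- become inductions on the degree.
    _⋆_ : (ℕ → A) → (ℕ → A) → ℕ → A
    (f ⋆ g) zero    = f 0 * g 0
    (f ⋆ g) (suc n) = (f 0 * g (suc n)) + ((λ k → f (suc k)) ⋆ g) n

  module PowerSeries {c ℓ} (R : CommutativeRing c ℓ) where

    open CommutativeRing R
    open import Algebra.Properties.CommutativeSemigroup +-commutativeSemigroup using (interchange)
    open import Relation.Binary.Reasoning.Setoid setoid

    open Convolution _+_ _*_ public

    constant : Carrier → ℕ → Carrier
    constant a zero    = a
    constant a (suc _) = 0#

    shift : (ℕ → Carrier) → ℕ → Carrier
    shift f zero    = 0#
    shift f (suc n) = f n

    ⋆-cong≤ : ∀ {f f′ g g′} n → (∀ k → k ℕ.≤ n → f k ≈ f′ k) → (∀ k → k ℕ.≤ n → g k ≈ g′ k) →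
              (f ⋆ g) n ≈ (f′ ⋆ g′) n
    ⋆-cong≤ zero    p q = *-cong (p 0 ℕ.z≤n) (q 0 ℕ.z≤n)
    ⋆-cong≤ (suc n) p q = +-cong (*-cong (p 0 ℕ.z≤n) (q (suc n) ℕ.≤-refl))
      (⋆-cong≤ n (λ k k≤n → p (suc k) (ℕ.s≤s k≤n)) (λ k k≤n → q k (ℕ.m≤n⇒m≤1+n k≤n)))

    ⋆-cong : ∀ {f f′ g g′} → (∀ k → f k ≈ f′ k) → (∀ k → g k ≈ g′ k) → ∀ n → (f ⋆ g) n ≈ (f′ ⋆ g′) n
    ⋆-cong p q n = ⋆-cong≤ n (λ k _ → p k) (λ k _ → q k)

    -- The mirror image of the defining recursion; commutativity is an induction that peels the two
    -- factors alternately.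
    ⋆-sucʳ : ∀ f g n → (f ⋆ g) (suc n) ≈ (f ⋆ (λ k → g (suc k))) n + f (suc n) * g 0
    ⋆-sucʳ f g zero    = refl
    ⋆-sucʳ f g (suc n) = trans (+-congˡ (⋆-sucʳ (λ k → f (suc k)) g n)) (sym (+-assoc _ _ _))

    ⋆-comm : ∀ f g n → (f ⋆ g) n ≈ (g ⋆ f) n
    ⋆-comm f g zero    = *-comm _ _
    ⋆-comm f g (suc n) = begin
      f 0 * g (suc n) + ((λ k → f (suc k)) ⋆ g) n  ≈⟨ +-cong (*-comm _ _) (⋆-comm (λ k → f (suc k)) g n) ⟩
      g (suc n) * f 0 + (g ⋆ (λ k → f (suc k))) n  ≈⟨ +-comm _ _ ⟩
      (g ⋆ (λ k → f (suc k))) n + g (suc n) * f 0  ≈⟨ ⋆-sucʳ g f n ⟨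
      (g ⋆ f) (suc n)                              ∎

    ⋆-distribʳ : ∀ h f g n → ((λ k → f k + g k) ⋆ h) n ≈ (f ⋆ h) n + (g ⋆ h) n
    ⋆-distribʳ h f g zero    = distribʳ _ _ _
    ⋆-distribʳ h f g (suc n) = trans
      (+-cong (distribʳ _ _ _) (⋆-distribʳ h (λ k → f (suc k)) (λ k → g (suc k)) n))
      (interchange _ _ _ _)

    ⋆-scale : ∀ a g h n → ((λ k → a * g k) ⋆ h) n ≈ a * (g ⋆ h) n
    ⋆-scale a g h zero    = *-assoc _ _ _
    ⋆-scale a g h (suc n) = trans (+-cong (*-assoc _ _ _) (⋆-scale a (λ k → g (suc k)) h n)) (sym (distribˡ _ _ _))

    ⋆-assoc : ∀ f g h n → ((f ⋆ g) ⋆ h) n ≈ (f ⋆ (g ⋆ h)) n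
    ⋆-assoc f g h zero    = *-assoc _ _ _
    ⋆-assoc f g h (suc n) = begin
      (f 0 * g 0) * h (suc n) + ((λ k → f 0 * g (suc k) + (f⁺ ⋆ g) k) ⋆ h) n
        ≈⟨ +-cong (*-assoc _ _ _) (⋆-distribʳ h (λ k → f 0 * g (suc k)) (f⁺ ⋆ g) n) ⟩
      f 0 * (g 0 * h (suc n)) + (((λ k → f 0 * g (suc k)) ⋆ h) n + ((f⁺ ⋆ g) ⋆ h) n)
        ≈⟨ +-congˡ (+-cong (⋆-scale (f 0) (λ k → g (suc k)) h n) (⋆-assoc f⁺ g h n)) ⟩
      f 0 * (g 0 * h (suc n)) + (f 0 * ((λ k → g (suc k)) ⋆ h) n + (f⁺ ⋆ (g ⋆ h)) n)
        ≈⟨ +-assoc _ _ _ ⟨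
      (f 0 * (g 0 * h (suc n)) + f 0 * ((λ k → g (suc k)) ⋆ h) n) + (f⁺ ⋆ (g ⋆ h)) n
        ≈⟨ +-congʳ (distribˡ _ _ _) ⟨
      f 0 * (g ⋆ h) (suc n) + (f⁺ ⋆ (g ⋆ h)) n ∎
      where
      f⁺ : ℕ → Carrier
      f⁺ k = f (suc k)

    zero-⋆ : ∀ g n → ((λ _ → 0#) ⋆ g) n ≈ 0#
    zero-⋆ g zero    = zeroˡ _
    zero-⋆ g (suc n) = trans (+-cong (zeroˡ _) (zero-⋆ g n)) (+-identityˡ _)

    constant-⋆ : ∀ a g n → (constant a ⋆ g) n ≈ a * g n
    constant-⋆ a g zero    = refl
    constant-⋆ a g (suc n) = trans (+-congˡ (zero-⋆ g n)) (+-identityʳ _)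

    shift-⋆ : ∀ f g n → (shift f ⋆ g) n ≈ shift (f ⋆ g) n
    shift-⋆ f g zero    = zeroˡ _
    shift-⋆ f g (suc n) = trans (+-congʳ (zeroˡ _)) (+-identityˡ _)

    seriesRing : CommutativeRing c ℓ
    seriesRing = record
      { Carrier = ℕ → Carrier
      ; _≈_ = λ f g → ∀ n → f n ≈ g n
      ; _+_ = λ f g n → f n + g n
      ; _*_ = _⋆_
      ; -_ = λ f n → - f n
      ; 0# = λ _ → 0#
      ; 1# = constant 1#
      ; isCommutativeRing = record
        { isRing = record
          { +-isAbelianGroup = record
            { isGroup = record
              { isMonoid = record
                { isSemigroup = record
                  { isMagma = record
                    { isEquivalence = record
                      { refl = λ _ → refl ; sym = λ p n → sym (p n) ; trans = λ p q n → trans (p n) (q n) }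
                    ; ∙-cong = λ p q n → +-cong (p n) (q n)
                    }
                  ; assoc = λ f g h n → +-assoc _ _ _
                  }
                ; identity = (λ f n → +-identityˡ _) , (λ f n → +-identityʳ _)
                }
              ; inverse = (λ f n → -‿inverseˡ _) , (λ f n → -‿inverseʳ _)
              ; ⁻¹-cong = λ p n → -‿cong (p n)
              }
            ; comm = λ f g n → +-comm _ _
            }
          ; *-cong = ⋆-cong
          ; *-assoc = ⋆-assoc
          ; *-identity = one-⋆ , (λ f n → trans (⋆-comm f (constant 1#) n) (one-⋆ f n))
          ; distrib = (λ h f g n → trans (⋆-comm h (λ k → f k + g k) n) (trans (⋆-distribʳ h f g n)
                        (+-cong (⋆-comm f h n) (⋆-comm g h n)))) , ⋆-distribʳ
          }
        ; *-comm = ⋆-comm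
        }
      }
      where
      one-⋆ : ∀ f n → (constant 1# ⋆ f) n ≈ f n
      one-⋆ f n = trans (constant-⋆ 1# f n) (*-identityˡ _)

    -- The operations of seriesRing compared modulo xᵇ: congruence in this ring is what
    -- makes fixed-point iterations converge.
    module _ (b : ℕ) where
      private module S = CommutativeRing seriesRing

      truncatedRing : CommutativeRing c ℓ
      truncatedRing = record
        { Carrier = ℕ → Carrier
        ; _≈_ = λ f g → ∀ n → n ℕ.< b → f n ≈ g n
        ; _+_ = S._+_
        ; _*_ = S._*_
        ; -_ = S.-_
        ; 0# = S.0#
        ; 1# = S.1#
        ; isCommutativeRing = record
          { isRing = record
            { +-isAbelianGroup = record
              { isGroup = record
                { isMonoid = record
                  { isSemigroup = record
                    { isMagma = record
                      { isEquivalence = record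
                        { refl = λ _ _ → refl ; sym = λ p n n<b → sym (p n n<b)
                        ; trans = λ p q n n<b → trans (p n n<b) (q n n<b) }
                      ; ∙-cong = λ p q n n<b → +-cong (p n n<b) (q n n<b)
                      }
                    ; assoc = λ f g h n _ → S.+-assoc f g h n
                    }
                  ; identity = (λ f n _ → S.+-identityˡ f n) , (λ f n _ → S.+-identityʳ f n)
                  }
                ; inverse = (λ f n _ → S.-‿inverseˡ f n) , (λ f n _ → S.-‿inverseʳ f n)
                ; ⁻¹-cong = λ p n n<b → -‿cong (p n n<b)
                }
              ; comm = λ f g n _ → S.+-comm f g n
              }
            ; *-cong = λ p q n n<b → ⋆-cong≤ n (λ k k≤n → p k (ℕ.≤-<-trans k≤n n<b)) (λ k k≤n → q k (ℕ.≤-<-trans k≤n n<b))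
            ; *-assoc = λ f g h n _ → S.*-assoc f g h n
            ; *-identity = (λ f n _ → S.*-identityˡ f n) , (λ f n _ → S.*-identityʳ f n)
            ; distrib = (λ f g h n _ → S.distribˡ f g h n) , (λ f g h n _ → S.distribʳ f g h n)
            }
          ; *-comm = λ f g n _ → S.*-comm f g n
          }
        }

-- Series in two variables as fixed points, and the kernel equation.

module FixedPoints where

  open import Algebra.Bundles using (CommutativeRing)
  open import Data.Nat.Base as ℕ using (ℕ; zero; suc)
  import Data.Nat.Properties as ℕ
  open import Data.Product.Base using (_,_; Σ)
  import Relation.Binary.PropositionalEquality as ≡
  open FormalSeries

  module FixedPoint {c ℓ} (K : CommutativeRing c ℓ) where

    module K = CommutativeRing K
    module X = PowerSeries K
    module S = CommutativeRing X.seriesRing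
    module P = PowerSeries X.seriesRing
    module B = CommutativeRing P.seriesRing

    infix 4 _≈[_]_
    -- In `f r k` the outer index `r` is the exponent of the catalytic variable `u` and `k` that of
    -- `x`. Truncation concerns `x` only and is uniform in `r`.
    _≈[_]_ : B.Carrier → ℕ → B.Carrier → Set ℓ
    f ≈[ b ] g = ∀ r k → k ℕ.< b → f r k K.≈ g r k

    -- A factor without constant term gains one order of precision in `x`.
    contract : ∀ {b e e′} n → b 0 K.≈ K.0# → (∀ k → k ℕ.< n → e k K.≈ e′ k) →
               ∀ k → k ℕ.< suc n → (b X.⋆ e) k K.≈ (b X.⋆ e′) k
    contract n b0 p zero    _   = K.trans (K.*-congʳ b0) (K.trans (K.zeroˡ _) (K.sym (K.trans (K.*-congʳ b0) (K.zeroˡ _))))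
    contract n b0 p (suc k) k<n = K.+-cong
      (K.trans (K.*-congʳ b0) (K.trans (K.zeroˡ _) (K.sym (K.trans (K.*-congʳ b0) (K.zeroˡ _)))))
      (X.⋆-cong≤ k (λ _ _ → K.refl) (λ j j≤k → p j (ℕ.≤-trans (ℕ.s≤s j≤k) (ℕ.≤-pred k<n))))

    module Quadratic (a p q : B.Carrier) (b : S.Carrier) (b0 : b 0 K.≈ K.0#) where

      body : B.Carrier → B.Carrier
      body f = p B.* f B.+ q B.* (f B.* f)

      op : B.Carrier → B.Carrier
      op f = a B.+ P.constant b B.* body f

      body-cong : ∀ n {f g} → f ≈[ n ] g → body f ≈[ n ] body g
      -- Agreement modulo `x^n` is equality of series in `u` over the truncated ring, so congruence
      -- is inherited from that ring.
      body-cong n {f} {g} e = T.+-cong {p B.* f} {p B.* g} {q B.* (f B.* f)} {q B.* (g B.* g)}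
        (T.*-congˡ {p} {f} {g} e) (T.*-congˡ {q} {f B.* f} {g B.* g} (T.*-cong {f} {g} {f} {g} e e))
        where module T = CommutativeRing (PowerSeries.seriesRing (X.truncatedRing n))

      op-cong : ∀ n {f g} → f ≈[ n ] g → op f ≈[ suc n ] op g
      op-cong n {f} {g} e r k k<n = K.+-cong K.refl (K.trans (P.constant-⋆ b (body f) r k)
        (K.trans (contract n b0 (body-cong n e r) k k<n) (K.sym (P.constant-⋆ b (body g) r k))))

      iterate : ℕ → B.Carrier
      iterate zero    = B.0#
      iterate (suc n) = op (iterate n)

      iterate-stable : ∀ n j → iterate n ≈[ n ] iterate (j ℕ.+ n)
      iterate-stable zero    j r k ()
      iterate-stable (suc n) j r k k<n = K.trans (op-cong n (iterate-stable n j) r k k<n)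
        (K.reflexive (≡.cong (λ t → iterate t r k) (≡.sym (ℕ.+-suc j n))))

      -- Each iteration settles one more power of `x`; the coefficient of `x^k` is final after
      -- `suc k` iterations, which permits this diagonal choice.
      solution : B.Carrier
      solution r k = iterate (suc k) r k

      solution≈iterate : ∀ n → solution ≈[ n ] iterate n
      solution≈iterate n r k k<n = K.trans (iterate-stable (suc k) (n ℕ.∸ suc k) r k (ℕ.n<1+n k))
        (K.reflexive (≡.cong (λ t → iterate t r k) (ℕ.m∸n+n≡m k<n)))

      solution-fixed : solution B.≈ op solution
      solution-fixed r k = K.sym (op-cong k (solution≈iterate k) r k (ℕ.n<1+n k))

    -- An equation in `x` alone is the case of coefficients constant in `u`, read off at `u = 0`.
    quadratic-solution : (a p q b : S.Carrier) → b 0 K.≈ K.0# →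
      Σ S.Carrier λ y → y S.≈ a S.+ b S.* (p S.* y S.+ q S.* (y S.* y))
    quadratic-solution a p q b b0 = solution 0 , solution-fixed 0
      where open Quadratic (P.constant a) (P.constant p) (P.constant q) b b0

  module KernelIdentity {c ℓ} (R : CommutativeRing c ℓ) where
    open CommutativeRing R
    open IntegralSolver R
    open import Relation.Binary.Reasoning.Setoid setoid

    -- Here `g` is `1/(1 - u)`: the fixed-point form of the equation contains the division, while
    -- the kernel identity needs the polynomial form.
    clear-denominator : ∀ u U g Y → (1# - u) * g ≈ 1# → Y ≈ (1# - U) * g + U * (0# * Y + 1# * (Y * Y)) →
      (1# - u) * Y ≈ (1# - U) + (1# - u) * (U * (Y * Y))
    clear-denominator u U g Y g-inv Y-eq = begin
      (1# - u) * Y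
        ≈⟨ *-congˡ Y-eq ⟩
      (1# - u) * ((1# - U) * g + U * (0# * Y + 1# * (Y * Y)))
        ≈⟨ solve 4 (λ u U g Y → (κ 1 :- u) :* ((κ 1 :- U) :* g :+ U :* (κ 0 :* Y :+ κ 1 :* (Y :* Y)))
             := (κ 1 :- U) :* ((κ 1 :- u) :* g) :+ (κ 1 :- u) :* (U :* (Y :* Y))) refl u U g Y ⟩
      (1# - U) * ((1# - u) * g) + (1# - u) * (U * (Y * Y))
        ≈⟨ +-congʳ (trans (*-congˡ g-inv) (*-identityʳ _)) ⟩
      (1# - U) + (1# - u) * (U * (Y * Y)) ∎

    module _ (u U V G Y : Carrier) where

      private
        2# = 1# + 1#
        N = (1# - U) - (U - u) * Y
        F = (1# - 2# * U) * (G * G * G)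
        x = U * (1# - 2# * U)

      -- The square root of the discriminant is `(U - u)(1 - 2UY)`, where `Y` solves
      -- `UY² - Y + (1 - U)/(1 - u) = 0`. Substituting it into the quadratic formula and cancelling
      -- `2U` leaves `N/(1 - 2U)`, that is `V * N`.
      kernel-identity : V * (1# - 2# * U) ≈ 1# → G * (1# - U) ≈ 1# →
        (1# - u) * Y ≈ (1# - U) + (1# - u) * (U * (Y * Y)) →
        F * ((1# - u) * ((V * N) * ((u + x) - x * (V * N)))) ≈ u
      kernel-identity V-inv G-inv Y-eq = begin
        F * ((1# - u) * ((V * N) * ((u + x) - x * (V * N))))
          ≈⟨ solve 5 (λ u U V G N → let p = κ 1 :- κ 2 :* U ; x = U :* p in
               p :* (G :* G :* G) :* ((κ 1 :- u) :* ((V :* N) :* ((u :+ x) :- x :* (V :* N))))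
               := (G :* G :* G) :* (V :* p) :* ((κ 1 :- u) :* (N :* ((u :+ x) :- U :* (V :* p) :* N)))) refl u U V G N ⟩
        (G * G * G) * (V * (1# - 2# * U)) * ((1# - u) * (N * ((u + x) - U * (V * (1# - 2# * U)) * N)))
          ≈⟨ *-cong (*-congˡ V-inv) (*-congˡ (*-congˡ (+-congˡ (-‿cong (*-congʳ (*-congˡ V-inv)))))) ⟩
        (G * G * G) * 1# * ((1# - u) * (N * ((u + x) - U * 1# * N)))
          -- `Y` survives only in `Y - UY²`, multiplied by `(1 - u)(U - u)²`; the equation of `Y`
          -- replaces `(1 - u)(Y - UY²)` by `1 - U`.
          ≈⟨ *-congˡ (solve 3 (λ u U Y → let N = (κ 1 :- U) :- (U :- u) :* Y ; x = U :* (κ 1 :- κ 2 :* U) in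
               (κ 1 :- u) :* (N :* ((u :+ x) :- U :* κ 1 :* N))
               := (κ 1 :- u) :* ((κ 1 :- U) :* (u :- U :* U))
                  :+ (U :- u) :* (U :- u) :* ((κ 1 :- u) :* Y :- (κ 1 :- u) :* (U :* (Y :* Y)))) refl u U Y) ⟩
        (G * G * G) * 1# * ((1# - u) * ((1# - U) * (u - U * U))
                           + (U - u) * (U - u) * ((1# - u) * Y - (1# - u) * (U * (Y * Y))))
          ≈⟨ *-congˡ (+-congˡ (*-congˡ (trans (+-congʳ Y-eq) (solve 2 (λ a b → (a :+ b) :- b := a) refl _ _)))) ⟩
        -- The remaining polynomial equals `u(1 - U)³`, which explains the cube of `G` in `F`.
        (G * G * G) * 1# * ((1# - u) * ((1# - U) * (u - U * U)) + (U - u) * (U - u) * (1# - U))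
          ≈⟨ solve 3 (λ u U G → (G :* G :* G) :* κ 1 :* ((κ 1 :- u) :* ((κ 1 :- U) :* (u :- U :* U)) :+ (U :- u) :* (U :- u) :* (κ 1 :- U))
               := (G :* (κ 1 :- U)) :* (G :* (κ 1 :- U)) :* (G :* (κ 1 :- U)) :* u) refl u U G ⟩
        (G * (1# - U)) * (G * (1# - U)) * (G * (1# - U)) * u
          ≈⟨ *-congʳ (*-cong (*-cong G-inv G-inv) G-inv) ⟩
        1# * 1# * 1# * u
          ≈⟨ solve 1 (λ u → κ 1 :* κ 1 :* κ 1 :* u := u) refl u ⟩
        u ∎

-- Recurrences for the coefficients of a solution of the kernel equation.

module SeriesCoefficients where

  open import Algebra.Bundles using (CommutativeRing)
  open import Data.Nat.Base as ℕ using (ℕ; zero; suc)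
  open FormalSeries

  module SeriesLemmas {c ℓ} (S : CommutativeRing c ℓ) where
    open CommutativeRing S
    open PowerSeries S
    module B = CommutativeRing seriesRing

    var : B.Carrier
    var = shift (constant 1#)

    var-⋆ : ∀ f → var B.* f B.≈ shift f
    var-⋆ f zero    = zeroˡ _
    var-⋆ f (suc n) = trans (shift-⋆ (constant 1#) f (suc n)) (B.*-identityˡ f n)

    var-cancel : ∀ f g → var B.* f B.≈ var B.* g → f B.≈ g
    var-cancel f g p n = trans (sym (var-⋆ f (suc n))) (trans (p (suc n)) (var-⋆ g (suc n)))

    head+tail : ∀ f → f B.≈ constant (f 0) B.+ var B.* (λ n → f (suc n))
    head+tail f zero    = sym (trans (+-congˡ (zeroˡ _)) (+-identityʳ _))
    head+tail f (suc n) = sym (trans (+-identityˡ _) (var-⋆ (λ n → f (suc n)) (suc n)))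

    constant-cong : ∀ {a b} → a ≈ b → constant a B.≈ constant b
    constant-cong p zero    = p
    constant-cong p (suc n) = refl

    constant-* : ∀ a b → constant (a * b) B.≈ constant a B.* constant b
    constant-* a b zero    = refl
    constant-* a b (suc n) = sym (trans (constant-⋆ a (constant b) (suc n)) (zeroʳ a))

    constant-+ : ∀ a b → constant (a + b) B.≈ constant a B.+ constant b
    constant-+ a b zero    = refl
    constant-+ a b (suc n) = sym (+-identityˡ _)

    constant-neg : ∀ a → constant (- a) B.≈ B.- constant a
    constant-neg a zero    = refl
    constant-neg a (suc n) = sym -0#≈0#
      where open import Algebra.Properties.Ring ring

    geometric : B.Carrier
    geometric _ = 1#

    geometric-inverse : (B.1# B.- var) B.* geometric B.≈ B.1#
    geometric-inverse = B.trans (B.*-congʳ {geometric} (λ n → refl)) (B.trans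
      (solve 2 (λ v g → (κ 1 :- v) :* g := g :- v :* g) (λ _ → refl) var geometric)
      λ { zero → trans (+-congˡ (trans (-‿cong (zeroˡ _)) -0#≈0#)) (+-identityʳ _)
        ; (suc n) → trans (+-congˡ (-‿cong (var-⋆ geometric (suc n)))) (-‿inverseʳ _) })
      where
      open IntegralSolver seriesRing
      open import Algebra.Properties.Ring ring

  module KernelCoefficients {c ℓ} (S : CommutativeRing c ℓ) where
    open CommutativeRing S
    open PowerSeries S
    open SeriesLemmas S
    open IntegralSolver seriesRing

    module _ (F x : Carrier) (Φ : ℕ → Carrier) (Φ0 : Φ 0 ≈ 1#)
      (E : constant F B.* ((B.1# B.- var) B.* (Φ B.* ((var B.+ constant x) B.- constant x B.* Φ))) B.≈ var) where

      private
        cF cx T₁ T₂ ch : B.Carrier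
        cF = constant F
        cx = constant x
        T₁ r = Φ (suc r)
        T₂ r = Φ (suc (suc r))
        ch = constant (Φ 1)

      Φ-split : Φ B.≈ B.1# B.+ var B.* T₁
      Φ-split = B.trans (head+tail Φ) (B.+-congʳ {var B.* T₁} (constant-cong Φ0))

      -- Since `Φ = 1 + u T₁`, the factor `(u + x) - xΦ` equals `u(1 - x T₁)`, and the kernel
      -- equation can be divided by `u`.
      cancelled : cF B.* ((B.1# B.- var) B.* (Φ B.* (B.1# B.- cx B.* T₁))) B.≈ B.1#
      cancelled = var-cancel _ _ (begin
        var B.* (cF B.* ((B.1# B.- var) B.* (Φ B.* (B.1# B.- cx B.* T₁))))
          ≈⟨ solve 5 (λ v f p x t → v :* (f :* ((κ 1 :- v) :* (p :* (κ 1 :- x :* t))))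
                        := f :* ((κ 1 :- v) :* (p :* ((v :+ x) :- x :* (κ 1 :+ v :* t))))) B.refl var cF Φ cx T₁ ⟩
        cF B.* ((B.1# B.- var) B.* (Φ B.* ((var B.+ cx) B.- cx B.* (B.1# B.+ var B.* T₁))))
          ≈⟨ B.*-congˡ {cF} (B.*-congˡ {B.1# B.- var} (B.*-congˡ {Φ} (B.+-congˡ {var B.+ cx} (B.-‿cong (B.*-congˡ {cx} Φ-split))))) ⟨
        cF B.* ((B.1# B.- var) B.* (Φ B.* ((var B.+ cx) B.- cx B.* Φ)))
          ≈⟨ E ⟩
        var
          ≈⟨ B.*-identityʳ var ⟨
        var B.* B.1# ∎)
        where open import Relation.Binary.Reasoning.Setoid B.setoid

      -- This is the constant coefficient in `u` of `cancelled`.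
      first : F ≈ 1# + x * F * Φ 1
      first = begin
        F ≈⟨ S.solve 3 (λ F x h → F S.:= (F S.:* ((S.κ 1 S.:- S.κ 0) S.:* (S.κ 1 S.:* (S.κ 1 S.:- x S.:* h)))) S.:+ x S.:* F S.:* h) refl F x (Φ 1) ⟩
        F * ((1# - 0#) * (1# * (1# - x * Φ 1))) + x * F * Φ 1
          ≈⟨ +-congʳ (*-congˡ (*-congˡ (*-congʳ (sym Φ0)))) ⟩
        F * ((1# - 0#) * (Φ 0 * (1# - x * Φ 1))) + x * F * Φ 1
          ≈⟨ +-congʳ (cancelled 0) ⟩
        1# + x * F * Φ 1 ∎
        where
        module S = IntegralSolver S
        open import Relation.Binary.Reasoning.Setoid setoid

      first-B : cF B.≈ B.1# B.+ cx B.* cF B.* ch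
      first-B = B.trans (constant-cong first) (B.trans (constant-+ _ _) (B.+-congˡ {B.1#}
        (B.trans (constant-* _ _) (B.*-congʳ {ch} (constant-* x F)))))

      -- With `T₁ = Φ 1 + u T₂`, the identity `first` turns `F(1 - x T₁)` into `1 - xF u T₂`. Hence
      -- `Φ` is the inverse of `(1 - u)(1 - xF u T₂)`, and expanding the second factor once gives
      -- the recurrence.
      renewal : Φ B.≈ geometric B.+ (cx B.* cF) B.* (var B.* (T₂ B.* Φ))
      renewal = begin
        Φ ≈⟨ B.*-identityˡ Φ ⟨
        B.1# B.* Φ
          ≈⟨ B.*-congʳ {Φ} geometric-inverse ⟨
        ((B.1# B.- var) B.* geometric) B.* Φ
          ≈⟨ solve 6 (λ v g p f x t → ((κ 1 :- v) :* g) :* p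
               := g :* ((κ 1 :- v) :* (p :* (κ 1 :- x :* f :* (v :* t)))) :+ (x :* f) :* (((κ 1 :- v) :* g) :* (v :* (t :* p))))
               B.refl var geometric Φ cF cx T₂ ⟩
        geometric B.* ((B.1# B.- var) B.* (Φ B.* (B.1# B.- cx B.* cF B.* (var B.* T₂))))
          B.+ (cx B.* cF) B.* (((B.1# B.- var) B.* geometric) B.* (var B.* (T₂ B.* Φ)))
          ≈⟨ B.+-cong (B.trans (B.*-congˡ {geometric} unit) (B.*-identityʳ geometric))
               (B.*-congˡ {cx B.* cF} (B.trans (B.*-congʳ {var B.* (T₂ B.* Φ)} geometric-inverse) (B.*-identityˡ (var B.* (T₂ B.* Φ))))) ⟩
        geometric B.+ (cx B.* cF) B.* (var B.* (T₂ B.* Φ)) ∎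
        where
        open import Relation.Binary.Reasoning.Setoid B.setoid
        T₁-split : T₁ B.≈ ch B.+ var B.* T₂
        T₁-split = head+tail T₁
        unit : (B.1# B.- var) B.* (Φ B.* (B.1# B.- cx B.* cF B.* (var B.* T₂))) B.≈ B.1#
        unit = begin
          (B.1# B.- var) B.* (Φ B.* (B.1# B.- cx B.* cF B.* (var B.* T₂)))
            ≈⟨ solve 6 (λ v p f x t h → (κ 1 :- v) :* (p :* (κ 1 :- x :* f :* (v :* t)))
                 := (κ 1 :- v) :* (p :* ((κ 1 :+ x :* f :* h) :- x :* f :* (h :+ v :* t)))) B.refl var Φ cF cx T₂ ch ⟩
          (B.1# B.- var) B.* (Φ B.* ((B.1# B.+ cx B.* cF B.* ch) B.- cx B.* cF B.* (ch B.+ var B.* T₂)))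
            ≈⟨ B.*-congˡ {B.1# B.- var} (B.*-congˡ {Φ} (B.+-cong first-B (B.-‿cong (B.*-congˡ {cx B.* cF} T₁-split)))) ⟨
          (B.1# B.- var) B.* (Φ B.* (cF B.- cx B.* cF B.* T₁))
            ≈⟨ solve 5 (λ v p f x t → (κ 1 :- v) :* (p :* (f :- x :* f :* t)) := f :* ((κ 1 :- v) :* (p :* (κ 1 :- x :* t))))
                 B.refl var Φ cF cx T₁ ⟩
          cF B.* ((B.1# B.- var) B.* (Φ B.* (B.1# B.- cx B.* T₁)))
            ≈⟨ cancelled ⟩
          B.1# ∎

      coefficients : ∀ r → Φ (suc r) ≈ 1# + x * F * (T₂ ⋆ Φ) r
      coefficients r = trans (renewal (suc r)) (+-congˡ (trans (B.*-congʳ {var B.* (T₂ B.* Φ)} (B.sym (constant-* x F)) (suc r))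
        (trans (constant-⋆ (x * F) (var B.* (T₂ B.* Φ)) (suc r)) (*-congˡ (var-⋆ (T₂ B.* Φ) (suc r))))))

-- The generating function of stack histories.

module StackHistories where

  open import Data.Integer.Base as ℤ using (ℤ; +_)
  import Data.Integer.Properties as ℤ
  open import Data.List.Base using (List; []; _∷_)
  open import Data.Nat.Base as ℕ using (ℕ; zero; suc)
  import Data.Nat.Properties as ℕ
  open import Data.Product.Base using (_,_; Σ; proj₁; proj₂)
  open import Relation.Binary.PropositionalEquality as ≡ using (_≡_)
  open FormalSeries
  open FixedPoints
  open SeriesCoefficients

  -- paths n s counts the n-step histories of a stack s, where a step either pushes 1 or
  -- selects an entry r and 1 ≤ j ≤ r, drops everything above r, and replaces r by j + 1
  -- on top of r - j.
  pathsVia : (List ℕ → ℕ) → ℕ → ℕ → List ℕ → ℕ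
  pathsVia p i zero    s = p (suc (suc i) ∷ 0 ∷ s)
  pathsVia p i (suc k) s = p (suc (suc i) ∷ suc k ∷ s) ℕ.+ pathsVia p (suc i) k s

  splits : (List ℕ → ℕ) → List ℕ → ℕ
  splits p []          = 0
  splits p (zero ∷ s)  = splits p s
  splits p (suc r ∷ s) = pathsVia p 0 r s ℕ.+ splits p s

  paths : ℕ → List ℕ → ℕ
  paths zero    s = 1
  paths (suc n) s = paths n (1 ∷ s) ℕ.+ splits (paths n) s

  module ℤx = FixedPoint ℤ.+-*-commutativeRing
  open ℤx.S
  open ℤx.X using (constant; shift; _⋆_)
  open SeriesLemmas ℤ.+-*-commutativeRing using (var; var-⋆)
  open IntegralSolver ℤx.X.seriesRing
  module S = SeriesLemmas ℤx.X.seriesRing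
  module B = ℤx.B
  open ℤx.P using () renaming (constant to lift)
  open import Relation.Binary.Reasoning.Setoid setoid

  x : Carrier
  x = var

  2# : Carrier
  2# = 1# + 1#

  -- As `b` has no constant term, substituting the equation into itself makes `e` divisible by every
  -- power of `x`.
  vanishing : ∀ {b e} → b 0 ≡ + 0 → e ≈ b * e → e ≈ 0#
  vanishing {b} {e} b0 p k = go (suc k) k (ℕ.n<1+n k)
    where
    go : ∀ n k → k ℕ.< n → e k ≡ + 0
    go (suc n) k k<n = ≡.trans (p k) (≡.trans (ℤx.contract {b} {e} {λ _ → + 0} n b0 (go n) k k<n) (zeroʳ b k))

  opaque
    -- The equation `V = 1 + 2xV²` says that `U = xV` satisfies `U = x + 2U²` and that `V` is the
    -- inverse of `1 - 2U`.
    V-exists : Σ Carrier λ y → y ≈ 1# + x * (0# * y + 2# * (y * y))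
    V-exists = ℤx.quadratic-solution 1# 0# 2# x ≡.refl

  V U : Carrier
  V = proj₁ V-exists
  U = x * V

  U0 : U 0 ≡ + 0
  U0 = ℤ.*-zeroˡ (V 0)

  V-inverse : V * (1# - 2# * U) ≈ 1#
  V-inverse = begin
    V * (1# - 2# * U)
      ≈⟨ solve 2 (λ x v → v :* (κ 1 :- κ 2 :* (x :* v)) := v :- x :* (κ 0 :* v :+ κ 2 :* (v :* v))) refl x V ⟩
    V - x * (0# * V + 2# * (V * V))
      ≈⟨ +-congʳ (proj₂ V-exists) ⟩
    (1# + x * (0# * V + 2# * (V * V))) - x * (0# * V + 2# * (V * V))
      ≈⟨ solve 1 (λ t → (κ 1 :+ t) :- t := κ 1) refl (x * (0# * V + 2# * (V * V))) ⟩
    1# ∎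

  x≈U[1-2U] : x ≈ U * (1# - 2# * U)
  x≈U[1-2U] = sym (trans (*-assoc x V (1# - 2# * U)) (trans (*-congˡ V-inverse) (*-identityʳ x)))

  opaque
    G-exists : Σ Carrier λ y → y ≈ 1# + U * (1# * y + 0# * (y * y))
    G-exists = ℤx.quadratic-solution 1# 1# 0# U U0

  G : Carrier
  G = proj₁ G-exists

  G-inverse : G * (1# - U) ≈ 1#
  G-inverse = begin
    G * (1# - U)
      ≈⟨ solve 2 (λ u g → g :* (κ 1 :- u) := g :- u :* (κ 1 :* g :+ κ 0 :* (g :* g))) refl U G ⟩
    G - U * (1# * G + 0# * (G * G))
      ≈⟨ +-congʳ (proj₂ G-exists) ⟩
    (1# + U * (1# * G + 0# * (G * G))) - U * (1# * G + 0# * (G * G))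
      ≈⟨ solve 1 (λ t → (κ 1 :+ t) :- t := κ 1) refl (U * (1# * G + 0# * (G * G))) ⟩
    1# ∎

  opaque
    -- The square root of `((1 - 2U)² - u)/(1 - u)` is encoded as `1 - 2UY`. This leaves for `Y` the
    -- contracting equation `Y = (1 - U)/(1 - u) + UY²`, with integer coefficients.
    Y-exists : Σ B.Carrier λ y → y B.≈ (B.1# B.- lift U) B.* S.geometric B.+ lift U B.* (B.0# B.* y B.+ B.1# B.* (y B.* y))
    Y-exists = solution , solution-fixed
      where open ℤx.Quadratic ((B.1# B.- lift U) B.* S.geometric) B.0# B.1# U U0

  Y : B.Carrier
  Y = proj₁ Y-exists

  -- At `u = 0` the equation of `Y` factors as `(Y - 1)(1 - U(Y + 1)) = 0`, and the second factor is
  -- invertible because `U` has no constant term.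
  Y0 : Y 0 ≈ 1#
  Y0 = begin
    Y 0              ≈⟨ solve 1 (λ y → y := (y :- κ 1) :+ κ 1) refl (Y 0) ⟩
    (Y 0 - 1#) + 1#  ≈⟨ +-congʳ (vanishing {U * (Y 0 + 1#)} {Y 0 - 1#} (≡.trans (≡.cong (ℤ._* (Y 0 + 1#) 0) U0) (ℤ.*-zeroˡ ((Y 0 + 1#) 0))) eq) ⟩
    0# + 1#          ≈⟨ +-identityˡ 1# ⟩
    1#               ∎
    where
    eq : Y 0 - 1# ≈ (U * (Y 0 + 1#)) * (Y 0 - 1#)
    eq = begin
      Y 0 - 1#
        ≈⟨ +-congʳ (proj₂ Y-exists 0) ⟩
      ((1# - U) * 1# + U * (0# * Y 0 + 1# * (Y 0 * Y 0))) - 1#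
        ≈⟨ solve 2 (λ u y → ((κ 1 :- u) :* κ 1 :+ u :* (κ 0 :* y :+ κ 1 :* (y :* y))) :- κ 1
             := (u :* (y :+ κ 1)) :* (y :- κ 1)) refl U (Y 0) ⟩
      (U * (Y 0 + 1#)) * (Y 0 - 1#) ∎

  Y-equation : (B.1# B.- S.var) B.* Y B.≈ (B.1# B.- lift U) B.+ (B.1# B.- S.var) B.* (lift U B.* (Y B.* Y))
  Y-equation = KernelIdentity.clear-denominator ℤx.P.seriesRing S.var (lift U) S.geometric Y S.geometric-inverse (proj₂ Y-exists)

  -- If the coefficients of Φ solve the recurrences Φ-suc and F̂-first below, then Φ satisfies the quadratic
  -- equation `kernel`, whose discriminant has the double root u = U; this forces F̂ and Φ.
  F̂ : Carrier
  F̂ = (1# - 2# * U) * (G * G * G)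

  -- Of the two roots of the kernel equation this is the one equal to 1 at `u = 0`; the other one
  -- vanishes there.
  Φ : B.Carrier
  Φ = lift V B.* ((B.1# B.- lift U) B.- (lift U B.- S.var) B.* Y)

  Φ0 : Φ 0 ≈ 1#
  Φ0 = begin
    V * ((1# - U) - (U - 0#) * Y 0)  ≈⟨ *-congˡ {V} (+-congˡ {1# - U} (-‿cong (*-congˡ {U - 0#} Y0))) ⟩
    V * ((1# - U) - (U - 0#) * 1#)   ≈⟨ solve 2 (λ u v → v :* ((κ 1 :- u) :- (u :- κ 0) :* κ 1) := v :* (κ 1 :- κ 2 :* u)) refl U V ⟩
    V * (1# - 2# * U)                ≈⟨ V-inverse ⟩
    1#                               ∎

  lift-1-2U : B.1# B.- (B.1# B.+ B.1#) B.* lift U B.≈ lift (1# - 2# * U)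
  lift-1-2U = B.sym (B.trans (S.constant-+ 1# (- (2# * U))) (B.+-congˡ {B.1#} (B.trans (S.constant-neg (2# * U))
    (B.-‿cong (B.trans (S.constant-* 2# U) (B.*-congʳ {lift U} (S.constant-+ 1# 1#)))))))

  lift-x : lift U B.* (B.1# B.- (B.1# B.+ B.1#) B.* lift U) B.≈ lift x
  lift-x = B.trans (B.*-congˡ {lift U} lift-1-2U) (B.trans (B.sym (S.constant-* U (1# - 2# * U))) (S.constant-cong (sym x≈U[1-2U])))

  lift-F̂ : (B.1# B.- (B.1# B.+ B.1#) B.* lift U) B.* (lift G B.* lift G B.* lift G) B.≈ lift F̂
  lift-F̂ = B.trans (B.*-cong lift-1-2U (B.trans (B.*-congʳ {lift G} (B.sym (S.constant-* G G))) (B.sym (S.constant-* (G * G) G))))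
    (B.sym (S.constant-* (1# - 2# * U) (G * G * G)))

  kernel : lift F̂ B.* ((B.1# B.- S.var) B.* (Φ B.* ((S.var B.+ lift x) B.- lift x B.* Φ))) B.≈ S.var
  kernel = B.trans
    (B.*-cong (B.sym lift-F̂) (B.*-congˡ {B.1# B.- S.var} (B.*-congˡ {Φ}
      (B.+-cong (B.+-congˡ {S.var} (B.sym lift-x)) (B.-‿cong (B.*-congʳ {Φ} (B.sym lift-x)))))))
    (KernelIdentity.kernel-identity ℤx.P.seriesRing S.var (lift U) (lift V) (lift G) Y
      (B.trans (B.*-congˡ {lift V} lift-1-2U) (B.trans (B.sym (S.constant-* V (1# - 2# * U))) (S.constant-cong V-inverse)))
      (B.trans (B.*-congˡ {lift G} (B.sym (B.trans (S.constant-+ 1# (- U)) (B.+-congˡ {B.1#} (S.constant-neg U)))))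
         (B.trans (B.sym (S.constant-* G (1# - U))) (S.constant-cong G-inverse)))
      Y-equation)

  F̂-first : F̂ ≈ 1# + x * F̂ * Φ 1
  F̂-first = KernelCoefficients.first ℤx.X.seriesRing F̂ x Φ Φ0 kernel

  Φ-suc : ∀ r → Φ (suc r) ≈ 1# + x * F̂ * ((λ k → Φ (suc (suc k))) ℤx.P.⋆ Φ) r
  Φ-suc = KernelCoefficients.coefficients ℤx.X.seriesRing F̂ x Φ Φ0 kernel


  -- A history of r ∷ s stays above s until it first selects an entry of s, so the series of
  -- a stack is the product of the contributions of its entries.
  weight : List ℕ → Carrier
  weight []      = 1#
  weight (r ∷ s) = Φ r * weight s

  P̂ : List ℕ → Carrier
  P̂ s = F̂ * weight s

  -- The choices of `j` are the summands of the convolution in `Φ-suc`; the index `i` records how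
  -- many of them have been peeled off.
  pathsVia-series : ∀ n → (∀ s → + paths n s ≡ P̂ s n) → ∀ i k s →
    + pathsVia (paths n) i k s ≡ (F̂ * ((λ r → Φ (suc (suc (i ℕ.+ r)))) ℤx.P.⋆ Φ) k * weight s) n
  pathsVia-series n IH i zero s = ≡.trans (IH (suc (suc i) ∷ 0 ∷ s)) (≡.trans
    (solve 4 (λ f a b w → f :* (a :* (b :* w)) := f :* (a :* b) :* w) refl F̂ (Φ (suc (suc i))) (Φ 0) (weight s) n)
    (≡.cong (λ t → (F̂ * (Φ (suc (suc t)) * Φ 0) * weight s) n) (≡.sym (ℕ.+-identityʳ i))))
  pathsVia-series n IH i (suc k) s = ≡.trans (≡.cong₂ ℤ._+_ (IH (suc (suc i) ∷ suc k ∷ s)) (pathsVia-series n IH (suc i) k s)) (≡.trans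
    (solve 5 (λ f a b c w → f :* (a :* (b :* w)) :+ f :* c :* w := f :* (a :* b :+ c) :* w) refl
       F̂ (Φ (suc (suc i))) (Φ (suc k)) (((λ r → Φ (suc (suc (suc (i ℕ.+ r))))) ℤx.P.⋆ Φ) k) (weight s) n)
    (*-congʳ {weight s} (*-congˡ {F̂} (+-cong {Φ (suc (suc i)) * Φ (suc k)}
      (reflexive (≡.cong (λ t → Φ (suc (suc t)) * Φ (suc k)) (≡.sym (ℕ.+-identityʳ i))))
      (ℤx.P.⋆-cong {g = Φ} (λ r → reflexive (≡.cong (λ t → Φ (suc (suc t))) (≡.sym (ℕ.+-suc i r)))) (λ r → refl) k))) n))

  -- splits only sees terms of positive degree, hence the subtraction of 1.
  splits-series : ∀ n → (∀ s → + paths n s ≡ P̂ s n) → ∀ s → + splits (paths n) s ≡ (weight s - 1#) (suc n)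
  splits-series n IH []          = ≡.refl
  splits-series n IH (zero ∷ s)  = ≡.trans (splits-series n IH s)
    (+-congʳ { - 1#} (sym (trans (*-congʳ {weight s} Φ0) (*-identityˡ (weight s)))) (suc n))
  splits-series n IH (suc r ∷ s) = ≡.trans (≡.cong₂ ℤ._+_ (pathsVia-series n IH 0 r s) (splits-series n IH s))
    (≡.trans (≡.cong (ℤ._+ (weight s - 1#) (suc n)) (≡.sym (var-⋆ (F̂ * T * weight s) (suc n))))
    (≡.trans (solve 4 (λ x f t w → x :* (f :* t :* w) :+ (w :- κ 1) := (κ 1 :+ x :* f :* t) :* w :- κ 1) refl x F̂ T (weight s) (suc n))
      (+-congʳ { - 1#} (*-congʳ {weight s} (sym (Φ-suc r))) (suc n))))
    where
    T : Carrier
    T = ((λ k → Φ (suc (suc k))) ℤx.P.⋆ Φ) r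

  F̂0 : F̂ 0 ≡ + 1
  F̂0 = ≡.trans (F̂-first 0) (≡.cong (λ t → + 1 ℤ.+ t)
    (≡.trans (*-assoc x F̂ (Φ 1) 0) (ℤ.*-zeroˡ ((F̂ * Φ 1) 0))))

  weight0 : ∀ s → weight s 0 ≡ + 1
  weight0 []          = ≡.refl
  weight0 (zero ∷ s)  = ≡.trans (*-congʳ {weight s} Φ0 0) (≡.trans (*-identityˡ (weight s) 0) (weight0 s))
  weight0 (suc r ∷ s) = ≡.trans (*-congʳ {weight s} (Φ-suc r) 0) (≡.trans
    (solve 4 (λ x f t w → (κ 1 :+ x :* f :* t) :* w := x :* (f :* t :* w) :+ w) refl x F̂ T (weight s) 0)
    (≡.trans (≡.cong (ℤ._+ weight s 0) (var-⋆ (F̂ * T * weight s) 0)) (≡.trans (ℤ.+-identityˡ (weight s 0)) (weight0 s))))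
    where
    T : Carrier
    T = ((λ k → Φ (suc (suc k))) ℤx.P.⋆ Φ) r

  -- With `W` the weight of `s`, `F̂-first` gives `F̂W - 1 = xF̂ (Φ 1) W + (W - 1)`. In positive
  -- degree the two summands are the pushes and the selections.
  paths-series : ∀ n s → + paths n s ≡ P̂ s n
  paths-series zero    s = ≡.sym (≡.cong₂ ℤ._*_ F̂0 (weight0 s))
  paths-series (suc n) s = ≡.trans (≡.cong₂ ℤ._+_ (paths-series n (1 ∷ s)) (splits-series n (paths-series n) s))
    (≡.trans (≡.cong (ℤ._+ (weight s - 1#) (suc n)) (≡.sym (var-⋆ (P̂ (1 ∷ s)) (suc n))))
    (≡.trans (solve 4 (λ x f h w → x :* (f :* (h :* w)) :+ (w :- κ 1) := (κ 1 :+ x :* f :* h) :* w :- κ 1) refl x F̂ (Φ 1) (weight s) (suc n))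
    (≡.trans (≡.cong (λ t → t ℤ.+ + 0) (*-congʳ {weight s} (sym F̂-first) (suc n))) (ℤ.+-identityʳ _))))

  F̂-paths : ∀ n → F̂ n ≡ + paths n []
  F̂-paths n = ≡.sym (≡.trans (paths-series n []) (*-identityʳ F̂ n))

-- Ballot numbers and the Catalan formula.

module BallotNumbers where

  open import Data.Nat.Base
  open import Data.Nat.Combinatorics using (_C_; nCk≡nC[n∸k]; nCk+nC[k+1]≡[n+1]C[k+1]; nCn≡1; k>n⇒nCk≡0)
  open import Data.Nat.DivMod using (_/_; m*n/n≡m)
  open import Data.Nat.Properties
  open import Data.Nat.Solver using (module +-*-Solver)
  open import Relation.Binary.PropositionalEquality
  open import Defs using (catalan)

  -- The number of `n`-step insertion histories of a 312-avoider whose lowest block has size `r`.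
  -- Its children have lowest blocks of sizes `1` to `r + 1`; the last clause is this sum with its
  -- final term split off.
  ballot : ℕ → ℕ → ℕ
  ballot zero    r       = 1
  ballot (suc n) zero    = ballot n 1
  ballot (suc n) (suc r) = ballot (suc n) r + ballot n (suc (suc r))

  nC0≡1 : ∀ n → n C 0 ≡ 1
  nC0≡1 n = trans (nCk≡nC[n∸k] {0} {n} z≤n) (nCn≡1 n)

  pascal : ∀ n k → suc n C suc k ≡ n C k + n C suc k
  pascal n k = sym (nCk+nC[k+1]≡[n+1]C[k+1] n k)

  absorption : ∀ n k → suc k * (suc n C suc k) ≡ suc n * (n C k)
  absorption zero    zero    = refl
  absorption zero    (suc k) = trans (cong (suc (suc k) *_) (k>n⇒nCk≡0 {1} {suc (suc k)} (s≤s (s≤s z≤n))))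
    (trans (*-zeroʳ k) (sym (cong (1 *_) (k>n⇒nCk≡0 {0} {suc k} (s≤s z≤n)))))
  absorption (suc n) zero    = begin
    1 * (suc (suc n) C 1)                    ≡⟨ cong (1 *_) (pascal (suc n) 0) ⟩
    1 * (suc n C 0 + suc n C 1)              ≡⟨ *-distribˡ-+ 1 (suc n C 0) (suc n C 1) ⟩
    1 * (suc n C 0) + 1 * (suc n C 1)        ≡⟨ cong₂ (λ a b → 1 * a + b) (nC0≡1 (suc n)) (absorption n 0) ⟩
    1 + suc n * (n C 0)                      ≡⟨ cong (λ t → 1 + suc n * t) (nC0≡1 n) ⟩
    suc (suc n) * 1                          ≡⟨ cong (suc (suc n) *_) (nC0≡1 (suc n)) ⟨
    suc (suc n) * (suc n C 0)                ∎
    where open ≡-Reasoning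
  absorption (suc n) (suc k) = begin
    suc (suc k) * (suc (suc n) C suc (suc k))
      ≡⟨ cong (suc (suc k) *_) (pascal (suc n) (suc k)) ⟩
    suc (suc k) * (a + suc n C suc (suc k))
      ≡⟨ *-distribˡ-+ (suc (suc k)) a _ ⟩
    (a + suc k * a) + suc (suc k) * (suc n C suc (suc k))
      ≡⟨ cong₂ (λ u v → (a + u) + v) (absorption n k) (absorption n (suc k)) ⟩
    (a + suc n * (n C k)) + suc n * (n C suc k)
      ≡⟨ +-assoc a _ _ ⟩
    a + (suc n * (n C k) + suc n * (n C suc k))
      ≡⟨ cong (a +_) (*-distribˡ-+ (suc n) (n C k) (n C suc k)) ⟨
    a + suc n * (n C k + n C suc k)
      ≡⟨ cong (λ t → a + suc n * t) (pascal n k) ⟨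
    suc (suc n) * a ∎
    where
    open ≡-Reasoning
    a = suc n C suc k

  C-symmetric : ∀ j k → (j + k) C j ≡ (j + k) C k
  C-symmetric j k = trans (nCk≡nC[n∸k] (m≤m+n j k)) (cong ((j + k) C_) (m+n∸m≡n j k))

  -- n C (k - 1), without the truncation of k - 1 at k = 0.
  _C⁻_ : ℕ → ℕ → ℕ
  n C⁻ zero  = 0
  n C⁻ suc k = n C k

  pascal⁻ : ∀ n k → suc n C k ≡ n C⁻ k + n C k
  pascal⁻ n zero    = trans (nC0≡1 (suc n)) (sym (nC0≡1 n))
  pascal⁻ n (suc k) = pascal n k

  -- This is `2n + r`, with the two successors exposed at every step in `n` so that Pascal's rule
  -- applies directly.
  size : ℕ → ℕ → ℕ
  size zero    r = r
  size (suc n) r = suc (suc (size n r))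

  size-suc : ∀ n r → size n (suc r) ≡ suc (size n r)
  size-suc zero    r = refl
  size-suc (suc n) r = cong (λ t → suc (suc t)) (size-suc n r)

  size≡ : ∀ n r → size n r ≡ n + (n + r)
  size≡ zero    r = refl
  size≡ (suc n) r = trans (cong (λ t → suc (suc t)) (size≡ n r)) (cong suc (sym (+-suc n (n + r))))

  -- The reflection principle, `ballot n r = C(2n + r, n) - C(2n + r, n - 1)`, without subtraction.
  -- Both sides obey Pascal's rule; the boundary `r = 0` uses the equality of the two middle entries
  -- of row `2n + 1`.
  ballot-reflection : ∀ n r → ballot n r + size n r C⁻ n ≡ size n r C n
  ballot-reflection zero r = sym (nC0≡1 r)
  ballot-reflection (suc n) zero = begin
    ballot n 1 + suc (suc (size n 0)) C n
      ≡⟨ cong (λ t → ballot n 1 + suc t C n) (size-suc n 0) ⟨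
    ballot n 1 + suc m C n
      ≡⟨ cong (ballot n 1 +_) (pascal⁻ m n) ⟩
    ballot n 1 + (m C⁻ n + m C n)
      ≡⟨ +-assoc (ballot n 1) _ _ ⟨
    (ballot n 1 + m C⁻ n) + m C n
      ≡⟨ cong (_+ m C n) (ballot-reflection n 1) ⟩
    m C n + m C n
      ≡⟨ cong (m C n +_) middle ⟩
    m C n + m C suc n
      ≡⟨ pascal m n ⟨
    suc m C suc n
      ≡⟨ cong (λ t → suc t C suc n) (size-suc n 0) ⟩
    suc (suc (size n 0)) C suc n ∎
    where
    open ≡-Reasoning
    m = size n 1
    middle : m C n ≡ m C suc n
    middle = subst (λ t → t C n ≡ t C suc n) (trans (cong (n +_) (+-comm 1 n)) (sym (size≡ n 1)))
      (C-symmetric n (suc n))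
  ballot-reflection (suc n) (suc r) = begin
    (ballot (suc n) r + ballot n (suc (suc r))) + suc (suc (size n (suc r))) C n
      ≡⟨ cong (λ t → (ballot (suc n) r + ballot n (suc (suc r))) + t C n) M ⟩
    (ballot (suc n) r + ballot n (suc (suc r))) + suc m C n
      ≡⟨ cong ((ballot (suc n) r + ballot n (suc (suc r))) +_) (pascal⁻ m n) ⟩
    (ballot (suc n) r + ballot n (suc (suc r))) + (m C⁻ n + m C n)
      ≡⟨ solve 4 (λ a b c d → (a :+ b) :+ (c :+ d) := (b :+ c) :+ (a :+ d)) refl (ballot (suc n) r) (ballot n (suc (suc r))) (m C⁻ n) (m C n) ⟩
    (ballot n (suc (suc r)) + m C⁻ n) + (ballot (suc n) r + m C n)
      ≡⟨ cong₂ _+_ (subst (λ t → ballot n (suc (suc r)) + t C⁻ n ≡ t C n) M′ (ballot-reflection n (suc (suc r)))) (ballot-reflection (suc n) r) ⟩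
    m C n + m C suc n
      ≡⟨ pascal m n ⟨
    suc m C suc n
      ≡⟨ cong (_C suc n) M ⟨
    suc (suc (size n (suc r))) C suc n ∎
    where
    open ≡-Reasoning
    open +-*-Solver
    m = suc (suc (size n r))
    M : suc (suc (size n (suc r))) ≡ suc m
    M = cong (λ t → suc (suc t)) (size-suc n r)
    M′ : size n (suc (suc r)) ≡ m
    M′ = trans (size-suc n (suc r)) (cong suc (size-suc n r))

  central : ∀ n → suc n * ((n + n) C⁻ n) ≡ n * ((n + n) C n)
  central zero    = refl
  central (suc n) = begin
    suc N * (suc m C n)      ≡⟨ cong (suc N *_) outer ⟩
    suc N * (suc m C suc N)  ≡⟨ absorption m N ⟩
    suc m * (m C N)          ≡⟨ cong (suc m *_) (C-symmetric n N) ⟨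
    suc m * (m C n)          ≡⟨ absorption m n ⟨
    N * (suc m C N)          ∎
    where
    open ≡-Reasoning
    N = suc n
    m = n + suc n
    outer : suc m C n ≡ suc m C suc N
    outer = subst (λ t → t C n ≡ t C suc N) (+-suc n N) (C-symmetric n (suc N))

  ballot-catalan : ∀ n → ballot n 0 ≡ catalan n
  ballot-catalan n = begin
    ballot n 0                       ≡⟨ m*n/n≡m (ballot n 0) (suc n) ⟨
    ballot n 0 * suc n / suc n       ≡⟨ cong (_/ suc n) scaled ⟩
    ((n + n) C n) / suc n             ≡⟨ cong (λ t → ((n + t) C n) / suc n) (+-identityʳ n) ⟨
    catalan n                        ∎
    where
    open ≡-Reasoning
    open +-*-Solver
    reflection : ballot n 0 + (n + n) C⁻ n ≡ (n + n) C n
    reflection = subst (λ t → ballot n 0 + t C⁻ n ≡ t C n) (trans (size≡ n 0) (cong (n +_) (+-identityʳ n))) (ballot-reflection n 0)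
    scaled : ballot n 0 * suc n ≡ (n + n) C n
    -- Multiplying `reflection` by `n + 1` turns its subtrahend into `n * C(2n, n)` by `central`,
    -- which is therefore added to both sides.
    scaled = +-cancelʳ-≡ (n * ((n + n) C n)) _ _ (begin
      ballot n 0 * suc n + n * ((n + n) C n)
        ≡⟨ cong (ballot n 0 * suc n +_) (central n) ⟨
      ballot n 0 * suc n + suc n * ((n + n) C⁻ n)
        ≡⟨ cong (_+ suc n * ((n + n) C⁻ n)) (*-comm (ballot n 0) (suc n)) ⟩
      suc n * ballot n 0 + suc n * ((n + n) C⁻ n)
        ≡⟨ *-distribˡ-+ (suc n) (ballot n 0) _ ⟨
      suc n * (ballot n 0 + (n + n) C⁻ n)
        ≡⟨ cong (suc n *_) reflection ⟩
      (n + n) C n + n * ((n + n) C n) ∎)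

-- The Catalan series, square roots and the closed form.

module GeneratingFunctions where

  open import Data.Integer.Base as ℤ using (ℤ; +_)
  import Data.Integer.Properties as ℤ
  open import Data.List.Base using ([])
  open import Data.List.Properties using (map-applyUpTo)
  open import Data.Nat.Base as ℕ using (ℕ; zero; suc)
  import Data.Nat.Properties as ℕ
  open import Data.Product.Base using (Σ; proj₁; proj₂)
  open import Relation.Binary.PropositionalEquality as ≡ using (_≡_)
  open import Defs
  open FormalSeries
  open SeriesCoefficients
  open StackHistories
  open BallotNumbers

  open ℤx.S
  open ℤx.X using (constant; shift; _⋆_)
  open SeriesLemmas ℤ.+-*-commutativeRing using (var; var-⋆)
  open IntegralSolver ℤx.X.seriesRing
  open import Relation.Binary.Reasoning.Setoid setoid

  Σ<-suc : ∀ n f → Σ< (suc n) f ≡ f 0 ℤ.+ Σ< n (λ i → f (suc i))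
  Σ<-suc n f = ≡.cong (λ l → f 0 ℤ.+ sumℤ l)
    (≡.trans (map-applyUpTo suc f n) (≡.sym (map-applyUpTo (λ i → i) (λ i → f (suc i)) n)))

  Σ<-cong : ∀ n {f g} → (∀ i → i ℕ.< n → f i ≡ g i) → Σ< n f ≡ Σ< n g
  Σ<-cong zero    p = ≡.refl
  Σ<-cong (suc n) {f} {g} p = ≡.trans (Σ<-suc n f) (≡.trans
    (≡.cong₂ ℤ._+_ (p 0 (ℕ.s≤s ℕ.z≤n)) (Σ<-cong n (λ i i<n → p (suc i) (ℕ.s≤s i<n)))) (≡.sym (Σ<-suc n g)))

  Σ<-last : ∀ n f → Σ< (suc n) f ≡ Σ< n f ℤ.+ f n
  Σ<-last zero    f = ≡.trans (ℤ.+-identityʳ (f 0)) (≡.sym (ℤ.+-identityˡ (f 0)))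
  Σ<-last (suc n) f = ≡.trans (Σ<-suc (suc n) f) (≡.trans (≡.cong (λ t → f 0 ℤ.+ t) (Σ<-last n (λ i → f (suc i))))
    (≡.trans (≡.sym (ℤ.+-assoc (f 0) _ _)) (≡.cong (ℤ._+ f (suc n)) (≡.sym (Σ<-suc n f)))))

  ⊗≈* : ∀ f g → f ⊗ g ≈ f * g
  ⊗≈* f g zero    = ℤ.+-identityʳ _
  ⊗≈* f g (suc n) = ≡.trans (Σ<-suc (suc n) (λ k → f k ℤ.* g (suc n ℕ.∸ k)))
    (≡.cong (λ t → f 0 ℤ.* g (suc n) ℤ.+ t) (⊗≈* (λ k → f (suc k)) g n))

  ⊗-cong : ∀ {f f′ g g′} → f ≈ f′ → g ≈ g′ → f ⊗ g ≈ f′ * g′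
  ⊗-cong {f} {g = g} p q = trans (⊗≈* f g) (*-cong p q)

  opaque
    C-exists : Σ Carrier λ y → y ≈ 1# + x * (0# * y + 1# * (y * y))
    C-exists = ℤx.quadratic-solution 1# 0# 1# x ≡.refl

  C : Carrier
  C = proj₁ C-exists

  C-equation : C ≈ 1# + x * (C * C)
  C-equation = trans (proj₂ C-exists) (solve 2 (λ x c → κ 1 :+ x :* (κ 0 :* c :+ κ 1 :* (c :* c)) := κ 1 :+ x :* (c :* c)) refl x C)

  C0 : C 0 ≡ + 1
  C0 = ≡.trans (C-equation 0) (≡.cong (λ t → + 1 ℤ.+ t) (ℤ.*-zeroˡ ((C * C) 0)))

  C^ : ℕ → Carrier
  C^ zero    = 1#
  C^ (suc r) = C * C^ r

  C^-constant : ∀ r → C^ r 0 ≡ + 1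
  C^-constant zero    = ≡.refl
  C^-constant (suc r) = ≡.cong₂ ℤ._*_ C0 (C^-constant r)

  C^-suc : ∀ r n → C^ (suc r) (suc n) ≡ C^ r (suc n) ℤ.+ C^ (suc (suc r)) n
  C^-suc r n = ≡.trans (*-congʳ {C^ r} C-equation (suc n))
    (≡.trans (solve 3 (λ x c p → (κ 1 :+ x :* (c :* c)) :* p := p :+ x :* (c :* (c :* p))) refl x C (C^ r) (suc n))
    (≡.cong (λ t → C^ r (suc n) ℤ.+ t) (var-⋆ (C * (C * C^ r)) (suc n))))

  -- Multiplying `C = 1 + xC²` by `C^r` gives `C^(r+1) = C^r + xC^(r+2)`, which is the recurrence of
  -- the ballot numbers.
  ballot-series : ∀ n r → + ballot n r ≡ C^ (suc r) n
  ballot-series zero    r       = ≡.sym (C^-constant (suc r))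
  ballot-series (suc n) zero    = ≡.trans (ballot-series n 1) (≡.sym (≡.trans (C^-suc 0 n) (ℤ.+-identityˡ _)))
  ballot-series (suc n) (suc r) = ≡.trans (≡.cong₂ ℤ._+_ (ballot-series (suc n) r) (ballot-series n (suc (suc r))))
    (≡.sym (C^-suc (suc r) n))

  C-ballot : ∀ n → C n ≡ + ballot n 0
  C-ballot n = ≡.sym (≡.trans (ballot-series n 0) (*-identityʳ C n))

  C-unit : C * (1# - x * C) ≈ 1#
  C-unit = begin
    C * (1# - x * C)                       ≈⟨ solve 2 (λ x c → c :* (κ 1 :- x :* c) := c :- x :* (c :* c)) refl x C ⟩
    C - x * (C * C)                        ≈⟨ +-congʳ C-equation ⟩
    (1# + x * (C * C)) - x * (C * C)       ≈⟨ solve 2 (λ x c → (κ 1 :+ x :* (c :* c)) :- x :* (c :* c) := κ 1) refl x C ⟩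
    1#                                     ∎

  -- The hypothesis means `J = 1 - 1/C`, and `1 - xC` is the inverse of `C`.
  renewal-quotient : ∀ {J} → C ≈ 1# + J * C → J ≈ x * C
  renewal-quotient {J} eq = begin
    J                                          ≈⟨ *-identityʳ J ⟨
    J * 1#                                     ≈⟨ *-congˡ C-unit ⟨
    J * (C * (1# - x * C))                     ≈⟨ solve 3 (λ j c x → j :* (c :* (κ 1 :- x :* c)) := ((κ 1 :+ j :* c) :- κ 1) :* (κ 1 :- x :* c)) refl J C x ⟩
    ((1# + J * C) - 1#) * (1# - x * C)         ≈⟨ *-congʳ {1# - x * C} (+-congʳ { - 1#} (trans (sym eq) C-equation)) ⟩
    ((1# + x * (C * C)) - 1#) * (1# - x * C)   ≈⟨ solve 2 (λ c x → ((κ 1 :+ x :* (c :* c)) :- κ 1) :* (κ 1 :- x :* c) := x :* c :* (c :* (κ 1 :- x :* c))) refl C x ⟩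
    x * C * (C * (1# - x * C))                 ≈⟨ *-congˡ {x * C} C-unit ⟩
    x * C * 1#                                 ≈⟨ *-identityʳ (x * C) ⟩
    x * C                                      ∎

  -- The factor `1 - xC` is `(√(1 - 4x) + 1)/2`.
  Î : Carrier
  Î = (F̂ - 1#) * (1# - x * C)

  indecomposable-series : ∀ {A I J} → A ≈ F̂ → J ≈ x * C → A ≈ 1# + I + J * (A - 1#) → I ≈ Î
  indecomposable-series {A} {I} {J} A≈ J≈ eq = begin
    I                                        ≈⟨ solve 3 (λ a i j → i := ((κ 1 :+ i :+ j :* (a :- κ 1)) :- κ 1) :- j :* (a :- κ 1)) refl A I J ⟩
    ((1# + I + J * (A - 1#)) - 1#) - J * (A - 1#)
                                             ≈⟨ +-cong (+-congʳ { - 1#} (sym eq)) (-‿cong (*-congʳ {A - 1#} J≈)) ⟩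
    (A - 1#) - x * C * (A - 1#)              ≈⟨ +-cong (+-congʳ { - 1#} A≈) (-‿cong (*-congˡ {x * C} (+-congʳ { - 1#} A≈))) ⟩
    (F̂ - 1#) - x * C * (F̂ - 1#)              ≈⟨ solve 2 (λ f t → (f :- κ 1) :- t :* (f :- κ 1) := (f :- κ 1) :* (κ 1 :- t)) refl F̂ (x * C) ⟩
    Î                                        ∎

  Î-coefficient : ∀ m → Î (suc (suc m)) ≡ F̂ (suc (suc m)) ℤ.- Σ< (suc m) (λ i → C i ℤ.* F̂ (suc m ℕ.∸ i))
  Î-coefficient m = ≡.trans
    (solve 3 (λ f c x → (f :- κ 1) :* (κ 1 :- x :* c) := (f :- κ 1) :- x :* (c :* (f :- κ 1))) refl F̂ C x (suc (suc m)))
    (≡.cong₂ ℤ._-_ (ℤ.+-identityʳ (F̂ (suc (suc m)))) (≡.trans (var-⋆ (C * (F̂ - 1#)) (suc (suc m)))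
      (≡.trans (≡.sym (⊗≈* C (F̂ - 1#) (suc m)))
      (≡.trans (Σ<-last (suc m) (λ k → C k ℤ.* (F̂ - 1#) (suc m ℕ.∸ k)))
      -- The last term of the convolution meets the constant coefficient of `F̂ - 1`, which is zero;
      -- hence the sum for `n = m + 2` stops at `i = n - 2`.
      (≡.trans (≡.cong₂ ℤ._+_ (Σ<-cong (suc m) (λ i i<m → ≡.cong (C i ℤ.*_) (positive i i<m))) last)
        (ℤ.+-identityʳ (Σ< (suc m) (λ i → C i ℤ.* F̂ (suc m ℕ.∸ i)))))))))
    where
    positive : ∀ i → i ℕ.< suc m → (F̂ - 1#) (suc m ℕ.∸ i) ≡ F̂ (suc m ℕ.∸ i)
    positive i i<m rewrite ℕ.+-∸-assoc 1 (ℕ.≤-pred i<m) = ℤ.+-identityʳ (F̂ (suc (m ℕ.∸ i)))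
    last : C (suc m) ℤ.* (F̂ - 1#) (suc m ℕ.∸ suc m) ≡ + 0
    last = ≡.trans (≡.cong (λ t → C (suc m) ℤ.* (F̂ - 1#) t) (ℕ.n∸n≡0 m))
      (≡.trans (≡.cong (λ t → C (suc m) ℤ.* (t ℤ.- + 1)) F̂0) (ℤ.*-zeroʳ (C (suc m))))

  -- The variant of `vanishing` with a factor 2, which is not invertible in the integers but can be
  -- cancelled coefficient by coefficient.
  double-vanishing : ∀ {b e} → b 0 ≡ + 0 → 2# * e ≈ b * e → e ≈ 0#
  double-vanishing {b} {e} b0 p k = go (suc k) k (ℕ.n<1+n k)
    where
    halve : ∀ i → i ℤ.+ i ≡ + 0 → i ≡ + 0
    halve (+ zero)      _ = ≡.refl
    halve (+ suc n)     ()
    halve (ℤ.-[1+ n ])  ()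
    doubled : 2# * e ≈ e + e
    doubled = solve 1 (λ e → κ 2 :* e := e :+ e) refl e
    go : ∀ n k → k ℕ.< n → e k ≡ + 0
    go (suc n) k k<n = halve (e k) (≡.trans (≡.sym (doubled k)) (≡.trans (p k)
      (≡.trans (ℤx.contract {b} {e} {λ _ → + 0} n b0 (go n) k k<n) (zeroʳ b k))))

  -- For `e = f - g` the equation `(f + g) e = 0` reads `2e = (2 - (f + g)) e`, and both constant
  -- terms being 1 makes the factor on the right contracting.
  sqrt-unique : ∀ {f g} → f 0 ≡ + 1 → g 0 ≡ + 1 → f * f ≈ g * g → f ≈ g
  sqrt-unique {f} {g} f0 g0 eq = begin
    f            ≈⟨ solve 2 (λ f g → f := (f :- g) :+ g) refl f g ⟩
    (f - g) + g  ≈⟨ +-congʳ (double-vanishing {2# - (f + g)} {f - g} (≡.cong₂ (λ a b → + 2 ℤ.- (a ℤ.+ b)) f0 g0) eq′) ⟩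
    0# + g       ≈⟨ +-identityˡ g ⟩
    g            ∎
    where
    eq′ : 2# * (f - g) ≈ (2# - (f + g)) * (f - g)
    eq′ = begin
      2# * (f - g)                                ≈⟨ solve 2 (λ f g → κ 2 :* (f :- g) := (κ 2 :- (f :+ g)) :* (f :- g) :+ (f :* f :- g :* g)) refl f g ⟩
      (2# - (f + g)) * (f - g) + (f * f - g * g)  ≈⟨ +-congˡ {(2# - (f + g)) * (f - g)} (trans (+-congʳ { - (g * g)} eq) (-‿inverseʳ (g * g))) ⟩
      (2# - (f + g)) * (f - g) + 0#               ≈⟨ +-identityʳ _ ⟩
      (2# - (f + g)) * (f - g)                    ∎

  constant-nat : ∀ n → constS (+ n) ≈ nat n
  constant-nat zero          zero    = ≡.refl
  constant-nat zero          (suc _) = ≡.refl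
  constant-nat 1             zero    = ≡.refl
  constant-nat 1             (suc _) = ≡.refl
  constant-nat (suc (suc n)) zero    = ≡.trans (≡.cong +_ (≡.sym (ℕ.+-comm (suc n) 1))) (≡.cong (ℤ._+ + 1) (constant-nat (suc n) 0))
  constant-nat (suc (suc n)) (suc k) = ≡.cong (ℤ._+ + 0) (constant-nat (suc n) (suc k))

  monomial-suc : ∀ c k → monoS c (suc k) ≈ x * monoS c k
  monomial-suc c k zero    = ≡.refl
  monomial-suc c k (suc n) = ≡.sym (var-⋆ (monoS c k) (suc n))

  linear-monomial : ∀ n → monoS (+ n) 1 ≈ nat n * x
  linear-monomial n = trans (monomial-suc (+ n) 0) (trans (*-congˡ {x} (constant-nat n)) (*-comm x (nat n)))

  quadratic-monomial : ∀ n → monoS (+ n) 2 ≈ nat n * x * x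
  quadratic-monomial n = trans (monomial-suc (+ n) 1) (trans (*-congˡ {x} (linear-monomial n)) (*-comm x (nat n * x)))

  S≈ : ∀ {S} → S 0 ≡ + 1 → S ⊗ S ≋ constS (+ 1) ⊖ monoS (+ 4) 1 → S ≈ 1# - 2# * (x * C)
  S≈ {S} S0 S² = sqrt-unique S0 (≡.cong (λ t → + 1 ℤ.- + 2 ℤ.* t) (ℤ.*-zeroˡ (C 0))) (begin
    S * S                                    ≈⟨ ⊗≈* S S ⟨
    S ⊗ S                                    ≈⟨ S² ⟩
    constS (+ 1) ⊖ monoS (+ 4) 1             ≈⟨ +-cong (constant-nat 1) (-‿cong (linear-monomial 4)) ⟩
    -- The term `4x(C - xC²)` is subtracted and added so that `C - xC² = 1` applies; `(1 - 2xC)²` is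
    -- `1 - 4x(C - xC²)`.
    1# - nat 4 * x                           ≈⟨ solve 2 (λ c x → κ 1 :- κ 4 :* x := κ 1 :- κ 4 :* x :* (c :- (x :* (c :* c))) :+ κ 4 :* x :* ((c :- x :* (c :* c)) :- κ 1)) refl C x ⟩
    1# - nat 4 * x * (C - x * (C * C)) + nat 4 * x * ((C - x * (C * C)) - 1#)
       ≈⟨ +-congˡ {1# - nat 4 * x * (C - x * (C * C))} (*-congˡ {nat 4 * x} (+-congʳ { - 1#} unit)) ⟩
    1# - nat 4 * x * (C - x * (C * C)) + nat 4 * x * (1# - 1#)
       ≈⟨ solve 2 (λ c x → κ 1 :- κ 4 :* x :* (c :- (x :* (c :* c))) :+ κ 4 :* x :* (κ 1 :- κ 1) := (κ 1 :- κ 2 :* (x :* c)) :* (κ 1 :- κ 2 :* (x :* c))) refl C x ⟩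
    (1# - 2# * (x * C)) * (1# - 2# * (x * C)) ∎)
    where
    unit : C - x * (C * C) ≈ 1#
    unit = trans (solve 2 (λ x c → c :- x :* (c :* c) := c :* (κ 1 :- x :* c)) refl x C) C-unit

  -- Because `1 - 8x = (1 - 4U)²`, this is `(1 - 8x)^(3/2)`, a polynomial in `U`.
  T̂ : Carrier
  T̂ = (1# - nat 4 * U) * (1# - nat 4 * U) * (1# - nat 4 * U)

  discriminant : 1# - nat 8 * x ≈ (1# - nat 4 * U) * (1# - nat 4 * U)
  discriminant = trans (+-congˡ {1#} (-‿cong (*-congˡ {nat 8} x≈U[1-2U])))
    (solve 1 (λ u → κ 1 :- κ 8 :* (u :* (κ 1 :- κ 2 :* u)) := (κ 1 :- κ 4 :* u) :* (κ 1 :- κ 4 :* u)) refl U)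

  T≈ : ∀ {T} → T 0 ≡ + 1 →
    T ⊗ T ≋ (constS (+ 1) ⊖ monoS (+ 8) 1) ⊗ (constS (+ 1) ⊖ monoS (+ 8) 1) ⊗ (constS (+ 1) ⊖ monoS (+ 8) 1) → T ≈ T̂
  T≈ {T} T0 T² = sqrt-unique T0 (≡.cong (λ t → (+ 1 ℤ.- + 4 ℤ.* t) ℤ.* (+ 1 ℤ.- + 4 ℤ.* t) ℤ.* (+ 1 ℤ.- + 4 ℤ.* t)) U0) (begin
    T * T      ≈⟨ ⊗≈* T T ⟨
    T ⊗ T      ≈⟨ T² ⟩
    Q ⊗ Q ⊗ Q  ≈⟨ ⊗-cong (⊗-cong Q≈ Q≈) Q≈ ⟩
    R * R * R  ≈⟨ solve 1 (λ r → (r :* r) :* (r :* r) :* (r :* r) := (r :* r :* r) :* (r :* r :* r)) refl (1# - nat 4 * U) ⟩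
    T̂ * T̂      ∎)
    where
    Q R : Carrier
    Q = constS (+ 1) ⊖ monoS (+ 8) 1
    R = (1# - nat 4 * U) * (1# - nat 4 * U)
    Q≈ : Q ≈ R
    Q≈ = trans (+-cong (constant-nat 1) (-‿cong (linear-monomial 8))) discriminant

  -- This is `1 + 20x - 8x² - (1 - 8x)^(3/2)` after the substitution `x = U(1 - 2U)`. Dividing `32x`
  -- by it gives `(1 - 2U)/(1 - U)³`.
  D̂ : Carrier
  D̂ = nat 32 * (U * ((1# - U) * (1# - U) * (1# - U)))

  D≈ : ∀ {T} → T ≈ T̂ → constS (+ 1) ⊕ monoS (+ 20) 1 ⊖ monoS (+ 8) 2 ⊖ T ≈ D̂
  D≈ {T} T≈T̂ = begin
    constS (+ 1) ⊕ monoS (+ 20) 1 ⊖ monoS (+ 8) 2 ⊖ T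
      ≈⟨ +-cong (+-cong (+-cong (constant-nat 1) (trans (linear-monomial 20) (*-congˡ {nat 20} x≈U[1-2U])))
           (-‿cong (trans (quadratic-monomial 8) (*-cong (*-congˡ {nat 8} x≈U[1-2U]) x≈U[1-2U])))) (-‿cong T≈T̂) ⟩
    ((1# + nat 20 * (U * (1# - 2# * U))) - nat 8 * (U * (1# - 2# * U)) * (U * (1# - 2# * U))) - T̂
      ≈⟨ solve 1 (λ u → let x = u :* (κ 1 :- κ 2 :* u) ; r = κ 1 :- κ 4 :* u ; v = κ 1 :- u in
           ((κ 1 :+ κ 20 :* x) :- κ 8 :* x :* x) :- r :* r :* r := κ 32 :* (u :* (v :* v :* v))) refl U ⟩
    D̂ ∎

  F̂D̂ : F̂ * D̂ ≈ nat 32 * x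
  F̂D̂ = begin
    F̂ * D̂
      ≈⟨ solve 2 (λ u g → let v = κ 1 :- u ; p = κ 1 :- κ 2 :* u in
           (p :* (g :* g :* g)) :* (κ 32 :* (u :* (v :* v :* v)))
           := κ 32 :* ((u :* p) :* ((g :* v) :* (g :* v) :* (g :* v)))) refl U G ⟩
    nat 32 * ((U * (1# - 2# * U)) * ((G * (1# - U)) * (G * (1# - U)) * (G * (1# - U))))
      ≈⟨ *-congˡ {nat 32} (*-cong (sym x≈U[1-2U]) (*-cong (*-cong G-inverse G-inverse) G-inverse)) ⟩
    nat 32 * (x * (1# * 1# * 1#))
      ≈⟨ solve 1 (λ x → κ 32 :* (x :* (κ 1 :* κ 1 :* κ 1)) := κ 32 :* x) refl x ⟩
    nat 32 * x ∎

  -- In terms of `U` and `C` both sides become `2(1 - xC)(F̂ - 1)D̂`, since `F̂D̂ = 32x`.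
  generating-function : ∀ {I S T} → I ≈ Î → S 0 ≡ + 1 → S ⊗ S ≋ constS (+ 1) ⊖ monoS (+ 4) 1 → T 0 ≡ + 1 →
    T ⊗ T ≋ (constS (+ 1) ⊖ monoS (+ 8) 1) ⊗ (constS (+ 1) ⊖ monoS (+ 8) 1) ⊗ (constS (+ 1) ⊖ monoS (+ 8) 1) →
    constS (+ 2) ⊗ I ⊗ (constS (+ 1) ⊕ monoS (+ 20) 1 ⊖ monoS (+ 8) 2 ⊖ T)
      ≋ (S ⊕ constS (+ 1)) ⊗ (monoS (+ 32) 1 ⊖ (constS (+ 1) ⊕ monoS (+ 20) 1 ⊖ monoS (+ 8) 2 ⊖ T))
  generating-function {I} {S} {T} I≈ S0 S² T0 T² = begin
    constS (+ 2) ⊗ I ⊗ D                                   ≈⟨ ⊗-cong (⊗-cong (constant-nat 2) I≈) (D≈ T≈T̂) ⟩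
    nat 2 * Î * D̂                                          ≈⟨ solve 4 (λ f x c d → κ 2 :* ((f :- κ 1) :* (κ 1 :- x :* c)) :* d
                                                                := ((κ 1 :- κ 2 :* (x :* c)) :+ κ 1) :* (f :* d :- d)) refl F̂ x C D̂ ⟩
    ((1# - 2# * (x * C)) + 1#) * (F̂ * D̂ - D̂)               ≈⟨ *-congˡ {(1# - 2# * (x * C)) + 1#} (+-congʳ { - D̂} F̂D̂) ⟩
    ((1# - 2# * (x * C)) + 1#) * (nat 32 * x - D̂)          ≈⟨ ⊗-cong {S ⊕ constS (+ 1)} {g = monoS (+ 32) 1 ⊖ D} (+-cong (S≈ {S} S0 S²) (constant-nat 1)) (+-cong (linear-monomial 32) (-‿cong (D≈ T≈T̂))) ⟨
    (S ⊕ constS (+ 1)) ⊗ (monoS (+ 32) 1 ⊖ D)              ∎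
    where
    D : Carrier
    D = constS (+ 1) ⊕ monoS (+ 20) 1 ⊖ monoS (+ 8) 2 ⊖ T
    T≈T̂ : T ≈ T̂
    T≈T̂ = T≈ {T} T0 T²

-- Permutations: insertion trees, symmetries and direct sums.

module Combinatorics where

  open import Data.Bool.Base using (Bool; true; false; T; not; if_then_else_; _∧_)
  open import Data.Bool.Properties using (T-∧; T?; T-≡)
  open import Data.Empty using (⊥-elim; ⊥)
  open import Data.List.Base using (List; []; _∷_; _++_; length; map; concatMap; upTo; filterᵇ; applyUpTo; reverse; take; drop)
  open import Data.List.Membership.Propositional using (_∈_; find; lose)
  open import Data.List.Membership.Propositional.Properties using (∈-map⁺; ∈-map⁻; ∈-++⁺ˡ; ∈-++⁺ʳ; ∈-++⁻; ∈-concatMap⁺; ∈-upTo⁺; ∈-upTo⁻; ∈-filter⁺; ∈-filter⁻; ∈-∃++)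
  open import Data.List.Properties using (length-map; length-++; length-upTo; ∷-injective; map-∘; map-id-local; map-applyUpTo; ++-assoc; ++-identityʳ; length-reverse; reverse-map; reverse-involutive; unfold-reverse; length-take; length-drop; take-take; take-all; take++drop≡id; ++-cancelˡ)
  open import Data.List.Relation.Binary.Pointwise using (Pointwise; []; _∷_)
  open import Data.List.Relation.Binary.Sublist.Propositional using (_⊆_; []; _∷_; _∷ʳ_; from∈; to∈)
  open import Data.List.Relation.Binary.Sublist.Propositional.Properties using (map⁺; ∷ˡ⁻; reverse⁺; []⊆-universal; ++⁺; ++⁺ˡ; ++⁺ʳ)
  open import Data.List.Relation.Unary.All as All using (All; []; _∷_)
  open import Data.List.Relation.Unary.All.Properties using (¬Any⇒All¬; All¬⇒¬Any; all⁺; all⁻)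
  open import Data.List.Relation.Unary.AllPairs using ([]; _∷_)
  open import Data.List.Relation.Unary.Any as Any using (Any; here; there)
  open import Data.List.Relation.Unary.Any.Properties using (any⁺; any⁻; reverse⁻)
  open import Data.List.Relation.Unary.Unique.Propositional using (Unique)
  import Data.List.Relation.Unary.Unique.Propositional.Properties as Unique
  open import Data.Nat.Base
  open import Data.Nat.ListAction using (sum)
  open import Data.Nat.Properties
  open import Data.Product.Base using (_×_; _,_; ∃; proj₁; proj₂)
  open import Data.Sum.Base using (inj₁; inj₂; _⊎_)
  open import Defs
  open import Function.Base using (_∘_)
  open import Function.Bundles using (Equivalence)
  open StackHistories using (paths; splits; pathsVia)
  open BallotNumbers using (ballot)
  open import Relation.Binary.Definitions using (tri<; tri≈; tri>)
  open import Relation.Binary.PropositionalEquality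
  open import Relation.Nullary using (¬_; yes; no)

  -- Permutations

  private
    variable
      A B : Set

  -- Pigeonhole principle: every element of `xs` removes an occurrence of its own from `ys`.
  length-≤ : {xs ys : List A} → Unique xs → (∀ {x} → x ∈ xs → x ∈ ys) → length xs ≤ length ys
  length-≤ {xs = []}     _          sub = z≤n
  length-≤ {xs = x ∷ xs} (x∉ ∷ uxs) sub with ∈-∃++ (sub (here refl))
  ... | as , bs , refl = subst (suc (length xs) ≤_) (trans (cong suc (length-++ as)) (trans (sym (+-suc (length as) (length bs))) (sym (length-++ as))))
          (s≤s (length-≤ uxs sub′))
    where
    sub′ : ∀ {y} → y ∈ xs → y ∈ as ++ bs
    sub′ {y} y∈ with ∈-++⁻ as (sub (there y∈))
    ... | inj₁ y∈as         = ∈-++⁺ˡ y∈as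
    ... | inj₂ (here refl)  = ⊥-elim (All¬⇒¬Any x∉ y∈)
    ... | inj₂ (there y∈bs) = ∈-++⁺ʳ as y∈bs

  unique-map : {f : A → B} {xs : List A} → (∀ {x y} → x ∈ xs → y ∈ xs → f x ≡ f y → x ≡ y) →
               Unique xs → Unique (map f xs)
  unique-map {xs = []}     inj _        = []
  unique-map {f = f} {xs = x ∷ xs} inj (x∉ ∷ u) = All.tabulate fresh ∷ unique-map (λ p q → inj (there p) (there q)) u
    where
    fresh : ∀ {z} → z ∈ map f xs → f x ≢ z
    fresh z∈ refl with ∈-map⁻ f z∈
    ... | y , y∈ , eq = All.lookup x∉ y∈ (inj (here refl) (there y∈) eq)

  ∈-concatMap : {f : A → List B} {xs : List A} {x : A} {y : B} → x ∈ xs → y ∈ f x → y ∈ concatMap f xs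
  ∈-concatMap x∈ y∈ = ∈-concatMap⁺ _ (Any.map (λ { refl → y∈ }) x∈)

  ∈-concatMap⁻′ : {f : A → List B} (xs : List A) {y : B} → y ∈ concatMap f xs → ∃ λ x → x ∈ xs × y ∈ f x
  ∈-concatMap⁻′ {f = f} (x ∷ xs) y∈ with ∈-++⁻ (f x) y∈
  ... | inj₁ p = x , here refl , p
  ... | inj₂ p = let x′ , q , r = ∈-concatMap⁻′ xs p in x′ , there q , r

  unique-concatMap : {f : A → List B} {xs : List A} → Unique xs → (∀ {x} → x ∈ xs → Unique (f x)) →
    (∀ {x x′ y} → x ∈ xs → x′ ∈ xs → y ∈ f x → y ∈ f x′ → x ≡ x′) → Unique (concatMap f xs)
  unique-concatMap {xs = []} _ _ _ = []
  unique-concatMap {f = f} {xs = x ∷ xs} (x∉ ∷ u) uf key = Unique.++⁺ (uf (here refl))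
    (unique-concatMap u (uf ∘ there) (λ p q → key (there p) (there q)))
    λ { (y∈ , y∈′) → let x′ , x′∈ , y∈fx′ = ∈-concatMap⁻′ xs y∈′ in All.lookup x∉ x′∈ (key (here refl) (there x′∈) y∈ y∈fx′) }

  bit : Bool → ℕ
  bit b = if b then 1 else 0

  count-∷ : ∀ p x xs → count p (x ∷ xs) ≡ bit (p x) + count p xs
  count-∷ p x xs with p x
  ... | true  = refl
  ... | false = refl

  count-++ : ∀ p xs ys → count p (xs ++ ys) ≡ count p xs + count p ys
  count-++ p []       ys = refl
  count-++ p (x ∷ xs) ys = begin
    count p (x ∷ xs ++ ys)                   ≡⟨ count-∷ p x (xs ++ ys) ⟩
    bit (p x) + count p (xs ++ ys)           ≡⟨ cong (bit (p x) +_) (count-++ p xs ys) ⟩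
    bit (p x) + (count p xs + count p ys)    ≡⟨ +-assoc (bit (p x)) _ _ ⟨
    bit (p x) + count p xs + count p ys      ≡⟨ cong (_+ count p ys) (count-∷ p x xs) ⟨
    count p (x ∷ xs) + count p ys            ∎
    where open ≡-Reasoning

  count-map : ∀ p f xs → count p (map f xs) ≡ count (p ∘ f) xs
  count-map p f []       = refl
  count-map p f (x ∷ xs) = trans (count-∷ p (f x) (map f xs))
    (trans (cong (bit (p (f x)) +_) (count-map p f xs)) (sym (count-∷ (p ∘ f) x xs)))

  count-cong : ∀ {p q} xs → (∀ {x} → x ∈ xs → p x ≡ q x) → count p xs ≡ count q xs
  count-cong []       _  = refl
  count-cong {p} {q} (x ∷ xs) eq = trans (count-∷ p x xs)
    (trans (cong₂ (λ b c → bit b + c) (eq (here refl)) (count-cong xs (eq ∘ there))) (sym (count-∷ q x xs)))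

  count-not : ∀ p xs → count p xs + count (not ∘ p) xs ≡ length xs
  count-not p []       = refl
  count-not p (x ∷ xs) with p x
  ... | true  = cong suc (count-not p xs)
  ... | false = trans (+-suc (count p xs) _) (cong suc (count-not p xs))

  count-≤ : ∀ {p q xs ys} (f : List ℕ → List ℕ) → Unique xs →
    (∀ {x y} → x ∈ xs → y ∈ xs → f x ≡ f y → x ≡ y) →
    (∀ {x} → x ∈ xs → T (p x) → f x ∈ ys × T (q (f x))) → count p xs ≤ count q ys
  count-≤ {p} {q} {xs} {ys} f u inj to = subst (_≤ count q ys) (length-map f (filterᵇ p xs))
    (length-≤ (unique-map (λ x∈ y∈ → inj (proj₁ (∈-filter⁻ (T? ∘ p) x∈)) (proj₁ (∈-filter⁻ (T? ∘ p) y∈))) (Unique.filter⁺ (T? ∘ p) u)) sub)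
    where
    sub : ∀ {y} → y ∈ map f (filterᵇ p xs) → y ∈ filterᵇ q ys
    sub y∈ with ∈-map⁻ f y∈
    ... | x , x∈ , refl = let x∈xs , px = ∈-filter⁻ (T? ∘ p) x∈ ; fx∈ , qfx = to x∈xs px in ∈-filter⁺ (T? ∘ q) fx∈ qfx

  count-same : ∀ p {xs ys} → Unique xs → Unique ys → (∀ {x} → x ∈ xs → x ∈ ys) → (∀ {y} → y ∈ ys → y ∈ xs) →
    count p xs ≡ count p ys
  count-same p ux uy to from = ≤-antisym
    (count-≤ (λ x → x) ux (λ _ _ e → e) (λ x∈ px → to x∈ , px))
    (count-≤ (λ x → x) uy (λ _ _ e → e) (λ y∈ py → from y∈ , py))

  record IsPermutation (n : ℕ) (π : List ℕ) : Set where
    constructor isPermutation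
    field
      size     : length π ≡ n
      unique   : Unique π
      positive : ∀ {v} → v ∈ π → 1 ≤ v
      bounded  : ∀ {v} → v ∈ π → v ≤ n

  ∈-range1⁺ : ∀ {n v} → 1 ≤ v → v ≤ n → v ∈ range1 n
  ∈-range1⁺ {v = suc v} _ v<n = ∈-map⁺ suc (∈-upTo⁺ v<n)

  ∈-range1⁻ : ∀ {n v} → v ∈ range1 n → 1 ≤ v × v ≤ n
  ∈-range1⁻ v∈ with ∈-map⁻ suc v∈
  ... | w , w∈ , refl = s≤s z≤n , ∈-upTo⁻ w∈

  range1-unique : ∀ n → Unique (range1 n)
  range1-unique n = Unique.map⁺ suc-injective (Unique.upTo⁺ n)

  length-range1 : ∀ n → length (range1 n) ≡ n
  length-range1 n = trans (length-map suc (upTo n)) (length-upTo n)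

  ∈-words⁺ : ∀ {xs} π → (∀ {v} → v ∈ π → v ∈ xs) → π ∈ words xs (length π)
  ∈-words⁺ []      _   = here refl
  ∈-words⁺ (v ∷ π) sub = ∈-concatMap (sub (here refl)) (∈-map⁺ (v ∷_) (∈-words⁺ π (sub ∘ there)))

  ∈-words⁻ : ∀ xs n {π} → π ∈ words xs n → length π ≡ n × (∀ {v} → v ∈ π → v ∈ xs)
  ∈-words⁻ xs zero    (here refl) = refl , λ ()
  ∈-words⁻ xs (suc n) π∈ with ∈-concatMap⁻′ xs π∈
  ... | x , x∈ , π∈′ with ∈-map⁻ (x ∷_) π∈′
  ... | π′ , π′∈ , refl with ∈-words⁻ xs n π′∈
  ... | len , sub = cong suc len , λ { (here refl) → x∈ ; (there v∈) → sub v∈ }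

  words-unique : ∀ {xs} n → Unique xs → Unique (words xs n)
  words-unique zero    u = [] ∷ []
  words-unique {xs} (suc n) u = unique-concatMap u
    (λ _ → Unique.map⁺ (λ { refl → refl }) (words-unique n u))
    λ {x} {x′} _ _ y∈ y∈′ → key (∈-map⁻ (x ∷_) y∈) (∈-map⁻ (x′ ∷_) y∈′)
    where
    key : ∀ {x x′ y} → (∃ λ w → w ∈ words xs n × y ≡ x ∷ w) → (∃ λ w → w ∈ words xs n × y ≡ x′ ∷ w) → x ≡ x′
    key (_ , _ , refl) (_ , _ , refl) = refl

  elemᵇ⇒∈ : ∀ v xs → T (elemᵇ v xs) → v ∈ xs
  elemᵇ⇒∈ v xs t = Any.map (λ {x} e → sym (≡ᵇ⇒≡ x v e)) (any⁻ (λ x → x ≡ᵇ v) xs t)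

  ∈⇒elemᵇ : ∀ {v xs} → v ∈ xs → T (elemᵇ v xs)
  ∈⇒elemᵇ {v} v∈ = any⁺ (λ x → x ≡ᵇ v) (Any.map (λ {x} e → ≡⇒≡ᵇ x v (sym e)) v∈)

  T-not⁺ : ∀ {b} → ¬ T b → T (not b)
  T-not⁺ {false} _ = _
  T-not⁺ {true}  f = f _

  T-not⁻ : ∀ {b} → T (not b) → ¬ T b
  T-not⁻ {false} _ ()

  distinctᵇ⇒Unique : ∀ xs → T (distinctᵇ xs) → Unique xs
  distinctᵇ⇒Unique []       _ = []
  distinctᵇ⇒Unique (x ∷ xs) t = let p , q = Equivalence.to T-∧ t in
    ¬Any⇒All¬ xs (λ x∈ → T-not⁻ p (∈⇒elemᵇ x∈)) ∷ distinctᵇ⇒Unique xs q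

  Unique⇒distinctᵇ : ∀ {xs} → Unique xs → T (distinctᵇ xs)
  Unique⇒distinctᵇ []       = _
  Unique⇒distinctᵇ {x ∷ xs} (x∉ ∷ u) = Equivalence.from T-∧
    (T-not⁺ (λ t → All¬⇒¬Any x∉ (elemᵇ⇒∈ x xs t)) , Unique⇒distinctᵇ u)

  ∈-perms⁺ : ∀ {n π} → IsPermutation n π → π ∈ perms n
  ∈-perms⁺ {n} {π} (isPermutation refl u pos bnd) = ∈-filter⁺ (T? ∘ distinctᵇ)
    (∈-words⁺ π (λ v∈ → ∈-range1⁺ (pos v∈) (bnd v∈))) (Unique⇒distinctᵇ u)

  ∈-perms⁻ : ∀ {n π} → π ∈ perms n → IsPermutation n π
  ∈-perms⁻ {n} {π} π∈ = let π∈w , d = ∈-filter⁻ (T? ∘ distinctᵇ) π∈ ; len , sub = ∈-words⁻ (range1 n) n π∈w in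
    isPermutation len (distinctᵇ⇒Unique π d) (proj₁ ∘ ∈-range1⁻ ∘ sub) (proj₂ ∘ ∈-range1⁻ ∘ sub)

  perms-unique : ∀ n → Unique (perms n)
  perms-unique n = Unique.filter⁺ (T? ∘ distinctᵇ) (words-unique n (range1-unique n))

  module _ {n π} (P : IsPermutation n π) where
    open IsPermutation P

    -- A missing value could be added to the `n` entries, giving `n + 1` distinct values between 1
    -- and `n`.
    surjective : ∀ {v} → 1 ≤ v → v ≤ n → v ∈ π
    surjective {v} 1≤v v≤n with Any.any? (v ≟_) π
    ... | yes v∈ = v∈
    ... | no v∉  = ⊥-elim (<-irrefl refl (subst₂ _≤_ (cong suc size) (length-range1 n) (length-≤ (¬Any⇒All¬ π v∉ ∷ unique)
          λ { (here refl) → ∈-range1⁺ 1≤v v≤n ; (there w∈) → ∈-range1⁺ (positive w∈) (bounded w∈) })))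

  -- Patterns

  ∈-subseqs⁺ : ∀ {s π} → s ⊆ π → s ∈ subseqs π
  ∈-subseqs⁺ []                   = here refl
  ∈-subseqs⁺ {π = x ∷ π} (.x ∷ʳ p) = ∈-++⁺ʳ (map (x ∷_) (subseqs π)) (∈-subseqs⁺ p)
  ∈-subseqs⁺ (refl ∷ p)           = ∈-++⁺ˡ (∈-map⁺ (_ ∷_) (∈-subseqs⁺ p))

  ∈-subseqs⁻ : ∀ π {s} → s ∈ subseqs π → s ⊆ π
  ∈-subseqs⁻ []      (here refl) = []
  ∈-subseqs⁻ (x ∷ π) s∈ with ∈-++⁻ (map (x ∷_) (subseqs π)) s∈
  ... | inj₂ p = x ∷ʳ ∈-subseqs⁻ π p
  ... | inj₁ p with ∈-map⁻ (x ∷_) p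
  ...   | s′ , s′∈ , refl = refl ∷ ∈-subseqs⁻ π s′∈

  record Agree (u a v b : ℕ) : Set where
    constructor _,_
    field
      same<ᵇ : (u <ᵇ v) ≡ (a <ᵇ b)
      same>ᵇ : (v <ᵇ u) ≡ (b <ᵇ a)

  data OrderIso : List ℕ → List ℕ → Set where
    []  : OrderIso [] []
    _∷_ : ∀ {u a us as} → Pointwise (Agree u a) us as → OrderIso us as → OrderIso (u ∷ us) (a ∷ as)

  -- The comparison of truth values is local to `sameOrderWith`, so it reduces only once all four
  -- tests are evaluated.
  agree⁻ : ∀ u a v b vs bs → T (sameOrderWith u a (v ∷ vs) (b ∷ bs)) → Agree u a v b × T (sameOrderWith u a vs bs)
  agree⁻ u a v b vs bs t with u <ᵇ v in e₁ | a <ᵇ b in e₂ | v <ᵇ u in e₃ | b <ᵇ a in e₄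
  ... | true  | true  | true  | true  = (trans e₁ (sym e₂) , trans e₃ (sym e₄)) , t
  ... | true  | true  | false | false = (trans e₁ (sym e₂) , trans e₃ (sym e₄)) , t
  ... | false | false | true  | true  = (trans e₁ (sym e₂) , trans e₃ (sym e₄)) , t
  ... | false | false | false | false = (trans e₁ (sym e₂) , trans e₃ (sym e₄)) , t

  agree⁺ : ∀ u a v b vs bs → Agree u a v b → T (sameOrderWith u a vs bs) → T (sameOrderWith u a (v ∷ vs) (b ∷ bs))
  agree⁺ u a v b vs bs (p , q) t rewrite p | q with a <ᵇ b | b <ᵇ a
  ... | true  | true  = t
  ... | true  | false = t
  ... | false | true  = t
  ... | false | false = t

  orderIsoᵇ-length : ∀ s τ → T (orderIsoᵇ s τ) → length s ≡ length τ
  orderIsoᵇ-length []      []      _ = refl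
  orderIsoᵇ-length (u ∷ s) (a ∷ τ) t = cong suc (orderIsoᵇ-length s τ (proj₂ (Equivalence.to T-∧ t)))

  orderIso⁻ : ∀ s τ → T (orderIsoᵇ s τ) → OrderIso s τ
  orderIso⁻ []      []      _ = []
  orderIso⁻ (u ∷ s) (a ∷ τ) t = let p , q = Equivalence.to T-∧ t in
    same u a s τ (orderIsoᵇ-length s τ q) p ∷ orderIso⁻ s τ q
    where
    same : ∀ u a s τ → length s ≡ length τ → T (sameOrderWith u a s τ) → Pointwise (Agree u a) s τ
    same u a []      []      _ _ = []
    same u a (v ∷ s) (b ∷ τ) l t = let p , q = agree⁻ u a v b s τ t in p ∷ same u a s τ (suc-injective l) q

  orderIso⁺ : ∀ {s τ} → OrderIso s τ → T (orderIsoᵇ s τ)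
  orderIso⁺ []       = _
  orderIso⁺ (p ∷ ps) = Equivalence.from T-∧ (same p , orderIso⁺ ps)
    where
    same : ∀ {u a s τ} → Pointwise (Agree u a) s τ → T (sameOrderWith u a s τ)
    same []       = _
    same {u} {a} {v ∷ s} {b ∷ τ} (p ∷ ps) = agree⁺ u a v b s τ p (same ps)

  contains⁺ : ∀ {τ π s} → s ⊆ π → OrderIso s τ → T (containsᵇ τ π)
  contains⁺ {τ} s⊆π iso = any⁺ (λ s → orderIsoᵇ s τ) (lose (∈-subseqs⁺ s⊆π) (orderIso⁺ iso))

  contains⁻ : ∀ τ π → T (containsᵇ τ π) → ∃ λ s → s ⊆ π × OrderIso s τ
  contains⁻ τ π t with find (any⁻ (λ s → orderIsoᵇ s τ) (subseqs π) t)
  ... | s , s∈ , iso = s , ∈-subseqs⁻ π s∈ , orderIso⁻ s τ iso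

  -- For letters of a concrete pattern the implicit hypothesis on `a` and `b` evaluates to the unit
  -- type and is found by unification.
  up : ∀ {u a v b} {a<b : T (a <ᵇ b)} → Agree u a v b → u < v
  up {a<b = ab} (p , _) = <ᵇ⇒< _ _ (subst T (sym p) ab)

  down : ∀ {u a v b} {b<a : T (b <ᵇ a)} → Agree u a v b → v < u
  down {b<a = ba} (_ , q) = <ᵇ⇒< _ _ (subst T (sym q) ba)

  <⇒<ᵇ≡true : ∀ {u v} → u < v → (u <ᵇ v) ≡ true
  <⇒<ᵇ≡true u<v = Equivalence.to T-≡ (<⇒<ᵇ u<v)

  <⇒>ᵇ≡false : ∀ {u v} → u < v → (v <ᵇ u) ≡ false
  <⇒>ᵇ≡false {u} {v} u<v with v <ᵇ u in eq
  ... | false = refl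
  ... | true  = ⊥-elim (<-asym u<v (<ᵇ⇒< v u (Equivalence.from T-≡ eq)))

  up⁺ : ∀ {u a v b} {a<b : T (a <ᵇ b)} → u < v → Agree u a v b
  up⁺ {a = a} {b = b} {ab} u<v =
    trans (<⇒<ᵇ≡true u<v) (sym (Equivalence.to T-≡ ab)) , trans (<⇒>ᵇ≡false u<v) (sym (<⇒>ᵇ≡false (<ᵇ⇒< a b ab)))

  down⁺ : ∀ {u a v b} {b<a : T (b <ᵇ a)} → v < u → Agree u a v b
  down⁺ {a = a} {b = b} {ba} v<u =
    trans (<⇒>ᵇ≡false v<u) (sym (<⇒>ᵇ≡false (<ᵇ⇒< b a ba))) , trans (<⇒<ᵇ≡true v<u) (sym (Equivalence.to T-≡ ba))

  Relation₃ Relation₄ : Set₁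
  Relation₃ = ℕ → ℕ → ℕ → Set
  Relation₄ = ℕ → ℕ → ℕ → ℕ → Set

  Contains₃ : Relation₃ → List ℕ → Set
  Contains₃ R π = ∃ λ a → ∃ λ b → ∃ λ c → (a ∷ b ∷ c ∷ []) ⊆ π × R a b c

  Contains₄ : Relation₄ → List ℕ → Set
  Contains₄ R π = ∃ λ a → ∃ λ b → ∃ λ c → ∃ λ d → (a ∷ b ∷ c ∷ d ∷ []) ⊆ π × R a b c d

  pattern p231  = 2 ∷ 3 ∷ 1 ∷ []
  pattern p312  = 3 ∷ 1 ∷ 2 ∷ []
  pattern p1342 = 1 ∷ 3 ∷ 4 ∷ 2 ∷ []
  pattern p1423 = 1 ∷ 4 ∷ 2 ∷ 3 ∷ []
  pattern p2314 = 2 ∷ 3 ∷ 1 ∷ 4 ∷ []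
  pattern p3124 = 3 ∷ 1 ∷ 2 ∷ 4 ∷ []

  R231 R312 : Relation₃
  R231 a b c = c < a × a < b
  R312 a b c = b < c × c < a

  R1342 R1423 R2314 R3124 : Relation₄
  R1342 a b c d = a < d × d < b × b < c
  R1423 a b c d = a < c × c < d × d < b
  R2314 a b c d = c < a × a < b × b < d
  R3124 a b c d = b < c × c < a × a < d

  record Represents₃ (τ : List ℕ) (R : Relation₃) : Set where
    field
      sound    : ∀ {π} → T (containsᵇ τ π) → Contains₃ R π
      complete : ∀ {π} → Contains₃ R π → T (containsᵇ τ π)

  record Represents₄ (τ : List ℕ) (R : Relation₄) : Set where
    field
      sound    : ∀ {π} → T (containsᵇ τ π) → Contains₄ R π
      complete : ∀ {π} → Contains₄ R π → T (containsᵇ τ π)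

  represents₃ : ∀ {p q r R} → let τ = p ∷ q ∷ r ∷ [] in
    (∀ {a b c} → OrderIso (a ∷ b ∷ c ∷ []) τ → R a b c) →
    (∀ {a b c} → R a b c → OrderIso (a ∷ b ∷ c ∷ []) τ) → Represents₃ τ R
  represents₃ {p} {q} {r} {R} to from = record
    { sound    = λ {π} t → sound (contains⁻ (p ∷ q ∷ r ∷ []) π t)
    ; complete = λ { (_ , _ , _ , s , r) → contains⁺ s (from r) } }
    where
    sound : ∀ {π} → (∃ λ s → s ⊆ π × OrderIso s (p ∷ q ∷ r ∷ [])) → Contains₃ R π
    sound (_ , s , iso@((_ ∷ _ ∷ []) ∷ (_ ∷ []) ∷ [] ∷ [])) = _ , _ , _ , s , to iso

  represents₄ : ∀ {p q r s R} → let τ = p ∷ q ∷ r ∷ s ∷ [] in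
    (∀ {a b c d} → OrderIso (a ∷ b ∷ c ∷ d ∷ []) τ → R a b c d) →
    (∀ {a b c d} → R a b c d → OrderIso (a ∷ b ∷ c ∷ d ∷ []) τ) → Represents₄ τ R
  represents₄ {p} {q} {r} {s} {R} to from = record
    { sound    = λ {π} t → sound (contains⁻ (p ∷ q ∷ r ∷ s ∷ []) π t)
    ; complete = λ { (_ , _ , _ , _ , s , r) → contains⁺ s (from r) } }
    where
    sound : ∀ {π} → (∃ λ t → t ⊆ π × OrderIso t (p ∷ q ∷ r ∷ s ∷ [])) → Contains₄ R π
    sound (_ , t , iso@((_ ∷ _ ∷ _ ∷ []) ∷ (_ ∷ _ ∷ []) ∷ (_ ∷ []) ∷ [] ∷ [])) = _ , _ , _ , _ , t , to iso

  represents231 : Represents₃ p231 R231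
  represents231 = represents₃
    (λ { ((ab ∷ ac ∷ []) ∷ (bc ∷ []) ∷ [] ∷ []) → down ac , up ab })
    (λ { (ca , ab) → (up⁺ ab ∷ down⁺ ca ∷ []) ∷ (down⁺ (<-trans ca ab) ∷ []) ∷ [] ∷ [] })

  represents312 : Represents₃ p312 R312
  represents312 = represents₃
    (λ { ((ab ∷ ac ∷ []) ∷ (bc ∷ []) ∷ [] ∷ []) → up bc , down ac })
    (λ { (bc , ca) → (down⁺ (<-trans bc ca) ∷ down⁺ ca ∷ []) ∷ (up⁺ bc ∷ []) ∷ [] ∷ [] })

  represents1342 : Represents₄ p1342 R1342
  represents1342 = represents₄
    (λ { ((ab ∷ ac ∷ ad ∷ []) ∷ (bc ∷ bd ∷ []) ∷ (cd ∷ []) ∷ [] ∷ []) → up ad , down bd , up bc })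
    (λ { (ad , db , bc) → (up⁺ (<-trans ad db) ∷ up⁺ (<-trans (<-trans ad db) bc) ∷ up⁺ ad ∷ [])
      ∷ (up⁺ bc ∷ down⁺ db ∷ []) ∷ (down⁺ (<-trans db bc) ∷ []) ∷ [] ∷ [] })

  represents1423 : Represents₄ p1423 R1423
  represents1423 = represents₄
    (λ { ((ab ∷ ac ∷ ad ∷ []) ∷ (bc ∷ bd ∷ []) ∷ (cd ∷ []) ∷ [] ∷ []) → up ac , up cd , down bd })
    (λ { (ac , cd , db) → (up⁺ (<-trans (<-trans ac cd) db) ∷ up⁺ ac ∷ up⁺ (<-trans ac cd) ∷ [])
      ∷ (down⁺ (<-trans cd db) ∷ down⁺ db ∷ []) ∷ (up⁺ cd ∷ []) ∷ [] ∷ [] })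

  represents2314 : Represents₄ p2314 R2314
  represents2314 = represents₄
    (λ { ((ab ∷ ac ∷ ad ∷ []) ∷ (bc ∷ bd ∷ []) ∷ (cd ∷ []) ∷ [] ∷ []) → down ac , up ab , up bd })
    (λ { (ca , ab , bd) → (up⁺ ab ∷ down⁺ ca ∷ up⁺ (<-trans ab bd) ∷ [])
      ∷ (down⁺ (<-trans ca ab) ∷ up⁺ bd ∷ []) ∷ (up⁺ (<-trans ca (<-trans ab bd)) ∷ []) ∷ [] ∷ [] })

  represents3124 : Represents₄ p3124 R3124
  represents3124 = represents₄
    (λ { ((ab ∷ ac ∷ ad ∷ []) ∷ (bc ∷ bd ∷ []) ∷ (cd ∷ []) ∷ [] ∷ []) → up bc , down ac , up ad })
    (λ { (bc , ca , ad) → (down⁺ (<-trans bc ca) ∷ down⁺ ca ∷ up⁺ ad ∷ [])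
      ∷ (up⁺ bc ∷ up⁺ (<-trans bc (<-trans ca ad)) ∷ []) ∷ (up⁺ (<-trans ca ad) ∷ []) ∷ [] ∷ [] })

  -- Insertion of a new first entry

  punch : ℕ → ℕ → ℕ
  punch c v with v <? c
  ... | yes _ = v
  ... | no _  = suc v

  punch-≢ : ∀ c v → punch c v ≢ c
  punch-≢ c v eq with v <? c
  ... | yes v<c = <-irrefl eq v<c
  ... | no v≮c  = v≮c (≤-reflexive eq)

  punch-< : ∀ {c v} → v < c → punch c v ≡ v
  punch-< {c} {v} v<c with v <? c
  ... | yes _  = refl
  ... | no v≮c = ⊥-elim (v≮c v<c)

  punch-≥ : ∀ {c v} → c ≤ v → punch c v ≡ suc v
  punch-≥ {c} {v} c≤v with v <? c
  ... | yes v<c = ⊥-elim (<⇒≱ v<c c≤v)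
  ... | no _    = refl

  punch-mono : ∀ c {v w} → v < w → punch c v < punch c w
  punch-mono c {v} {w} v<w with v <? c | w <? c
  ... | yes _   | yes _   = v<w
  ... | yes _   | no _    = m<n⇒m<1+n v<w
  ... | no v≮c  | yes w<c = ⊥-elim (v≮c (<-trans v<w w<c))
  ... | no _    | no _    = s≤s v<w

  punch-cancel : ∀ c {v w} → punch c v < punch c w → v < w
  punch-cancel c {v} {w} lt with <-cmp v w
  ... | tri< v<w _ _  = v<w
  ... | tri≈ _ refl _ = ⊥-elim (<-irrefl refl lt)
  ... | tri> _ _ w<v  = ⊥-elim (<-asym lt (punch-mono c w<v))

  punch-injective : ∀ c {v w} → punch c v ≡ punch c w → v ≡ w
  punch-injective c {v} {w} eq with <-cmp v w
  ... | tri< v<w _ _ = ⊥-elim (<-irrefl eq (punch-mono c v<w))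
  ... | tri≈ _ e _   = e
  ... | tri> _ _ w<v = ⊥-elim (<-irrefl (sym eq) (punch-mono c w<v))

  unpunch : ℕ → ℕ → ℕ
  unpunch c v with v <? c
  ... | yes _ = v
  ... | no _  = pred v

  punch-unpunch : ∀ {c v} → v ≢ c → punch c (unpunch c v) ≡ v
  punch-unpunch {c} {v} v≢c with v <? c
  ... | yes v<c = punch-< v<c
  punch-unpunch {c} {zero}  v≢c | no v≮c = ⊥-elim (v≢c (sym (n≤0⇒n≡0 (≮⇒≥ v≮c))))
  punch-unpunch {c} {suc v} v≢c | no v≮c = punch-≥ (≤-pred (≤∧≢⇒< (≮⇒≥ v≮c) (v≢c ∘ sym)))

  punch-≤ : ∀ c {v n} → v ≤ n → punch c v ≤ suc n
  punch-≤ c {v} v≤n with v <? c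
  ... | yes _ = m≤n⇒m≤1+n v≤n
  ... | no _  = s≤s v≤n

  v≤punch : ∀ c v → v ≤ punch c v
  v≤punch c v with v <? c
  ... | yes _ = ≤-refl
  ... | no _  = n≤1+n v

  prepend : ℕ → List ℕ → List ℕ
  prepend c τ = c ∷ map (punch c) τ

  children : ℕ → List ℕ → List (List ℕ)
  children n τ = map (λ c → prepend c τ) (range1 (suc n))

  grow : ℕ → ℕ → List (List ℕ) → List (List ℕ)
  grow zero    n L = L
  grow (suc m) n L = grow m (suc n) (concatMap (children n) L)

  prepend-permutation : ∀ {n τ c} → IsPermutation n τ → 1 ≤ c → c ≤ suc n → IsPermutation (suc n) (prepend c τ)
  prepend-permutation {n} {τ} {c} (isPermutation size u pos bnd) 1≤c c≤n = isPermutation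
    (cong suc (trans (length-map (punch c) τ) size))
    (All.tabulate (λ z∈ c≡z → let v , _ , eq = ∈-map⁻ (punch c) z∈ in punch-≢ c v (sym (trans c≡z eq))) ∷ Unique.map⁺ (punch-injective c) u)
    (λ { (here refl) → 1≤c ; (there v∈) → let w , w∈ , eq = ∈-map⁻ (punch c) v∈ in subst (1 ≤_) (sym eq) (≤-trans (pos w∈) (v≤punch c w)) })
    (λ { (here refl) → c≤n ; (there v∈) → let w , w∈ , eq = ∈-map⁻ (punch c) v∈ in subst (_≤ suc n) (sym eq) (punch-≤ c (bnd w∈)) })

  unprepend-permutation : ∀ {n c ρ} → IsPermutation (suc n) (c ∷ ρ) → ∃ λ τ → IsPermutation n τ × c ∷ ρ ≡ prepend c τ
  unprepend-permutation {n} {c} {ρ} (isPermutation size (c∉ ∷ u) pos bnd) = τ , isPermutation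
      (trans (length-map (unpunch c) ρ) (suc-injective size))
      (unique-map (λ {v} {w} v∈ w∈ eq → trans (sym (pu v∈)) (trans (cong (punch c) eq) (pu w∈))) u)
      (λ v∈ → let w , w∈ , eq = ∈-map⁻ (unpunch c) v∈ in subst (1 ≤_) (sym eq) (positive w∈))
      (λ v∈ → let w , w∈ , eq = ∈-map⁻ (unpunch c) v∈ in subst (_≤ n) (sym eq) (bounded w∈))
    , cong (c ∷_) (sym (trans (sym (map-∘ ρ)) (map-id-local (All.tabulate pu))))
    where
    τ : List ℕ
    τ = map (unpunch c) ρ
    pu : ∀ {v} → v ∈ ρ → punch c (unpunch c v) ≡ v
    pu v∈ = punch-unpunch (λ v≡c → All.lookup c∉ v∈ (sym v≡c))
    positive : ∀ {v} → v ∈ ρ → 1 ≤ unpunch c v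
    positive {v} v∈ with v <? c
    ... | yes _  = pos (there v∈)
    ... | no v≮c = ≤-trans (pos (here refl)) (<⇒≤pred (≤∧≢⇒< (≮⇒≥ v≮c) (All.lookup c∉ v∈)))
    bounded : ∀ {v} → v ∈ ρ → unpunch c v ≤ n
    bounded {v} v∈ with v <? c
    ... | yes v<c = ≤-pred (≤-trans v<c (bnd (here refl)))
    ... | no _    = pred-mono-≤ (bnd (there v∈))

  record Enumerates (n : ℕ) (L : List (List ℕ)) : Set where
    constructor enumerates
    field
      unique   : Unique L
      sound    : ∀ {π} → π ∈ L → IsPermutation n π
      complete : ∀ {π} → IsPermutation n π → π ∈ L

  enumerates-perms : ∀ n → Enumerates n (perms n)
  enumerates-perms n = enumerates (perms-unique n) ∈-perms⁻ ∈-perms⁺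

  count-enumerations : ∀ p {n L M} → Enumerates n L → Enumerates n M → count p L ≡ count p M
  count-enumerations p (enumerates u s c) (enumerates u′ s′ c′) = count-same p u u′ (c′ ∘ s) (c ∘ s′)

  -- Deleting the first entry and closing the gap in the values recovers the unique parent of a
  -- permutation.
  enumerates-children : ∀ {n L} → Enumerates n L → Enumerates (suc n) (concatMap (children n) L)
  enumerates-children {n} {L} (enumerates u snd cmp) = enumerates
    (unique-concatMap u (λ _ → Unique.map⁺ (λ eq → proj₁ (∷-injective eq)) (range1-unique (suc n)))
      (λ {τ} {τ′} _ _ y∈ y∈′ → key (∈-map⁻ (λ c → prepend c τ) y∈) (∈-map⁻ (λ c → prepend c τ′) y∈′)))
    sound complete
    where
    map-injective : ∀ c {xs ys} → map (punch c) xs ≡ map (punch c) ys → xs ≡ ys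
    map-injective c {[]}     {[]}     _  = refl
    map-injective c {x ∷ xs} {y ∷ ys} eq = let p , q = ∷-injective eq in cong₂ _∷_ (punch-injective c p) (map-injective c q)
    key : ∀ {τ τ′ y} → (∃ λ c → c ∈ range1 (suc n) × y ≡ prepend c τ) → (∃ λ c → c ∈ range1 (suc n) × y ≡ prepend c τ′) → τ ≡ τ′
    key {τ} {τ′} (c , _ , refl) (c′ , _ , eq) with ∷-injective eq
    ... | refl , q = map-injective c q
    sound : ∀ {π} → π ∈ concatMap (children n) L → IsPermutation (suc n) π
    sound π∈ with ∈-concatMap⁻′ L π∈
    ... | τ , τ∈ , π∈′ with ∈-map⁻ (λ c → prepend c τ) π∈′
    ... | c , c∈ , refl = prepend-permutation (snd τ∈) (proj₁ (∈-range1⁻ c∈)) (proj₂ (∈-range1⁻ c∈))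
    complete : ∀ {π} → IsPermutation (suc n) π → π ∈ concatMap (children n) L
    complete {[]} P with IsPermutation.size P
    ... | ()
    complete {c ∷ ρ} P with unprepend-permutation P
    ... | τ , Q , eq rewrite eq = ∈-concatMap (cmp Q) (∈-map⁺ (λ c → prepend c τ)
          (∈-range1⁺ (IsPermutation.positive P (here refl)) (IsPermutation.bounded P (here refl))))

  enumerates-grow : ∀ m {n L} → Enumerates n L → Enumerates (m + n) (grow m n L)
  enumerates-grow zero    E = E
  enumerates-grow (suc m) {n} {L} E = subst (λ k → Enumerates k (grow (suc m) n L)) (+-suc m n) (enumerates-grow m (enumerates-children E))

  count-perms : ∀ p n → count p (perms n) ≡ count p (grow n 0 ([] ∷ []))
  count-perms p n = count-enumerations p (enumerates-perms n)
    (subst (λ k → Enumerates k (grow n 0 ([] ∷ []))) (+-identityʳ n) (enumerates-grow n (enumerates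
      ([] ∷ []) (λ { (here refl) → isPermutation refl [] (λ ()) (λ ()) }) (λ { {[]} _ → here refl ; {_ ∷ _} P → ⊥-elim (1+n≢0 (IsPermutation.size P)) }))))

  grow-++ : ∀ m n L M → grow m n (L ++ M) ≡ grow m n L ++ grow m n M
  grow-++ zero    n L M = refl
  grow-++ (suc m) n L M = trans (cong (grow m (suc n)) (concatMap-++ L)) (grow-++ m (suc n) _ _)
    where
    concatMap-++ : ∀ L → concatMap (children n) (L ++ M) ≡ concatMap (children n) L ++ concatMap (children n) M
    concatMap-++ []      = refl
    concatMap-++ (x ∷ L) = trans (cong (children n x ++_) (concatMap-++ L)) (sym (++-assoc (children n x) _ _))

  sumFrom : (ℕ → ℕ) → ℕ → ℕ → ℕ
  sumFrom f b zero    = 0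
  sumFrom f b (suc k) = f b + sumFrom f (suc b) k

  sumFrom-+ : ∀ f b j k → sumFrom f b (j + k) ≡ sumFrom f b j + sumFrom f (b + j) k
  sumFrom-+ f b zero    k = cong (λ t → sumFrom f t k) (sym (+-identityʳ b))
  sumFrom-+ f b (suc j) k = trans (cong (f b +_) (trans (sumFrom-+ f (suc b) j k)
    (cong (λ t → sumFrom f (suc b) j + sumFrom f t k) (sym (+-suc b j))))) (sym (+-assoc (f b) _ _))

  sumFrom-cong : ∀ {f g} b k → (∀ i → b ≤ i → i < b + k → f i ≡ g i) → sumFrom f b k ≡ sumFrom g b k
  sumFrom-cong b zero    _  = refl
  sumFrom-cong b (suc k) eq = cong₂ _+_ (eq b ≤-refl (m<m+n b (s≤s z≤n)))
    (sumFrom-cong (suc b) k (λ i b<i i< → eq i (<⇒≤ b<i) (subst (i <_) (sym (+-suc b k)) i<)))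

  sumFrom-zero : ∀ {f} b k → (∀ i → b ≤ i → i < b + k → f i ≡ 0) → sumFrom f b k ≡ 0
  sumFrom-zero b k eq = trans (sumFrom-cong b k eq) (zeros b k)
    where
    zeros : ∀ b k → sumFrom (λ _ → 0) b k ≡ 0
    zeros b zero    = refl
    zeros b (suc k) = zeros (suc b) k

  interval : ℕ → ℕ → List ℕ
  interval b zero    = []
  interval b (suc k) = b ∷ interval (suc b) k

  applyUpTo-interval : ∀ (f : ℕ → ℕ) b k → (∀ i → f i ≡ b + i) → applyUpTo f k ≡ interval b k
  applyUpTo-interval f b zero    _  = refl
  applyUpTo-interval f b (suc k) eq = cong₂ _∷_ (trans (eq 0) (+-identityʳ b))
    (applyUpTo-interval (f ∘ suc) (suc b) k (λ i → trans (eq (suc i)) (+-suc b i)))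

  range1≡interval : ∀ k → range1 k ≡ interval 1 k
  range1≡interval k = trans (map-applyUpTo (λ i → i) suc k) (applyUpTo-interval suc 1 k (λ _ → refl))

  count-grow-children : ∀ p m n τ →
    count p (grow (suc m) n (τ ∷ [])) ≡ sumFrom (λ c → count p (grow m (suc n) (prepend c τ ∷ []))) 1 (suc n)
  count-grow-children p m n τ = trans (cong (count p ∘ grow m (suc n)) (trans (++-identityʳ (children n τ))
    (cong (map (λ c → prepend c τ)) (range1≡interval (suc n))))) (go 1 (suc n))
    where
    grow-[] : ∀ m n → grow m n [] ≡ []
    grow-[] zero    n = refl
    grow-[] (suc m) n = grow-[] m (suc n)
    go : ∀ b k → count p (grow m (suc n) (map (λ c → prepend c τ) (interval b k)))
               ≡ sumFrom (λ c → count p (grow m (suc n) (prepend c τ ∷ []))) b k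
    go b zero    = cong (count p) (grow-[] m (suc n))
    go b (suc k) = trans (cong (count p) (grow-++ m (suc n) (prepend b τ ∷ []) _)) (trans
      (count-++ p (grow m (suc n) (prepend b τ ∷ [])) _) (cong (count p (grow m (suc n) (prepend b τ ∷ [])) +_) (go (suc b) k)))

  -- Insertion and patterns

  ⊆-map⁻ : ∀ (f : ℕ → ℕ) τ {s} → s ⊆ map f τ → ∃ λ s′ → s′ ⊆ τ × s ≡ map f s′
  ⊆-map⁻ f []      []         = [] , [] , refl
  ⊆-map⁻ f (x ∷ τ) (.(f x) ∷ʳ p) = let s′ , q , eq = ⊆-map⁻ f τ p in s′ , x ∷ʳ q , eq
  ⊆-map⁻ f (x ∷ τ) (refl ∷ p) = let s′ , q , eq = ⊆-map⁻ f τ p in x ∷ s′ , refl ∷ q , cong (f x ∷_) eq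

  data Prepended (c : ℕ) (τ : List ℕ) : List ℕ → Set where
    atHead : ∀ {s xs} → s ⊆ τ → xs ≡ map (punch c) s → Prepended c τ (c ∷ xs)
    inTail : ∀ {s xs} → s ⊆ τ → xs ≡ map (punch c) s → Prepended c τ xs

  prepended : ∀ c τ {s} → s ⊆ prepend c τ → Prepended c τ s
  prepended c τ (refl ∷ p) with ⊆-map⁻ (punch c) τ p
  ... | s′ , q , eq = atHead q eq
  prepended c τ (.c ∷ʳ p) with ⊆-map⁻ (punch c) τ p
  ... | s′ , q , eq = inTail q eq

  -- Half-open intervals of values let consecutive blocks share an endpoint.
  Decreasing : List ℕ → ℕ → ℕ → Set
  Decreasing τ s t = ∀ {x y} → (x ∷ y ∷ []) ⊆ τ → s < x → x ≤ t → s < y → y ≤ t → y < x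

  -- Only `y` is compared with `t`, as it is the smallest of the three values.
  AvoidsAbove : List ℕ → ℕ → Set
  AvoidsAbove τ t = ∀ {x y z} → (x ∷ y ∷ z ∷ []) ⊆ τ → t < y → y < z → z < x → ⊥

  Avoids1423 : List ℕ → Set
  Avoids1423 τ = ∀ {w x y z} → (w ∷ x ∷ y ∷ z ∷ []) ⊆ τ → w < y → y < z → z < x → ⊥

  Decreasing-mono : ∀ {τ s s′ t t′} → s ≤ s′ → t′ ≤ t → Decreasing τ s t → Decreasing τ s′ t′
  Decreasing-mono s≤ t≤ D p a b c d = D p (≤-<-trans s≤ a) (≤-trans b t≤) (≤-<-trans s≤ c) (≤-trans d t≤)

  Decreasing-empty : ∀ {τ s t} → t ≤ s → Decreasing τ s t
  Decreasing-empty t≤s p a b _ _ = ⊥-elim (<⇒≱ a (≤-trans b t≤s))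

  AvoidsAbove-mono : ∀ {τ s t} → s ≤ t → AvoidsAbove τ s → AvoidsAbove τ t
  AvoidsAbove-mono s≤t A p a = A p (≤-<-trans s≤t a)

  punch-<⁻ : ∀ {c t v} → t < c → t < punch c v → t < v
  punch-<⁻ {c} {t} {v} t<c t<pv with v <? c
  ... | yes _  = t<pv
  ... | no v≮c = <-≤-trans t<c (≮⇒≥ v≮c)

  punch-<⁺ : ∀ {c t v} → t < v → t < punch c v
  punch-<⁺ {c} {t} {v} t<v = <-≤-trans t<v (v≤punch c v)

  punch-≤suc⁻ : ∀ {c t v} → c ≤ suc t → punch c v ≤ suc t → v ≤ t
  punch-≤suc⁻ {c} {t} {v} c≤t pv≤t with v <? c
  ... | yes v<c = ≤-pred (<-≤-trans v<c c≤t)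
  ... | no _    = ≤-pred pv≤t

  punch-suc<⁻ : ∀ {c t v} → c ≤ suc t → suc t < punch c v → t < v
  punch-suc<⁻ {c} {t} {v} c≤t t<pv with v <? c
  ... | yes v<c = ⊥-elim (<⇒≱ (<-trans t<pv v<c) c≤t)
  ... | no _    = ≤-pred t<pv

  punch-suc<⁺ : ∀ {c t v} → c ≤ suc t → t < v → suc t < punch c v
  punch-suc<⁺ {c} {t} {v} c≤t t<v rewrite punch-≥ {c} {v} (≤-trans c≤t t<v) = s≤s t<v

  ⊆-unequal : ∀ {x y : ℕ} {τ} → Unique τ → (x ∷ y ∷ []) ⊆ τ → x ≢ y
  ⊆-unequal (_ ∷ u)  (_ ∷ʳ p)   = ⊆-unequal u p
  ⊆-unequal (x∉ ∷ _) (refl ∷ p) = All.lookup x∉ (to∈ p)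

  punch-above : ∀ {c v} → c < punch c v → c ≤ v
  punch-above {c} {v} c<pv with v <? c
  ... | yes v<c = ⊥-elim (<-asym c<pv v<c)
  ... | no v≮c  = ≮⇒≥ v≮c

  module _ {c : ℕ} {τ : List ℕ} where

    private τ′ = prepend c τ

    prepend⁺ : ∀ {s} → s ⊆ τ → map (punch c) s ⊆ τ′
    prepend⁺ p = c ∷ʳ map⁺ (punch c) p

    Decreasing-prepend : ∀ {s t} → c ≡ suc t → Decreasing τ s t → Decreasing τ′ s (suc t)
    Decreasing-prepend {s} {t} refl D {x} {y} p s<x x≤t s<y y≤t with prepended c τ p
    ... | atHead {v ∷ []} q refl     = ≤∧≢⇒< y≤t (punch-≢ c v)
    ... | inTail {v ∷ w ∷ []} q refl = punch-mono c (D q (below s<x x≤t) (bound x≤t) (below s<y y≤t) (bound y≤t))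
      where
      bound : ∀ {v} → punch c v ≤ suc t → v ≤ t
      bound = punch-≤suc⁻ ≤-refl
      below : ∀ {v} → s < punch c v → punch c v ≤ suc t → s < v
      below s<pv pv≤ = punch-<⁻ (<-≤-trans s<pv pv≤) s<pv

    Decreasing-shift : ∀ {s t} → c ≤ suc s → Decreasing τ s t → Decreasing τ′ (suc s) (suc t)
    Decreasing-shift {s} {t} c≤s D {x} {y} p s<x x≤t s<y y≤t with prepended c τ p
    ... | atHead q _ = ⊥-elim (<⇒≱ s<x c≤s)
    ... | inTail {v ∷ w ∷ []} q refl = punch-mono c (D q (punch-suc<⁻ c≤s s<x) (bound s<x x≤t) (punch-suc<⁻ c≤s s<y) (bound s<y y≤t))
      where
      bound : ∀ {v} → suc s < punch c v → punch c v ≤ suc t → v ≤ t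
      bound {v} a b = punch-≤suc⁻ (≤-trans c≤s (<⇒≤ (<-≤-trans a b))) b

    Decreasing-shift⁻ : ∀ {s t} → c ≤ suc s → Decreasing τ′ (suc s) (suc t) → Decreasing τ s t
    Decreasing-shift⁻ c≤s D p s<x x≤t s<y y≤t = punch-cancel c (D (prepend⁺ p)
      (punch-suc<⁺ c≤s s<x) (punch-≤ c x≤t) (punch-suc<⁺ c≤s s<y) (punch-≤ c y≤t))

    -- The value `c` of `τ` becomes `suc c` and stands behind the new first entry `c`: an ascent
    -- within the interval.
    ¬Decreasing-prepend : ∀ {n s t} → IsPermutation n τ → 1 ≤ c → s < c → c < t → t ≤ suc n → ¬ Decreasing τ′ s t
    ¬Decreasing-prepend {n} {s} {suc t} P 1≤c s<c c<t t≤n D = <-asym c<t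
      (subst (_< c) (punch-≥ (≤-pred c<t)) (D (refl ∷ map⁺ (punch c) (from∈ (surjective P (≤-trans 1≤c (≤-pred c<t)) (≤-pred t≤n))))
        s<c (<⇒≤ c<t) (≤-trans (<-trans s<c c<t) (≤-reflexive (sym (punch-≥ (≤-pred c<t))))) (≤-reflexive (punch-≥ (≤-pred c<t)))))

    -- The new first entry can only play the 3 of a 312, and the other two entries would be an
    -- ascent among the values above `t` and below `c`.
    AvoidsAbove-prepend : ∀ {t} → t < c → AvoidsAbove τ t → Decreasing τ t (pred c) → AvoidsAbove τ′ t
    AvoidsAbove-prepend {t} t<c A D p t<y y<z z<x with prepended c τ p
    ... | inTail {u ∷ v ∷ w ∷ []} q refl = A q (punch-<⁻ t<c t<y) (punch-cancel c y<z) (punch-cancel c z<x)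
    ... | atHead {v ∷ w ∷ []} q refl     = <-asym (punch-cancel c y<z)
          (D q (punch-<⁻ t<c t<y) (small (<-trans y<z z<x)) (punch-<⁻ t<c (<-trans t<y y<z)) (small z<x))
      where
      small : ∀ {v} → punch c v < c → v ≤ pred c
      small {v} lt = <⇒≤pred (≤-<-trans (v≤punch c v) lt)

    AvoidsAbove-tail : ∀ {t} → AvoidsAbove τ′ t → AvoidsAbove τ t
    AvoidsAbove-tail A p t<y y<z z<x = A (prepend⁺ p) (punch-<⁺ t<y) (punch-mono c y<z) (punch-mono c z<x)

    AvoidsAbove-head : ∀ {t} → 1 ≤ c → Unique τ → AvoidsAbove τ′ t → Decreasing τ t (pred c)
    AvoidsAbove-head {t} 1≤c u A {x} {y} p t<x x≤c t<y y≤c with <-cmp y x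
    ... | tri< y<x _ _ = y<x
    ... | tri≈ _ eq _  = ⊥-elim (⊆-unequal u p (sym eq))
    ... | tri> _ _ x<y = ⊥-elim (A (refl ∷ map⁺ (punch c) p) (punch-<⁺ t<x) (punch-mono c x<y)
            (subst (_< c) (sym (punch-< y<c)) y<c))
      where
      y<c : y < c
      y<c = ≤-trans (s≤s y≤c) (≤-reflexive (suc-pred c {{>-nonZero 1≤c}}))

    -- The new first entry can only play the 1; the other three entries come from a 312 among the
    -- values of `τ` that are at least `c`.
    Avoids1423-prepend : Avoids1423 τ → AvoidsAbove τ (pred c) → 1 ≤ c → Avoids1423 τ′
    Avoids1423-prepend V A 1≤c p w<y y<z z<x with prepended c τ p
    ... | inTail {t ∷ u ∷ v ∷ w ∷ []} q refl = V q (punch-cancel c w<y) (punch-cancel c y<z) (punch-cancel c z<x)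
    ... | atHead {u ∷ v ∷ w ∷ []} q refl     = A q (subst (_≤ v) (sym (suc-pred c {{>-nonZero 1≤c}})) c≤v) (punch-cancel c y<z) (punch-cancel c z<x)
      where
      c≤v : c ≤ v
      c≤v = punch-above w<y

    Avoids1423-tail : Avoids1423 τ′ → Avoids1423 τ
    Avoids1423-tail V p a b d = V (prepend⁺ p) (punch-mono c a) (punch-mono c b) (punch-mono c d)

    Avoids1423-head : 1 ≤ c → Avoids1423 τ′ → AvoidsAbove τ (pred c)
    Avoids1423-head 1≤c V {x} {y} {z} p c≤y y<z z<x = V (refl ∷ map⁺ (punch c) p)
      (subst (c <_) (sym (punch-≥ c≤y′)) (s≤s c≤y′)) (punch-mono c y<z) (punch-mono c z<x)
      where
      c≤y′ : c ≤ y
      c≤y′ = subst (_≤ y) (suc-pred c {{>-nonZero 1≤c}}) c≤y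

  avoids1423⁺ : ∀ {π} → Avoids1423 π → avoidsᵇ p1423 π ≡ true
  avoids1423⁺ {π} V with containsᵇ p1423 π in eq
  ... | false = refl
  ... | true with Represents₄.sound represents1423 {π} (subst T (sym eq) _)
  ...   | _ , _ , _ , _ , s , a , b , d = ⊥-elim (V s a b d)

  avoids1423⁻ : ∀ {π} → ¬ Avoids1423 π → avoidsᵇ p1423 π ≡ false
  avoids1423⁻ {π} ¬V with containsᵇ p1423 π in eq
  ... | true  = refl
  ... | false = ⊥-elim (¬V (λ s a b d → subst T eq (Represents₄.complete represents1423 {π} (_ , _ , _ , _ , s , a , b , d))))

  avoids312⁺ : ∀ {π n} → IsPermutation n π → AvoidsAbove π 0 → avoidsᵇ p312 π ≡ true
  avoids312⁺ {π} P A with containsᵇ p312 π in eq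
  ... | false = refl
  ... | true with Represents₃.sound represents312 {π} (subst T (sym eq) _)
  ...   | _ , _ , _ , s , a , b = ⊥-elim (A s (IsPermutation.positive P (to∈ (∷ˡ⁻ s))) a b)

  avoids312⁻ : ∀ {π} → ¬ AvoidsAbove π 0 → avoidsᵇ p312 π ≡ false
  avoids312⁻ {π} ¬A with containsᵇ p312 π in eq
  ... | true  = refl
  ... | false = ⊥-elim (¬A (λ s _ a b → subst T eq (Represents₃.complete represents312 {π} (_ , _ , _ , s , a , b))))

  -- Counting avoiders by insertion

  completions : (List ℕ → Bool) → ℕ → ℕ → List ℕ → ℕ
  completions p m n τ = count p (grow m n (τ ∷ []))

  completions-suc : ∀ p m n τ → completions p (suc m) n τ ≡ sumFrom (λ c → completions p m (suc n) (prepend c τ)) 1 (suc n)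
  completions-suc = count-grow-children

  count-singleton-true : ∀ {p : List ℕ → Bool} {τ} → p τ ≡ true → count p (τ ∷ []) ≡ 1
  count-singleton-true {p} {τ} eq = trans (count-∷ p τ []) (cong (λ b → bit b + 0) eq)

  count-singleton-false : ∀ {p : List ℕ → Bool} {τ} → p τ ≡ false → count p (τ ∷ []) ≡ 0
  count-singleton-false {p} {τ} eq = trans (count-∷ p τ []) (cong (λ b → bit b + 0) eq)

  -- An occurrence survives all later insertions, so the whole subtree contributes nothing.
  dead1423 : ∀ m n τ → ¬ Avoids1423 τ → completions (avoidsᵇ p1423) m n τ ≡ 0
  dead1423 zero    n τ ¬V = count-singleton-false {avoidsᵇ p1423} {τ} (avoids1423⁻ {τ} ¬V)
  dead1423 (suc m) n τ ¬V = trans (completions-suc (avoidsᵇ p1423) m n τ)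
    (sumFrom-zero 1 (suc n) (λ c _ _ → dead1423 m (suc n) (prepend c τ) (¬V ∘ Avoids1423-tail)))

  dead312 : ∀ m n τ → ¬ AvoidsAbove τ 0 → completions (avoidsᵇ p312) m n τ ≡ 0
  dead312 zero    n τ ¬A = count-singleton-false {avoidsᵇ p312} {τ} (avoids312⁻ {τ} ¬A)
  dead312 (suc m) n τ ¬A = trans (completions-suc (avoidsᵇ p312) m n τ)
    (sumFrom-zero 1 (suc n) (λ c _ _ → dead312 m (suc n) (prepend c τ) (¬A ∘ AvoidsAbove-tail)))

  -- Above g, the values of τ split into the maximal blocks (b , b + r] that occur in
  -- decreasing order; Runs lists their sizes, starting with the block at b.
  Runs : List ℕ → ℕ → ℕ → List ℕ → ℕ → Set
  Runs τ g b []      n = b ≡ n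
  Runs τ g b (r ∷ s) n = Decreasing τ b (b + r)
    × (∀ k t → 1 ≤ k → k ≤ r → g ≤ t → t < b → ¬ Decreasing τ t (b + k))
    × Runs τ g (b + r) s n

  -- With `g` the least threshold above which 312 is avoided, the insertions that create a 1423 are
  -- exactly those with `c ≤ g`.
  record State (τ : List ℕ) (n g : ℕ) (s : List ℕ) : Set where
    field
      permutation : IsPermutation n τ
      avoids      : Avoids1423 τ
      above       : AvoidsAbove τ g
      minimal     : ∀ t → t < g → ¬ AvoidsAbove τ t
      runs        : Runs τ g g s n

  Runs-total : ∀ {τ g n} b s → Runs τ g b s n → b + sum s ≡ n
  Runs-total b []      eq          = trans (+-identityʳ b) eq
  Runs-total b (r ∷ s) (_ , _ , R) = trans (sym (+-assoc b r (sum s))) (Runs-total (b + r) s R)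

  Runs-≤ : ∀ {τ g n} b s → Runs τ g b s n → b ≤ n
  Runs-≤ b s R = subst (b ≤_) (Runs-total b s R) (m≤m+n b (sum s))

  -- Blocks at or above the insertion move up rigidly. They cannot be extended downwards: to a bound
  -- below `c`, because `c` now precedes `suc c`; to a bound from `c` on, because of the old
  -- obstruction. This covers all bounds, so the new threshold `g′` is arbitrary.
  Runs-shift : ∀ {τ n c g g′} b s → IsPermutation n τ → 1 ≤ c → c ≤ suc b → g < c →
    Runs τ g b s n → Runs (prepend c τ) g′ (suc b) s (suc n)
  Runs-shift b [] P 1≤c c≤b g<c refl = refl
  Runs-shift {τ} {n} {c} {g} {g′} b (r ∷ s) P 1≤c c≤b g<c (D , ¬D , R) =
    Decreasing-shift c≤b D , broken , Runs-shift (b + r) s P 1≤c (≤-trans c≤b (s≤s (m≤m+n b r))) g<c R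
    where
    broken : ∀ k t → 1 ≤ k → k ≤ r → g′ ≤ t → t < suc b → ¬ Decreasing (prepend c τ) t (suc b + k)
    broken k t 1≤k k≤r _ t<b with t <? c
    ... | yes t<c = ¬Decreasing-prepend P 1≤c t<c (≤-<-trans c≤b (m<m+n (suc b) 1≤k))
          (s≤s (≤-trans (+-monoʳ-≤ b k≤r) (Runs-≤ (b + r) s R)))
    broken k zero    1≤k k≤r _ t<b | no t≮c = ⊥-elim (t≮c 1≤c)
    broken k (suc t) 1≤k k≤r _ t<b | no t≮c = ¬D k t 1≤k k≤r (≤-pred (<-≤-trans g<c (≮⇒≥ t≮c))) (≤-pred t<b)
          ∘ Decreasing-shift⁻ (≮⇒≥ t≮c)

  -- The lowest admissible value has no value between the threshold and itself, so no 312 arises and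
  -- `g` stays. The larger values all follow it, hence it forms a block of its own.
  State-push : ∀ {τ n g s} → State τ n g s → State (prepend (suc g) τ) (suc n) g (1 ∷ s)
  State-push {τ} {n} {g} {s} Q = record
    { permutation = prepend-permutation permutation (s≤s z≤n) (s≤s (Runs-≤ g s runs))
    ; avoids      = Avoids1423-prepend avoids above (s≤s z≤n)
    ; above       = AvoidsAbove-prepend ≤-refl above (Decreasing-empty ≤-refl)
    ; minimal     = λ t t<g → minimal t t<g ∘ AvoidsAbove-tail
    ; runs        = subst (Decreasing (prepend (suc g) τ) g) (+-comm 1 g) (Decreasing-prepend refl (Decreasing-empty ≤-refl))
                  , (λ k t _ _ g≤t t<g → ⊥-elim (<⇒≱ t<g g≤t))
                  , subst (λ b → Runs (prepend (suc g) τ) g b s (suc n)) (+-comm 1 g) (Runs-shift g s permutation (s≤s z≤n) ≤-refl ≤-refl runs)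
    }
    where open State Q

  -- The new value exceeds exactly the lowest `suc i` values of the block at `b` and heads a
  -- decreasing block with them; the upper `k` values now follow a smaller entry and are cut off.
  -- The threshold rises to `b`: from any lower `t`, the values up to `c` contain an ascent, with
  -- which the new entry forms a 312.
  State-split : ∀ {τ n g s₀} → State τ n g s₀ → ∀ b i k s → g ≤ b → Runs τ g b (suc (i + k) ∷ s) n →
    State (prepend (suc (suc (b + i))) τ) (suc n) b (suc (suc i) ∷ k ∷ s)
  State-split {τ} {n} {g} Q b i k s g≤b (D , ¬D , R) = record
    { permutation = prepend-permutation permutation 1≤c c≤n
    ; avoids      = Avoids1423-prepend avoids (AvoidsAbove-mono (≤-trans g≤b (≤-trans (m≤m+n b i) (n≤1+n _))) above) 1≤c
    ; above       = AvoidsAbove-prepend b<c (AvoidsAbove-mono g≤b above) lower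
    ; minimal     = minimal′
    ; runs        = subst (Decreasing τ′ b) (sym 2+i) (Decreasing-prepend refl lower)
                  , (λ _ t _ _ b≤t t<b → ⊥-elim (<⇒≱ t<b b≤t))
                  , subst (λ e → Decreasing τ′ e (e + k)) (sym 2+i) (Decreasing-shift ≤-refl upper)
                  , subst (λ e → ∀ j t → 1 ≤ j → j ≤ k → b ≤ t → t < e → ¬ Decreasing τ′ t (e + j)) (sym 2+i)
                      (λ j t 1≤j j≤k _ t<c → ¬Decreasing-prepend permutation 1≤c t<c (m<m+n c 1≤j) (≤-trans (+-monoʳ-≤ c j≤k) c+k≤n))
                  , subst (λ e → Runs τ′ b e s (suc n)) end (Runs-shift (b + suc (i + k)) s permutation 1≤c c≤end (≤-<-trans g≤b b<c) R)
    }
    where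
    open State Q
    c = suc (suc (b + i))
    τ′ = prepend c τ
    2+i : b + suc (suc i) ≡ c
    2+i = trans (+-suc b (suc i)) (cong suc (+-suc b i))
    mid : suc (b + i) + k ≡ b + suc (i + k)
    mid = trans (cong suc (+-assoc b i k)) (sym (+-suc b (i + k)))
    end : suc (b + suc (i + k)) ≡ b + suc (suc i) + k
    end = trans (cong suc (sym mid)) (cong (_+ k) (sym 2+i))
    b<c : b < c
    b<c = s≤s (≤-trans (m≤m+n b i) (n≤1+n _))
    1≤c : 1 ≤ c
    1≤c = s≤s z≤n
    c+k≤n : c + k ≤ suc n
    c+k≤n = s≤s (subst (_≤ n) (sym mid) (Runs-≤ (b + suc (i + k)) s R))
    c≤n : c ≤ suc n
    c≤n = ≤-trans (m≤m+n c k) c+k≤n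
    c≤end : c ≤ suc (b + suc (i + k))
    c≤end = s≤s (subst (suc (b + i) ≤_) mid (m≤m+n (suc (b + i)) k))
    lower : Decreasing τ b (suc (b + i))
    lower = Decreasing-mono ≤-refl (subst (suc (b + i) ≤_) mid (m≤m+n _ k)) D
    upper : Decreasing τ (suc (b + i)) (suc (b + i) + k)
    upper = Decreasing-mono (≤-trans (m≤m+n b i) (n≤1+n _)) (≤-reflexive mid) D
    minimal′ : ∀ t → t < b → ¬ AvoidsAbove τ′ t
    minimal′ t t<b A with t <? g
    ... | yes t<g = minimal t t<g (AvoidsAbove-tail A)
    ... | no t≮g  = ¬D (suc i) t (s≤s z≤n) (s≤s (m≤m+n i k)) (≮⇒≥ t≮g) t<b
            (subst (Decreasing τ t) (sym (+-suc b i)) (AvoidsAbove-head 1≤c (IsPermutation.unique permutation) A))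

  completions-paths : ∀ m {τ n g s} → State τ n g s → completions (avoidsᵇ p1423) m n τ ≡ paths m s
  completions-paths zero    {τ} Q = count-singleton-true {avoidsᵇ p1423} {τ} (avoids1423⁺ {τ} (State.avoids Q))
  completions-paths (suc m) {τ} {n} {g} {s} Q = begin
    completions (avoidsᵇ p1423) (suc m) n τ                       ≡⟨ completions-suc (avoidsᵇ p1423) m n τ ⟩
    sumFrom f 1 (suc n)                                           ≡⟨ cong (λ t → sumFrom f 1 (suc t)) (Runs-total g s runs) ⟨
    sumFrom f 1 (suc (g + sum s))                                 ≡⟨ cong (sumFrom f 1) (+-suc g (sum s)) ⟨
    sumFrom f 1 (g + suc (sum s))                                 ≡⟨ sumFrom-+ f 1 g (suc (sum s)) ⟩
    -- Insertions up to `g` are dead and `suc g` is the push. A block on the values from `b + 1` to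
    -- `b + r` receives `c` from `b + 2` to `b + r + 1`, and these ranges tile the rest.
    sumFrom f 1 g + (f (suc g) + sumFrom f (suc (suc g)) (sum s)) ≡⟨ cong₂ _+_ low (cong₂ _+_ (completions-paths m (State-push Q)) (blocks g s ≤-refl runs)) ⟩
    paths m (1 ∷ s) + splits (paths m) s                          ∎
    where
    open ≡-Reasoning
    open State Q
    f : ℕ → ℕ
    f c = completions (avoidsᵇ p1423) m (suc n) (prepend c τ)
    low : sumFrom f 1 g ≡ 0
    low = sumFrom-zero 1 g (λ c 1≤c c≤g → dead1423 m (suc n) (prepend c τ)
      (minimal (pred c) (<-≤-trans (≤-reflexive (suc-pred c {{>-nonZero 1≤c}})) (≤-pred c≤g)) ∘ Avoids1423-head 1≤c))
    block : ∀ b i k s → g ≤ b → Runs τ g b (suc (i + k) ∷ s) n → sumFrom f (suc (suc (b + i))) (suc k) ≡ pathsVia (paths m) i k s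
    block b i zero    s g≤b R = trans (+-identityʳ _) (completions-paths m (State-split Q b i 0 s g≤b R))
    block b i (suc k) s g≤b R = cong₂ _+_ (completions-paths m (State-split Q b i (suc k) s g≤b R))
      (trans (cong (λ t → sumFrom f (suc (suc t)) (suc k)) (sym (+-suc b i)))
        (block b (suc i) k s g≤b (subst (λ t → Runs τ g b (suc t ∷ s) n) (+-suc i k) R)))
    blocks : ∀ b s → g ≤ b → Runs τ g b s n → sumFrom f (suc (suc b)) (sum s) ≡ splits (paths m) s
    blocks b []          g≤b R = refl
    -- An empty block, left over when `c` was placed above all values of a block, receives no
    -- insertion.
    blocks b (zero ∷ s)  g≤b (_ , _ , R) = trans (cong (λ t → sumFrom f (suc (suc t)) (sum s)) (sym (+-identityʳ b)))
      (blocks (b + 0) s (≤-trans g≤b (m≤m+n b 0)) R)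
    blocks b (suc r ∷ s) g≤b R@(_ , _ , R′) = trans (sumFrom-+ f (suc (suc b)) (suc r) (sum s)) (cong₂ _+_
      (trans (cong (λ t → sumFrom f (suc (suc t)) (suc r)) (sym (+-identityʳ b))) (block b 0 r s g≤b R))
      (blocks (b + suc r) s (≤-trans g≤b (m≤m+n b (suc r))) R′))

  empty-permutation : IsPermutation 0 []
  empty-permutation = isPermutation refl [] (λ ()) (λ ())

  count-avoids1423 : ∀ n → count (avoidsᵇ p1423) (perms n) ≡ paths n []
  count-avoids1423 n = trans (count-perms (avoidsᵇ p1423) n) (completions-paths n {[]} {0} {0} {[]} (record
    { permutation = empty-permutation
    ; avoids = λ () ; above = λ () ; minimal = λ _ () ; runs = refl }))

  -- Here `r` is the size of the lowest block. An insertion `c ≤ r + 1` has only decreasing values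
  -- below it and yields a lowest block of size `c`; a larger `c` precedes an ascent of smaller
  -- values.
  completions-ballot : ∀ m {τ n r} → IsPermutation n τ → AvoidsAbove τ 0 → r ≤ n → Decreasing τ 0 r →
    (r < n → ¬ Decreasing τ 0 (suc r)) → completions (avoidsᵇ p312) m n τ ≡ ballot m r
  completions-ballot zero    {τ} P A r≤n D ¬D = count-singleton-true {avoidsᵇ p312} {τ} (avoids312⁺ P A)
  completions-ballot (suc m) {τ} {n} {r} P A r≤n D ¬D = begin
    completions (avoidsᵇ p312) (suc m) n τ                       ≡⟨ completions-suc (avoidsᵇ p312) m n τ ⟩
    sumFrom f 1 (suc n)                                          ≡⟨ cong (λ t → sumFrom f 1 (suc t)) (m+[n∸m]≡n r≤n) ⟨
    sumFrom f 1 (suc r + (n ∸ r))                                ≡⟨ sumFrom-+ f 1 (suc r) (n ∸ r) ⟩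
    sumFrom f 1 (suc r) + sumFrom f (suc (suc r)) (n ∸ r)        ≡⟨ cong₂ _+_ (sumFrom-cong 1 (suc r) live) (sumFrom-zero (suc (suc r)) (n ∸ r) dead) ⟩
    sumFrom (ballot m) 1 (suc r) + 0                             ≡⟨ +-identityʳ _ ⟩
    sumFrom (ballot m) 1 (suc r)                                 ≡⟨ ballot-sum r ⟩
    ballot (suc m) r                                             ∎
    where
    open ≡-Reasoning
    f : ℕ → ℕ
    f c = completions (avoidsᵇ p312) m (suc n) (prepend c τ)
    live : ∀ c → 1 ≤ c → c < 1 + suc r → f c ≡ ballot m c
    live (suc c) 1≤c c≤r = completions-ballot m
      (prepend-permutation P 1≤c (s≤s (≤-trans c≤r′ r≤n)))
      (AvoidsAbove-prepend (s≤s z≤n) A D′) (s≤s (≤-trans c≤r′ r≤n)) (Decreasing-prepend refl D′)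
      (λ c<n → ¬Decreasing-prepend P 1≤c (s≤s z≤n) ≤-refl c<n)
      where
      c≤r′ : c ≤ r
      c≤r′ = ≤-pred (≤-pred c≤r)
      D′ : Decreasing τ 0 c
      D′ = Decreasing-mono ≤-refl c≤r′ D
    dead : ∀ c → suc (suc r) ≤ c → c < suc (suc r) + (n ∸ r) → f c ≡ 0
    dead (suc c) r<c c≤n = dead312 m (suc n) (prepend (suc c) τ) (λ A′ → ¬D
      (<-≤-trans (≤-pred r<c) (≤-pred (≤-pred (subst (suc (suc c) ≤_) (cong (suc ∘ suc) (m+[n∸m]≡n r≤n)) c≤n))))
      (Decreasing-mono ≤-refl (≤-pred r<c) (AvoidsAbove-head (s≤s z≤n) (IsPermutation.unique P) A′)))
    ballot-sum : ∀ r → sumFrom (ballot m) 1 (suc r) ≡ ballot (suc m) r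
    ballot-sum zero    = +-identityʳ _
    ballot-sum (suc r) = trans (cong (sumFrom (ballot m) 1) (+-comm 1 (suc r))) (trans (sumFrom-+ (ballot m) 1 (suc r) 1)
      (cong₂ _+_ (ballot-sum r) (+-identityʳ _)))

  count-avoids312 : ∀ n → count (avoidsᵇ p312) (perms n) ≡ ballot n 0
  count-avoids312 n = trans (count-perms (avoidsᵇ p312) n)
    (completions-ballot n {[]} {0} {0} empty-permutation (λ ()) z≤n (λ ()) (λ ()))

  -- Reverse-complement and inverse

  record Transport (n : ℕ) (σ τ : List ℕ) : Set where
    field
      f           : List ℕ → List ℕ
      permutation : ∀ {π} → IsPermutation n π → IsPermutation n (f π)
      injective   : ∀ {π ρ} → IsPermutation n π → IsPermutation n ρ → f π ≡ f ρ → π ≡ ρ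
      contains    : ∀ {π} → IsPermutation n π → T (containsᵇ σ π) → T (containsᵇ τ (f π))

  count-contains-≤ : ∀ {n σ τ} → Transport n σ τ → count (containsᵇ σ) (perms n) ≤ count (containsᵇ τ) (perms n)
  count-contains-≤ {n} t = count-≤ f (perms-unique n) (λ p q → injective (∈-perms⁻ p) (∈-perms⁻ q))
    (λ p c → ∈-perms⁺ (permutation (∈-perms⁻ p)) , contains (∈-perms⁻ p) c)
    where open Transport t

  -- Symmetries carry occurrences to occurrences, so the injections in both directions compare the
  -- permutations that contain the patterns; the avoiders are the complements.
  count-avoids-≡ : ∀ {n σ τ} → Transport n σ τ → Transport n τ σ → count (avoidsᵇ σ) (perms n) ≡ count (avoidsᵇ τ) (perms n)
  count-avoids-≡ {n} {σ} {τ} t u = +-cancelˡ-≡ (count (containsᵇ σ) (perms n)) _ _ (trans (count-not (containsᵇ σ) (perms n))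
    (trans (sym (count-not (containsᵇ τ) (perms n)))
      (cong (_+ count (avoidsᵇ τ) (perms n)) (sym (≤-antisym (count-contains-≤ t) (count-contains-≤ u))))))

  unique-reverse : ∀ {xs : List ℕ} → Unique xs → Unique (reverse xs)
  unique-reverse {[]}     _        = []
  unique-reverse {x ∷ xs} (x∉ ∷ u) = subst Unique (sym (unfold-reverse x xs))
    (Unique.++⁺ (unique-reverse u) ([] ∷ []) λ { (p , here refl) → All.lookup x∉ (reverse⁻ p) refl })

  module ReverseComplement (n : ℕ) where

    complement : ℕ → ℕ
    complement v = suc n ∸ v

    rc : List ℕ → List ℕ
    rc π = map complement (reverse π)

    complement-< : ∀ {v w} → w ≤ n → v < w → complement w < complement v
    complement-< w≤n v<w = ∸-monoʳ-< v<w (m≤n⇒m≤1+n w≤n)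

    complement-involutive : ∀ {v} → v ≤ n → complement (complement v) ≡ v
    complement-involutive v≤n = m∸[m∸n]≡n (m≤n⇒m≤1+n v≤n)

    rc-involutive : ∀ {π} → IsPermutation n π → rc (rc π) ≡ π
    rc-involutive {π} P = begin
      map complement (reverse (map complement (reverse π)))  ≡⟨ cong (map complement) (reverse-map complement (reverse π)) ⟨
      map complement (map complement (reverse (reverse π)))  ≡⟨ cong (map complement ∘ map complement) (reverse-involutive π) ⟩
      map complement (map complement π)                      ≡⟨ map-∘ π ⟨
      map (complement ∘ complement) π                        ≡⟨ map-id-local (All.tabulate (complement-involutive ∘ IsPermutation.bounded P)) ⟩
      π                                                      ∎
      where open ≡-Reasoning

    rc-permutation : ∀ {π} → IsPermutation n π → IsPermutation n (rc π)
    rc-permutation {π} (isPermutation size u pos bnd) = isPermutation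
      (trans (length-map complement (reverse π)) (trans (length-reverse π) size))
      (unique-map (λ {v} {w} p q e → trans (sym (complement-involutive (bnd (reverse⁻ p))))
        (trans (cong complement e) (complement-involutive (bnd (reverse⁻ q))))) (unique-reverse u))
      (λ v∈ → let w , w∈ , eq = ∈-map⁻ complement v∈ in subst (1 ≤_) (sym eq) (m<n⇒0<n∸m (s≤s (bnd (reverse⁻ w∈)))))
      (λ v∈ → let w , w∈ , eq = ∈-map⁻ complement v∈ in subst (_≤ n) (sym eq) (∸-monoʳ-≤ (suc n) (pos (reverse⁻ w∈))))

    module _ {π} (P : IsPermutation n π) where
      open IsPermutation P

      rc₃ : ∀ {a b c} → (a ∷ b ∷ c ∷ []) ⊆ π → (complement c ∷ complement b ∷ complement a ∷ []) ⊆ rc π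
      rc₃ s = map⁺ complement (reverse⁺ s)

      rc₄ : ∀ {a b c d} → (a ∷ b ∷ c ∷ d ∷ []) ⊆ π → (complement d ∷ complement c ∷ complement b ∷ complement a ∷ []) ⊆ rc π
      rc₄ s = map⁺ complement (reverse⁺ s)

      flip : ∀ {v w s} → (w ∷ s) ⊆ π → v < w → complement w < complement v
      flip s = complement-< (bounded (to∈ s))

    transport : ∀ {σ τ} → (∀ {π} → IsPermutation n π → T (containsᵇ σ π) → T (containsᵇ τ (rc π))) → Transport n σ τ
    transport c = record
      { f = rc ; permutation = rc-permutation
      ; injective = λ P Q eq → trans (sym (rc-involutive P)) (trans (cong rc eq) (rc-involutive Q)) ; contains = c }

    rc231 : Transport n p231 p312
    rc231 = transport λ {π} P t → let a , b , c , s , ca , ab = Represents₃.sound represents231 {π} t in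
      Represents₃.complete represents312 (_ , _ , _ , rc₃ P s , flip P (∷ˡ⁻ s) ab , flip P s ca)

    rc312 : Transport n p312 p231
    rc312 = transport λ {π} P t → let a , b , c , s , bc , ca = Represents₃.sound represents312 {π} t in
      Represents₃.complete represents231 (_ , _ , _ , rc₃ P s , flip P s ca , flip P (∷ˡ⁻ (∷ˡ⁻ s)) bc)

    rc1342 : Transport n p1342 p3124
    rc1342 = transport λ {π} P t → let a , b , c , d , s , ad , db , bc = Represents₄.sound represents1342 {π} t in
      Represents₄.complete represents3124 (_ , _ , _ , _ , rc₄ P s , flip P (∷ˡ⁻ (∷ˡ⁻ s)) bc , flip P (∷ˡ⁻ s) db , flip P (∷ˡ⁻ (∷ˡ⁻ (∷ˡ⁻ s))) ad)

    rc3124 : Transport n p3124 p1342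
    rc3124 = transport λ {π} P t → let a , b , c , d , s , bc , ca , ad = Represents₄.sound represents3124 {π} t in
      Represents₄.complete represents1342 (_ , _ , _ , _ , rc₄ P s , flip P (∷ˡ⁻ (∷ˡ⁻ (∷ˡ⁻ s))) ad , flip P s ca , flip P (∷ˡ⁻ (∷ˡ⁻ s)) bc)

    rc2314 : Transport n p2314 p1423
    rc2314 = transport λ {π} P t → let a , b , c , d , s , ca , ab , bd = Represents₄.sound represents2314 {π} t in
      Represents₄.complete represents1423 (_ , _ , _ , _ , rc₄ P s , flip P (∷ˡ⁻ (∷ˡ⁻ (∷ˡ⁻ s))) bd , flip P (∷ˡ⁻ s) ab , flip P s ca)

    rc1423 : Transport n p1423 p2314
    rc1423 = transport λ {π} P t → let a , b , c , d , s , ac , cd , db = Represents₄.sound represents1423 {π} t in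
      Represents₄.complete represents2314 (_ , _ , _ , _ , rc₄ P s , flip P (∷ˡ⁻ s) db , flip P (∷ˡ⁻ (∷ˡ⁻ (∷ˡ⁻ s))) cd , flip P (∷ˡ⁻ (∷ˡ⁻ s)) ac)

  -- An absent value is located just past the end of the list.
  position : ℕ → List ℕ → ℕ
  position v []       = 1
  position v (w ∷ ws) with v ≟ w
  ... | yes _ = 1
  ... | no _  = suc (position v ws)

  position-positive : ∀ v π → 1 ≤ position v π
  position-positive v []      = s≤s z≤n
  position-positive v (w ∷ π) with v ≟ w
  ... | yes _ = s≤s z≤n
  ... | no _  = s≤s z≤n

  ∈-tail : ∀ {v w : ℕ} {π} → v ≢ w → v ∈ w ∷ π → v ∈ π
  ∈-tail v≢w (here eq)  = ⊥-elim (v≢w eq)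
  ∈-tail v≢w (there v∈) = v∈

  position-bounded : ∀ {v π} → v ∈ π → position v π ≤ length π
  position-bounded {v} {w ∷ π} v∈ with v ≟ w
  ... | yes _  = s≤s z≤n
  ... | no v≢w = s≤s (position-bounded (∈-tail v≢w v∈))

  position-injective : ∀ {v w π} → v ∈ π → w ∈ π → position v π ≡ position w π → v ≡ w
  position-injective {v} {w} {u ∷ π} v∈ w∈ eq with v ≟ u | w ≟ u
  ... | yes v≡u | yes w≡u = trans v≡u (sym w≡u)
  ... | yes _   | no w≢u  = ⊥-elim (<-irrefl (suc-injective eq) (position-positive w π))
  ... | no v≢u  | yes _   = ⊥-elim (<-irrefl (sym (suc-injective eq)) (position-positive v π))
  ... | no v≢u  | no w≢u  = position-injective (∈-tail v≢u v∈) (∈-tail w≢u w∈) (suc-injective eq)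

  position-< : ∀ {a b : ℕ} {s π} → Unique π → (a ∷ b ∷ s) ⊆ π → position a π < position b π
  position-< {a} {b} {s} {u ∷ π} (u∉ ∷ U) (.u ∷ʳ p) with a ≟ u | b ≟ u
  ... | yes a≡u | _       = ⊥-elim (All.lookup u∉ (to∈ p) (sym a≡u))
  ... | no _    | yes b≡u = ⊥-elim (All.lookup u∉ (to∈ (∷ˡ⁻ p)) (sym b≡u))
  ... | no _    | no _    = s≤s (position-< U p)
  position-< {a} {b} {s} {u ∷ π} (u∉ ∷ U) (refl ∷ p) with a ≟ u | b ≟ u
  ... | no a≢u | _       = ⊥-elim (a≢u refl)
  ... | yes _  | yes b≡u = ⊥-elim (All.lookup u∉ (to∈ p) (sym b≡u))
  ... | yes _  | no _    = s≤s (position-positive b π)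

  -- The entries at position 1 must agree, and deleting them lowers all other positions by one. This
  -- is what makes `inverse` injective.
  position-determines : ∀ {π ρ} → Unique π → length π ≡ length ρ → (∀ {v} → v ∈ π → position v π ≡ position v ρ) → π ≡ ρ
  position-determines {[]}    {[]}    _        _   _  = refl
  position-determines {x ∷ π} {y ∷ ρ} (x∉ ∷ U) len eq with x≡y
    where
    x≡y : x ≡ y
    x≡y with x ≟ y | x ≟ x | eq (here refl)
    ... | yes p | _     | _ = p
    ... | no _  | no x≢ | _ = ⊥-elim (x≢ refl)
    ... | no _  | yes _ | e = ⊥-elim (<-irrefl (suc-injective e) (position-positive x ρ))
  ... | refl = cong (x ∷_) (position-determines U (suc-injective len) tail)
    where
    tail : ∀ {v} → v ∈ π → position v π ≡ position v ρ
    tail {v} v∈ with v ≟ x | eq (there v∈)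
    ... | yes v≡x | _ = ⊥-elim (All.lookup x∉ v∈ (sym v≡x))
    ... | no _    | e = suc-injective e

  map-agree : ∀ {f g : ℕ → ℕ} xs → map f xs ≡ map g xs → ∀ {v} → v ∈ xs → f v ≡ g v
  map-agree (x ∷ xs) eq (here refl) = proj₁ (∷-injective eq)
  map-agree (x ∷ xs) eq (there v∈)  = map-agree xs (proj₂ (∷-injective eq)) v∈

  ∷-⊆-interval : ∀ {x s} b k → b ≤ x → x < b + k → (∀ k′ → suc x + k′ ≡ b + k → s ⊆ interval (suc x) k′) → (x ∷ s) ⊆ interval b k
  ∷-⊆-interval {x} b zero    b≤x x<b _ = ⊥-elim (<⇒≱ x<b (subst (_≤ x) (sym (+-identityʳ b)) b≤x))
  ∷-⊆-interval {x} b (suc k) b≤x x<b rest with b ≟ x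
  ... | yes refl = refl ∷ rest k (sym (+-suc b k))
  ... | no b≢x   = b ∷ʳ ∷-⊆-interval (suc b) k (≤∧≢⇒< b≤x b≢x) (subst (x <_) (+-suc b k) x<b)
        (λ k′ eq → rest k′ (trans eq (sym (+-suc b k))))

  increasing-⊆ : ∀ {n a b c d} → 1 ≤ a → a < b → b < c → c < d → d ≤ n → (a ∷ b ∷ c ∷ d ∷ []) ⊆ range1 n
  increasing-⊆ {n} {a} {b} {c} {d} 1≤a a<b b<c c<d d≤n = subst ((a ∷ b ∷ c ∷ d ∷ []) ⊆_) (sym (range1≡interval n))
    (∷-⊆-interval 1 n 1≤a (s≤s (<⇒≤ (<-trans a<b b<n))) λ k₁ e₁ →
     ∷-⊆-interval (suc a) k₁ a<b (subst (b <_) (sym e₁) (s≤s (<⇒≤ b<n))) λ k₂ e₂ →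
     ∷-⊆-interval (suc b) k₂ b<c (subst (c <_) (sym (trans e₂ e₁)) (s≤s (<⇒≤ c<n))) λ k₃ e₃ →
     ∷-⊆-interval (suc c) k₃ c<d (subst (d <_) (sym (trans e₃ (trans e₂ e₁))) (s≤s d≤n)) λ k₄ _ → []⊆-universal _)
    where
    c<n : c < n
    c<n = <-≤-trans c<d d≤n
    b<n : b < n
    b<n = <-trans b<c c<n

  module Inverse (n : ℕ) where

    inverse : List ℕ → List ℕ
    inverse π = map (λ v → position v π) (range1 n)

    inverse-permutation : ∀ {π} → IsPermutation n π → IsPermutation n (inverse π)
    inverse-permutation {π} P = isPermutation
      (trans (length-map _ (range1 n)) (length-range1 n))
      (unique-map (λ p q → position-injective (here∈ p) (here∈ q)) (range1-unique n))
      (λ v∈ → let w , _ , eq = ∈-map⁻ (λ v → position v π) v∈ in subst (1 ≤_) (sym eq) (position-positive w π))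
      (λ v∈ → let w , w∈ , eq = ∈-map⁻ (λ v → position v π) v∈ in
        subst₂ _≤_ (sym eq) (IsPermutation.size P) (position-bounded (here∈ w∈)))
      where
      here∈ : ∀ {v} → v ∈ range1 n → v ∈ π
      here∈ v∈ = let 1≤v , v≤n = ∈-range1⁻ v∈ in surjective P 1≤v v≤n

    inverse-injective : ∀ {π ρ} → IsPermutation n π → IsPermutation n ρ → inverse π ≡ inverse ρ → π ≡ ρ
    inverse-injective P Q eq = position-determines (IsPermutation.unique P)
      (trans (IsPermutation.size P) (sym (IsPermutation.size Q)))
      (λ v∈ → map-agree (range1 n) eq (∈-range1⁺ (IsPermutation.positive P v∈) (IsPermutation.bounded P v∈)))

    transport : ∀ {σ τ} → (∀ {π} → IsPermutation n π → T (containsᵇ σ π) → T (containsᵇ τ (inverse π))) → Transport n σ τ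
    transport c = record { f = inverse ; permutation = inverse-permutation ; injective = inverse-injective ; contains = c }

    -- Listed by increasing value, the entries of the occurrence form a sublist of `range1 n`. Their
    -- positions form the occurrence in the inverse, and their order in `π` supplies its
    -- inequalities.
    inverse1342 : Transport n p1342 p1423
    inverse1342 = transport λ {π} P t → let a , b , c , d , s , ad , db , bc = Represents₄.sound represents1342 {π} t in
      Represents₄.complete represents1423 (_ , _ , _ , _
        , map⁺ (λ v → position v π) (increasing-⊆ (IsPermutation.positive P (to∈ s)) ad db bc (IsPermutation.bounded P (to∈ (∷ˡ⁻ (∷ˡ⁻ s)))))
        , position-< (IsPermutation.unique P) s , position-< (IsPermutation.unique P) (∷ˡ⁻ s) , position-< (IsPermutation.unique P) (∷ˡ⁻ (∷ˡ⁻ s)))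

    inverse1423 : Transport n p1423 p1342
    inverse1423 = transport λ {π} P t → let a , b , c , d , s , ac , cd , db = Represents₄.sound represents1423 {π} t in
      Represents₄.complete represents1342 (_ , _ , _ , _
        , map⁺ (λ v → position v π) (increasing-⊆ (IsPermutation.positive P (to∈ s)) ac cd db (IsPermutation.bounded P (to∈ (∷ˡ⁻ s))))
        , position-< (IsPermutation.unique P) s , position-< (IsPermutation.unique P) (∷ˡ⁻ s) , position-< (IsPermutation.unique P) (∷ˡ⁻ (∷ˡ⁻ s)))

  count-1342≡1423 : ∀ n → count (avoidsᵇ p1342) (perms n) ≡ count (avoidsᵇ p1423) (perms n)
  count-1342≡1423 n = count-avoids-≡ (Inverse.inverse1342 n) (Inverse.inverse1423 n)

  count-2314≡1423 : ∀ n → count (avoidsᵇ p2314) (perms n) ≡ count (avoidsᵇ p1423) (perms n)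
  count-2314≡1423 n = count-avoids-≡ (ReverseComplement.rc2314 n) (ReverseComplement.rc1423 n)

  count-3124≡1342 : ∀ n → count (avoidsᵇ p3124) (perms n) ≡ count (avoidsᵇ p1342) (perms n)
  count-3124≡1342 n = count-avoids-≡ (ReverseComplement.rc3124 n) (ReverseComplement.rc1342 n)

  count-231≡312 : ∀ n → count (avoidsᵇ p231) (perms n) ≡ count (avoidsᵇ p312) (perms n)
  count-231≡312 n = count-avoids-≡ (ReverseComplement.rc231 n) (ReverseComplement.rc312 n)

  -- Direct sums

  -- For a permutation this one inclusion already forces the first `i` entries to be all of `1` to
  -- `i`, by pigeonhole.
  Initial : List ℕ → ℕ → Set
  Initial π i = ∀ {v} → v ∈ take i π → v ≤ i

  ∈-take : ∀ {v : ℕ} i π → v ∈ take i π → v ∈ π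
  ∈-take i π v∈ = subst (_ ∈_) (take++drop≡id i π) (∈-++⁺ˡ v∈)

  ∈-drop : ∀ {v : ℕ} i π → v ∈ drop i π → v ∈ π
  ∈-drop i π v∈ = subst (_ ∈_) (take++drop≡id i π) (∈-++⁺ʳ (take i π) v∈)

  take-++ : ∀ i (α γ : List ℕ) → i ≤ length α → take i (α ++ γ) ≡ take i α
  take-++ zero    α       γ _         = refl
  take-++ (suc i) (x ∷ α) γ (s≤s i≤α) = cong (x ∷_) (take-++ i α γ i≤α)

  take-permutation : ∀ {n i π} → IsPermutation n π → i ≤ n → Initial π i → IsPermutation i (take i π)
  take-permutation {n} {i} {π} (isPermutation size u pos bnd) i≤n init = isPermutation
    (trans (length-take i π) (m≤n⇒m⊓n≡m (subst (i ≤_) (sym size) i≤n))) (Unique.take⁺ i u) (pos ∘ ∈-take i π) init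

  prefix⇒Initial : ∀ π i → T (prefixIsInitialᵇ π i) → Initial π i
  prefix⇒Initial π i t v∈ = proj₂ (∈-range1⁻ (elemᵇ⇒∈ _ (range1 i)
    (All.lookup (all⁺ (λ x → elemᵇ x (range1 i)) (take i π) (proj₁ (Equivalence.to T-∧ t))) v∈)))

  Initial⇒prefix : ∀ {n i π} → IsPermutation n π → i ≤ n → Initial π i → T (prefixIsInitialᵇ π i)
  Initial⇒prefix {n} {i} {π} P i≤n init = Equivalence.from T-∧
    ( all⁻ (λ x → elemᵇ x (range1 i)) (All.tabulate (λ v∈ → ∈⇒elemᵇ (∈-range1⁺ (IsPermutation.positive Q v∈) (init v∈))))
    , all⁻ (λ v → elemᵇ v (take i π)) (All.tabulate (λ v∈ → ∈⇒elemᵇ (surjective Q (proj₁ (∈-range1⁻ v∈)) (proj₂ (∈-range1⁻ v∈))))) )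
    where
    Q : IsPermutation i (take i π)
    Q = take-permutation P i≤n init

  record LeastPrefix (π : List ℕ) (b d r : ℕ) : Set where
    field
      lower    : b ≤ r
      upper    : r ≤ d
      isPrefix : T (prefixIsInitialᵇ π r)
      least    : ∀ i → b ≤ i → i < r → ¬ T (prefixIsInitialᵇ π i)

  -- The searched interval ends at `d`, where the test succeeds, so the search is never exhausted
  -- and the default never hides a failure.
  firstFrom-least : ∀ π b k d → b + k ≡ suc d → b ≤ d → T (prefixIsInitialᵇ π d) → LeastPrefix π b d (firstFrom π (interval b k) d)
  firstFrom-least π b zero    d eq b≤d t = ⊥-elim (<-irrefl (trans (sym (+-identityʳ b)) eq) (s≤s b≤d))
  firstFrom-least π b (suc k) d eq b≤d t with prefixIsInitialᵇ π b in eqb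
  ... | true  = record { lower = ≤-refl ; upper = b≤d ; isPrefix = subst T (sym eqb) _
                       ; least = λ i b≤i i<b → ⊥-elim (<⇒≱ i<b b≤i) }
  ... | false = record { lower = <⇒≤ (LeastPrefix.lower L) ; upper = LeastPrefix.upper L ; isPrefix = LeastPrefix.isPrefix L ; least = least }
    where
    b<d : b < d
    b<d = ≤∧≢⇒< b≤d (λ b≡d → subst T (trans (cong (prefixIsInitialᵇ π) (sym b≡d)) eqb) t)
    L : LeastPrefix π (suc b) d (firstFrom π (interval (suc b) k) d)
    L = firstFrom-least π (suc b) k d (trans (sym (+-suc b k)) eq) b<d t
    least : ∀ i → b ≤ i → i < firstFrom π (interval (suc b) k) d → ¬ T (prefixIsInitialᵇ π i)
    least i b≤i i<r with b ≟ i
    ... | yes refl = subst T eqb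
    ... | no b≢i   = LeastPrefix.least L i (≤∧≢⇒< b≤i b≢i) i<r

  iπ-least : ∀ {n π} → IsPermutation n π → 1 ≤ n → LeastPrefix π 1 n (iπ π)
  iπ-least {n} {π} P 1≤n = subst₂ (LeastPrefix π 1) size (sym (cong (λ l → firstFrom π l (length π)) (range1≡interval (length π))))
    (firstFrom-least π 1 (length π) (length π) refl (subst (1 ≤_) (sym size) 1≤n)
      (subst (T ∘ prefixIsInitialᵇ π) (sym size) (Initial⇒prefix P ≤-refl (λ v∈ → IsPermutation.bounded P (∈-take n π v∈)))))
    where open IsPermutation P using (size)

  Indecomposable : ℕ → List ℕ → Set
  Indecomposable n π = ∀ i → 1 ≤ i → i < n → ¬ Initial π i

  indecomposableᵇ-iπ : ∀ {π} → 1 ≤ length π → indecomposableᵇ π ≡ (iπ π ≡ᵇ length π)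
  indecomposableᵇ-iπ {x ∷ π} _ = refl

  indecomposable⁻ : ∀ {n π} → IsPermutation n π → 1 ≤ n → T (indecomposableᵇ π) → Indecomposable n π
  indecomposable⁻ {n} {π} P 1≤n t i 1≤i i<n init = LeastPrefix.least (iπ-least P 1≤n) i 1≤i (subst (i <_) (sym (trans iπ≡ size)) i<n)
    (Initial⇒prefix P (<⇒≤ i<n) init)
    where
    open IsPermutation P using (size)
    iπ≡ : iπ π ≡ length π
    iπ≡ = ≡ᵇ⇒≡ _ _ (subst T (indecomposableᵇ-iπ {π} (subst (1 ≤_) (sym size) 1≤n)) t)

  indecomposable⁺ : ∀ {n π} → IsPermutation n π → 1 ≤ n → Indecomposable n π → T (indecomposableᵇ π)
  indecomposable⁺ {n} {π} P 1≤n ind = subst T (sym (indecomposableᵇ-iπ {π} (subst (1 ≤_) (sym size) 1≤n)))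
    (≡⇒≡ᵇ _ _ (trans iπ≡n (sym size)))
    where
    open IsPermutation P using (size)
    module L = LeastPrefix (iπ-least P 1≤n)
    iπ≡n : iπ π ≡ n
    iπ≡n with iπ π ≟ n
    ... | yes eq = eq
    ... | no neq = ⊥-elim (ind (iπ π) L.lower (≤∧≢⇒< L.upper neq) (prefix⇒Initial π (iπ π) L.isPrefix))

  infixr 5 _⊕[_]_
  _⊕[_]_ : List ℕ → ℕ → List ℕ → List ℕ
  α ⊕[ m ] β = α ++ map (m +_) β

  ⊕-permutation : ∀ {m k α β} → IsPermutation m α → IsPermutation k β → IsPermutation (m + k) (α ⊕[ m ] β)
  ⊕-permutation {m} {k} {α} {β} P Q = isPermutation
    (trans (length-++ α) (cong₂ _+_ P.size (trans (length-map (m +_) β) Q.size)))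
    (Unique.++⁺ P.unique (Unique.map⁺ (+-cancelˡ-≡ m _ _) Q.unique) λ { (v∈α , v∈β) → disjoint v∈α (∈-map⁻ (m +_) v∈β) })
    (λ v∈ → positive (∈-++⁻ α v∈)) (λ v∈ → bounded (∈-++⁻ α v∈))
    where
    module P = IsPermutation P
    module Q = IsPermutation Q
    disjoint : ∀ {v} → v ∈ α → (∃ λ w → w ∈ β × v ≡ m + w) → ⊥
    disjoint v∈ (w , w∈ , refl) = <⇒≱ (m<m+n m (Q.positive w∈)) (P.bounded v∈)
    positive : ∀ {v} → v ∈ α ⊎ v ∈ map (m +_) β → 1 ≤ v
    positive (inj₁ v∈) = P.positive v∈
    positive (inj₂ v∈) with ∈-map⁻ (m +_) v∈
    ... | w , w∈ , refl = ≤-trans (Q.positive w∈) (m≤n+m w m)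
    bounded : ∀ {v} → v ∈ α ⊎ v ∈ map (m +_) β → v ≤ m + k
    bounded (inj₁ v∈) = ≤-trans (P.bounded v∈) (m≤m+n m k)
    bounded (inj₂ v∈) with ∈-map⁻ (m +_) v∈
    ... | w , w∈ , refl = +-monoʳ-≤ m (Q.bounded w∈)

  map-+-injective : ∀ m {xs ys : List ℕ} → map (m +_) xs ≡ map (m +_) ys → xs ≡ ys
  map-+-injective m {[]}     {[]}     _  = refl
  map-+-injective m {x ∷ xs} {y ∷ ys} eq = let p , q = ∷-injective eq in cong₂ _∷_ (+-cancelˡ-≡ m x y p) (map-+-injective m q)

  record Decomposition (n : ℕ) (π : List ℕ) : Set where
    field
      m           : ℕ
      1≤m         : 1 ≤ m
      m≤n         : m ≤ n
      α β         : List ℕ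
      α-perm      : IsPermutation m α
      α-indec     : T (indecomposableᵇ α)
      β-perm      : IsPermutation (n ∸ m) β
      isSum       : π ≡ α ⊕[ m ] β

  decomposition : ∀ {n π} → IsPermutation n π → 1 ≤ n → Decomposition n π
  decomposition {n} {π} P 1≤n = record
    { m = m ; 1≤m = L.lower ; m≤n = L.upper ; α = α ; β = map (_∸ m) ρ
    ; α-perm = α-perm
    ; α-indec = indecomposable⁺ α-perm L.lower (λ i 1≤i i<m init → L.least i 1≤i i<m
        (Initial⇒prefix P (<⇒≤ (<-≤-trans i<m L.upper))
          (λ v∈ → init (subst (_ ∈_) (sym (trans (take-take i m π) (cong (λ t → take t π) (m≤n⇒m⊓n≡m (<⇒≤ i<m))))) v∈))))
    ; β-perm = isPermutation
        (trans (length-map (_∸ m) ρ) (trans (length-drop m π) (cong (_∸ m) size)))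
        (unique-map (λ {v} {w} v∈ w∈ eq → trans (sym (m+[n∸m]≡n (<⇒≤ (above v∈)))) (trans (cong (m +_) eq) (m+[n∸m]≡n (<⇒≤ (above w∈))))) (Unique.drop⁺ m unique))
        (λ v∈ → let w , w∈ , eq = ∈-map⁻ (_∸ m) v∈ in subst (1 ≤_) (sym eq) (m<n⇒0<n∸m (above w∈)))
        (λ v∈ → let w , w∈ , eq = ∈-map⁻ (_∸ m) v∈ in subst (_≤ n ∸ m) (sym eq) (∸-monoˡ-≤ m (bounded (∈-drop m π w∈))))
    ; isSum = trans (sym (take++drop≡id m π)) (cong (α ++_) (sym (trans (sym (map-∘ ρ)) (map-id-local (All.tabulate (λ v∈ → m+[n∸m]≡n (<⇒≤ (above v∈))))))))
    }
    where
    open IsPermutation P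
    m = iπ π
    module L = LeastPrefix (iπ-least P 1≤n)
    α ρ : List ℕ
    α = take m π
    ρ = drop m π
    α-perm : IsPermutation m α
    α-perm = take-permutation P L.upper (prefix⇒Initial π m L.isPrefix)
    disjoint : ∀ (xs : List ℕ) {ys v} → Unique (xs ++ ys) → v ∈ xs → v ∈ ys → ⊥
    disjoint (x ∷ xs) (x∉ ∷ _) (here refl) v∈ys = All.lookup x∉ (∈-++⁺ʳ xs v∈ys) refl
    disjoint (x ∷ xs) (_ ∷ u)  (there v∈)  v∈ys = disjoint xs u v∈ v∈ys
    above : ∀ {v} → v ∈ ρ → m < v
    above {v} v∈ with m <? v
    ... | yes m<v = m<v
    -- As a permutation of `[m]`, `α` already contains every value up to `m`.
    ... | no m≮v  = ⊥-elim (disjoint α (subst Unique (sym (take++drop≡id m π)) unique)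
            (surjective α-perm (positive (∈-drop m π v∈)) (≮⇒≥ m≮v)) v∈)

  -- The shorter first component would be a proper initial segment of the longer one, against its
  -- indecomposability.
  decomposition-size-unique : ∀ {m m′ α α′ γ γ′} → IsPermutation m α → IsPermutation m′ α′ → 1 ≤ m → Indecomposable m′ α′ →
    α ++ γ ≡ α′ ++ γ′ → ¬ m < m′
  decomposition-size-unique {m} {m′} {α} {α′} {γ} {γ′} P P′ 1≤m ind eq m<m′ = ind m 1≤m m<m′
    (λ v∈ → IsPermutation.bounded P (subst (_ ∈_) prefix v∈))
    where
    prefix : take m α′ ≡ α
    prefix = begin
      take m α′         ≡⟨ take-++ m α′ γ′ (subst (m ≤_) (sym (IsPermutation.size P′)) (<⇒≤ m<m′)) ⟨
      take m (α′ ++ γ′) ≡⟨ cong (take m) eq ⟨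
      take m (α ++ γ)   ≡⟨ take-++ m α γ (≤-reflexive (sym (IsPermutation.size P))) ⟩
      take m α          ≡⟨ take-all m α (≤-reflexive (IsPermutation.size P)) ⟩
      α                 ∎
      where open ≡-Reasoning

  indecomposables : ℕ → List (List ℕ)
  indecomposables m = filterᵇ indecomposableᵇ (perms m)

  ∈-indecomposables : ∀ m {α} → α ∈ indecomposables m → IsPermutation m α × T (indecomposableᵇ α)
  ∈-indecomposables m α∈ = let p , t = ∈-filter⁻ (T? ∘ indecomposableᵇ) α∈ in ∈-perms⁻ p , t

  sumsWith : ℕ → ℕ → List ℕ → List (List ℕ)
  sumsWith n m α = map (α ⊕[ m ]_) (perms (n ∸ m))

  sumsOfSize : ℕ → ℕ → List (List ℕ)
  sumsOfSize n m = concatMap (sumsWith n m) (indecomposables m)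

  sums : ℕ → List (List ℕ)
  sums n = concatMap (sumsOfSize n) (range1 n)

  ∈-sumsOfSize : ∀ n m {π} → π ∈ sumsOfSize n m →
    ∃ λ α → ∃ λ β → IsPermutation m α × T (indecomposableᵇ α) × IsPermutation (n ∸ m) β × π ≡ α ⊕[ m ] β
  ∈-sumsOfSize n m π∈ with ∈-concatMap⁻′ (indecomposables m) π∈
  ... | α , α∈ , π∈′ with ∈-map⁻ (α ⊕[ m ]_) π∈′
  ... | β , β∈ , eq = α , β , proj₁ (∈-indecomposables m α∈) , proj₂ (∈-indecomposables m α∈) , ∈-perms⁻ β∈ , eq

  enumerates-sums : ∀ {n} → 1 ≤ n → Enumerates n (sums n)
  enumerates-sums {n} 1≤n = enumerates
    (unique-concatMap (range1-unique n) unique₁ same-size) sound complete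
    where
    unique₁ : ∀ {m} → m ∈ range1 n → Unique (sumsOfSize n m)
    unique₁ {m} _ = unique-concatMap (Unique.filter⁺ (T? ∘ indecomposableᵇ) (perms-unique m))
      (λ {α} _ → Unique.map⁺ (λ eq → map-+-injective m (++-cancelˡ α _ _ eq)) (perms-unique (n ∸ m)))
      λ {α} {α′} α∈ α′∈ y∈ y∈′ → same-head (∈-indecomposables m α∈) (∈-indecomposables m α′∈) (∈-map⁻ (α ⊕[ m ]_) y∈) (∈-map⁻ (α′ ⊕[ m ]_) y∈′)
      where
      same-head : ∀ {α α′ y} → IsPermutation m α × T (indecomposableᵇ α) → IsPermutation m α′ × T (indecomposableᵇ α′) →
        (∃ λ β → β ∈ perms (n ∸ m) × y ≡ α ⊕[ m ] β) → (∃ λ β → β ∈ perms (n ∸ m) × y ≡ α′ ⊕[ m ] β) → α ≡ α′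
      same-head {α} {α′} (P , _) (P′ , _) (β , _ , refl) (β′ , _ , eq) = begin
        α                          ≡⟨ take-all m α (≤-reflexive (IsPermutation.size P)) ⟨
        take m α                   ≡⟨ take-++ m α _ (≤-reflexive (sym (IsPermutation.size P))) ⟨
        take m (α ⊕[ m ] β)        ≡⟨ cong (take m) eq ⟩
        take m (α′ ⊕[ m ] β′)      ≡⟨ take-++ m α′ _ (≤-reflexive (sym (IsPermutation.size P′))) ⟩
        take m α′                  ≡⟨ take-all m α′ (≤-reflexive (IsPermutation.size P′)) ⟩
        α′                         ∎
        where open ≡-Reasoning
    same-size : ∀ {m m′ y} → m ∈ range1 n → m′ ∈ range1 n → y ∈ sumsOfSize n m → y ∈ sumsOfSize n m′ → m ≡ m′
    same-size {m} {m′} m∈ m′∈ y∈ y∈′ with ∈-sumsOfSize n m y∈ | ∈-sumsOfSize n m′ y∈′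
    ... | α , β , P , I , _ , refl | α′ , β′ , P′ , I′ , _ , eq with <-cmp m m′
    ... | tri≈ _ m≡m′ _ = m≡m′
    ... | tri< m<m′ _ _ = ⊥-elim (decomposition-size-unique P P′ 1≤m (indecomposable⁻ P′ 1≤m′ I′) eq m<m′)
      where
      1≤m : 1 ≤ m
      1≤m = proj₁ (∈-range1⁻ m∈)
      1≤m′ : 1 ≤ m′
      1≤m′ = proj₁ (∈-range1⁻ m′∈)
    ... | tri> _ _ m′<m = ⊥-elim (decomposition-size-unique P′ P (proj₁ (∈-range1⁻ m′∈)) (indecomposable⁻ P (proj₁ (∈-range1⁻ m∈)) I) (sym eq) m′<m)
    sound : ∀ {π} → π ∈ sums n → IsPermutation n π
    sound π∈ with ∈-concatMap⁻′ (range1 n) π∈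
    ... | m , m∈ , π∈′ with ∈-sumsOfSize n m π∈′
    ... | α , β , P , _ , Q , refl = subst (λ k → IsPermutation k (α ⊕[ m ] β)) (m+[n∸m]≡n (proj₂ (∈-range1⁻ m∈))) (⊕-permutation P Q)
    complete : ∀ {π} → IsPermutation n π → π ∈ sums n
    complete P = subst (_∈ sums n) (sym D.isSum) (∈-concatMap (∈-range1⁺ D.1≤m D.m≤n)
      (∈-concatMap (∈-filter⁺ (T? ∘ indecomposableᵇ) (∈-perms⁺ D.α-perm) D.α-indec) (∈-map⁺ (D.α ⊕[ D.m ]_) (∈-perms⁺ D.β-perm))))
      where module D = Decomposition (decomposition P 1≤n)

  -- Patterns in direct sums

  ⊆-++⁻ : ∀ (α : List ℕ) {γ s} → s ⊆ (α ++ γ) → ∃ λ t → ∃ λ u → s ≡ t ++ u × t ⊆ α × u ⊆ γ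
  ⊆-++⁻ []      {s = s} p  = [] , s , refl , [] , p
  ⊆-++⁻ (x ∷ α) (.x ∷ʳ p)   = let t , u , eq , q , r = ⊆-++⁻ α p in t , u , eq , x ∷ʳ q , r
  ⊆-++⁻ (x ∷ α) (refl ∷ p) = let t , u , eq , q , r = ⊆-++⁻ α p in x ∷ t , u , cong (x ∷_) eq , refl ∷ q , r

  avoids-∧ : ∀ {b c d} → (T b → T c ⊎ T d) → (T c → T b) → (T d → T b) → not b ≡ not c ∧ not d
  avoids-∧ {true}  {true}          _ _ _ = refl
  avoids-∧ {true}  {false} {true}  _ _ _ = refl
  avoids-∧ {true}  {false} {false} f _ _ with f _
  ... | inj₁ ()
  ... | inj₂ ()
  avoids-∧ {false} {true}          _ g _ = ⊥-elim (g _)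
  avoids-∧ {false} {false} {true}  _ _ h = ⊥-elim (h _)
  avoids-∧ {false} {false} {false} _ _ _ = refl

  -- When `σ` is `ρ` followed by a new maximum, a nonempty `β` supplies the maximum for an
  -- occurrence of `ρ` in `α`.
  SumRule : List ℕ → List ℕ → Set
  SumRule ρ σ = ∀ {m k α β} → IsPermutation m α → IsPermutation k β → 1 ≤ k →
    avoidsᵇ σ (α ⊕[ m ] β) ≡ avoidsᵇ ρ α ∧ avoidsᵇ σ β

  module SumIndecomposable
    (ρ : List ℕ) (R : Relation₃) (rep : Represents₃ ρ R)
    (last<first : ∀ {a b c} → R a b c → c < a)
    (shift : ∀ m {a b c} → R a b c → R (m + a) (m + b) (m + c))
    (unshift : ∀ m {a b c} → R (m + a) (m + b) (m + c) → R a b c)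
    where

    open Represents₃ rep

    module _ {m k α β} (P : IsPermutation m α) (Q : IsPermutation k β) where

      private
        module P = IsPermutation P
        module Q = IsPermutation Q

      above : ∀ {v s} → (v ∷ s) ⊆ map (m +_) β → m < v
      above p with ∈-map⁻ (m +_) (to∈ p)
      ... | w , w∈ , refl = m<m+n m (Q.positive w∈)

      separated : ∀ {v w s t} → (v ∷ s) ⊆ α → (w ∷ t) ⊆ map (m +_) β → v < w
      separated p q = ≤-<-trans (P.bounded (to∈ p)) (above q)

      -- The patterns end below their first letter, so no occurrence can start in `α` and end among
      -- the larger values of `β`.
      inverted : ∀ {a b c s t} → R a b c → (a ∷ s) ⊆ α → (c ∷ t) ⊆ map (m +_) β → ⊥
      inverted r p q = <-asym (last<first r) (separated p q)

      right⁻ : ∀ {a b c} → (a ∷ b ∷ c ∷ []) ⊆ map (m +_) β → R a b c → Contains₃ R β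
      right⁻ p r with ⊆-map⁻ (m +_) β p
      ... | _ ∷ _ ∷ _ ∷ [] , q , refl = _ , _ , _ , q , unshift m r

      sum⁻ : Contains₃ R (α ⊕[ m ] β) → Contains₃ R α ⊎ Contains₃ R β
      sum⁻ (a , b , c , p , r) with ⊆-++⁻ α p
      ... | []             , _ , refl , _ , q = inj₂ (right⁻ q r)
      ... | _ ∷ []         , _ , refl , q₁ , q₂ = ⊥-elim (inverted r q₁ (∷ˡ⁻ q₂))
      ... | _ ∷ _ ∷ []     , _ , refl , q₁ , q₂ = ⊥-elim (inverted r q₁ q₂)
      ... | _ ∷ _ ∷ _ ∷ [] , _ , refl , q , _ = inj₁ (_ , _ , _ , q , r)

      left⁺ : Contains₃ R α → Contains₃ R (α ⊕[ m ] β)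
      left⁺ (a , b , c , p , r) = a , b , c , ++⁺ʳ (map (m +_) β) p , r

      right⁺ : Contains₃ R β → Contains₃ R (α ⊕[ m ] β)
      right⁺ (a , b , c , p , r) = _ , _ , _ , ++⁺ˡ α (map⁺ (m +_) p) , shift m r

    sumRule : SumRule ρ ρ
    sumRule {α = α} {β} P Q _ = avoids-∧ (λ t → complete′ (sum⁻ P Q (sound t)))
      (λ t → complete (left⁺ P Q (sound t))) (λ t → complete (right⁺ P Q (sound t)))
      where
      complete′ : Contains₃ R α ⊎ Contains₃ R β → T (containsᵇ ρ α) ⊎ T (containsᵇ ρ β)
      complete′ (inj₁ c) = inj₁ (complete c)
      complete′ (inj₂ c) = inj₂ (complete c)

    module Extended
      (σ : List ℕ) (R′ : Relation₄) (rep′ : Represents₄ σ R′)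
      (restrict : ∀ {a b c d} → R′ a b c d → R a b c × (a < d × b < d × c < d))
      (extend : ∀ {a b c d} → R a b c → a < d → b < d → c < d → R′ a b c d)
      where

      private module S = Represents₄ rep′

      module _ {m k α β} (P : IsPermutation m α) (Q : IsPermutation k β) where

        right₄⁻ : ∀ {a b c d} → (a ∷ b ∷ c ∷ d ∷ []) ⊆ map (m +_) β → R′ a b c d → Contains₄ R′ β
        right₄⁻ p r with ⊆-map⁻ (m +_) β p
        ... | a ∷ b ∷ c ∷ d ∷ [] , q , refl = let r₃ , ad , bd , cd = restrict r in
          _ , _ , _ , _ , q , extend (unshift m r₃) (+-cancelˡ-< m a d ad) (+-cancelˡ-< m b d bd) (+-cancelˡ-< m c d cd)

        -- An occurrence that starts in `α` has its first three letters there by `inverted`, and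
        -- these already form an occurrence of `ρ`.
        sum₄⁻ : Contains₄ R′ (α ⊕[ m ] β) → Contains₃ R α ⊎ Contains₄ R′ β
        sum₄⁻ (a , b , c , d , p , r) with ⊆-++⁻ α p
        ... | []                 , _ , refl , _ , q = inj₂ (right₄⁻ q r)
        ... | _ ∷ []             , _ , refl , q₁ , q₂ = ⊥-elim (inverted P Q (proj₁ (restrict r)) q₁ (∷ˡ⁻ q₂))
        ... | _ ∷ _ ∷ []         , _ , refl , q₁ , q₂ = ⊥-elim (inverted P Q (proj₁ (restrict r)) q₁ q₂)
        ... | _ ∷ _ ∷ _ ∷ []     , _ , refl , q , _ = inj₁ (_ , _ , _ , q , proj₁ (restrict r))
        ... | _ ∷ _ ∷ _ ∷ _ ∷ [] , _ , refl , q , _ = inj₁ (_ , _ , _ , ⊆-init q , proj₁ (restrict r))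
          where
          ⊆-init : ∀ {a b c d : ℕ} {π} → (a ∷ b ∷ c ∷ d ∷ []) ⊆ π → (a ∷ b ∷ c ∷ []) ⊆ π
          ⊆-init (x ∷ʳ p) = x ∷ʳ ⊆-init p
          ⊆-init (refl ∷ p) = refl ∷ ⊆-init₂ p
            where
            ⊆-init₁ : ∀ {c d : ℕ} {π} → (c ∷ d ∷ []) ⊆ π → (c ∷ []) ⊆ π
            ⊆-init₁ (x ∷ʳ p)   = x ∷ʳ ⊆-init₁ p
            ⊆-init₁ (refl ∷ p) = refl ∷ []⊆-universal _
            ⊆-init₂ : ∀ {b c d : ℕ} {π} → (b ∷ c ∷ d ∷ []) ⊆ π → (b ∷ c ∷ []) ⊆ π
            ⊆-init₂ (x ∷ʳ p)   = x ∷ʳ ⊆-init₂ p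
            ⊆-init₂ (refl ∷ p) = refl ∷ ⊆-init₁ p

        left₄⁺ : 1 ≤ k → Contains₃ R α → Contains₄ R′ (α ⊕[ m ] β)
        -- The value 1 of `β` becomes `m + 1`, larger than every entry of `α`.
        left₄⁺ 1≤k (a , b , c , p , r) = a , b , c , m + 1
          , ++⁺ p (map⁺ (m +_) (from∈ (surjective Q ≤-refl 1≤k)))
          , extend r (below p) (below (∷ˡ⁻ p)) (below (∷ˡ⁻ (∷ˡ⁻ p)))
          where
          below : ∀ {v s} → (v ∷ s) ⊆ α → v < m + 1
          below p = ≤-<-trans (IsPermutation.bounded P (to∈ p)) (m<m+n m (s≤s z≤n))

        right₄⁺ : Contains₄ R′ β → Contains₄ R′ (α ⊕[ m ] β)
        right₄⁺ (a , b , c , d , p , r) = let r₃ , ad , bd , cd = restrict r in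
          _ , _ , _ , _ , ++⁺ˡ α (map⁺ (m +_) p) , extend (shift m r₃) (+-monoʳ-< m ad) (+-monoʳ-< m bd) (+-monoʳ-< m cd)

      sumRule₄ : SumRule ρ σ
      sumRule₄ {α = α} {β} P Q 1≤k = avoids-∧ (λ t → complete′ (sum₄⁻ P Q (S.sound t)))
        (λ t → S.complete (left₄⁺ P Q 1≤k (sound t))) (λ t → S.complete (right₄⁺ P Q (S.sound t)))
        where
        complete′ : Contains₃ R α ⊎ Contains₄ R′ β → T (containsᵇ ρ α) ⊎ T (containsᵇ σ β)
        complete′ (inj₁ c) = inj₁ (complete c)
        complete′ (inj₂ c) = inj₂ (S.complete c)

  module Sum231 = SumIndecomposable p231 R231 represents231 proj₁
    (λ m (ca , ab) → +-monoʳ-< m ca , +-monoʳ-< m ab) (λ m {a} {b} {c} (ca , ab) → +-cancelˡ-< m c a ca , +-cancelˡ-< m a b ab)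

  module Sum312 = SumIndecomposable p312 R312 represents312 proj₂
    (λ m (bc , ca) → +-monoʳ-< m bc , +-monoʳ-< m ca) (λ m {a} {b} {c} (bc , ca) → +-cancelˡ-< m b c bc , +-cancelˡ-< m c a ca)

  module Sum2314 = Sum231.Extended p2314 R2314 represents2314
    (λ (ca , ab , bd) → (ca , ab) , <-trans ab bd , bd , <-trans ca (<-trans ab bd)) (λ (ca , ab) _ bd _ → ca , ab , bd)

  module Sum3124 = Sum312.Extended p3124 R3124 represents3124
    (λ (bc , ca , ad) → (bc , ca) , ad , <-trans bc (<-trans ca ad) , <-trans ca ad) (λ (bc , ca) ad _ _ → bc , ca , ad)

  Additive : (List ℕ → ℕ) → Set
  Additive st = ∀ {m k α β} → IsPermutation m α → IsPermutation k β → 1 ≤ m → 1 ≤ k → st (α ⊕[ m ] β) ≡ st α + st β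

  <ᵇ-shift : ∀ m a b → (m + a <ᵇ m + b) ≡ (a <ᵇ b)
  <ᵇ-shift zero    a b = refl
  <ᵇ-shift (suc m) a b = <ᵇ-shift m a b

  des-shift : ∀ m β → des (map (m +_) β) ≡ des β
  des-shift m []          = refl
  des-shift m (x ∷ [])    = refl
  des-shift m (x ∷ y ∷ β) = cong₂ (λ b d → (if b then 1 else 0) + d) (<ᵇ-shift m y x) (des-shift m (y ∷ β))

  des-++ : ∀ x α y γ → (∀ {v} → v ∈ x ∷ α → v < y) → des (x ∷ α ++ y ∷ γ) ≡ des (x ∷ α) + des (y ∷ γ)
  des-++ x []       y γ lt rewrite <⇒>ᵇ≡false (lt (here refl)) = refl
  des-++ x (x′ ∷ α) y γ lt = trans (cong ((if x′ <ᵇ x then 1 else 0) +_) (des-++ x′ α y γ (lt ∘ there)))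
    (sym (+-assoc (if x′ <ᵇ x then 1 else 0) _ _))

  des-additive : Additive des
  des-additive {α = []}    P Q 1≤m _ = ⊥-elim (<⇒≱ 1≤m (≤-reflexive (sym (IsPermutation.size P))))
  des-additive {α = _ ∷ _} {[]} P Q _ 1≤k = ⊥-elim (<⇒≱ 1≤k (≤-reflexive (sym (IsPermutation.size Q))))
  des-additive {m} {α = x ∷ α} {y ∷ β} P Q _ _ = trans
    (des-++ x α (m + y) (map (m +_) β) (λ v∈ → ≤-<-trans (IsPermutation.bounded P v∈) (m<m+n m (IsPermutation.positive Q (here refl)))))
    (cong (des (x ∷ α) +_) (des-shift m (y ∷ β)))

  -- Splitting off the first component

  open import Data.Bool.Properties using (∧-assoc; ∧-comm; ∧-identityʳ; ∧-zeroʳ)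
  open import Data.Integer.Base as ℤ using (ℤ; +_)
  import Data.Integer.Properties as ℤ
  open GeneratingFunctions using (Σ<-suc; Σ<-cong; Σ<-last)

  Σ<-zero : ∀ n {f} → (∀ i → i < n → f i ≡ + 0) → Σ< n f ≡ + 0
  Σ<-zero n eq = trans (Σ<-cong n eq) (zeros n)
    where
    zeros : ∀ n → Σ< n (λ _ → + 0) ≡ + 0
    zeros zero    = refl
    zeros (suc n) = trans (Σ<-suc n (λ _ → + 0)) (trans (ℤ.+-identityˡ _) (zeros n))

  Σ<-+ : ∀ n f g → Σ< n (λ i → f i ℤ.+ g i) ≡ Σ< n f ℤ.+ Σ< n g
  Σ<-+ zero    f g = refl
  Σ<-+ (suc n) f g = begin
    Σ< (suc n) (λ i → f i ℤ.+ g i)                         ≡⟨ Σ<-suc n (λ i → f i ℤ.+ g i) ⟩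
    (f 0 ℤ.+ g 0) ℤ.+ Σ< n (λ i → f (suc i) ℤ.+ g (suc i))  ≡⟨ cong (λ t → (f 0 ℤ.+ g 0) ℤ.+ t) (Σ<-+ n (f ∘ suc) (g ∘ suc)) ⟩
    (f 0 ℤ.+ g 0) ℤ.+ (Σ< n (f ∘ suc) ℤ.+ Σ< n (g ∘ suc))  ≡⟨ interchange (f 0) (g 0) _ _ ⟩
    (f 0 ℤ.+ Σ< n (f ∘ suc)) ℤ.+ (g 0 ℤ.+ Σ< n (g ∘ suc))  ≡⟨ cong₂ ℤ._+_ (Σ<-suc n f) (Σ<-suc n g) ⟨
    Σ< (suc n) f ℤ.+ Σ< (suc n) g                          ∎
    where
    open ≡-Reasoning
    open import Algebra.Properties.CommutativeSemigroup ℤ.+-commutativeSemigroup using (interchange)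

  -- The convolution of the series of indecomposables with `A - 1` loses both end terms, since
  -- neither series has a constant term.
  Σ<-interior : ∀ n f → f 0 ≡ + 0 → f (suc n) ≡ + 0 → Σ< (suc (suc n)) f ≡ Σ< n (f ∘ suc)
  Σ<-interior n f f0 fn = begin
    Σ< (suc (suc n)) f                ≡⟨ Σ<-suc (suc n) f ⟩
    f 0 ℤ.+ Σ< (suc n) (f ∘ suc)      ≡⟨ cong₂ ℤ._+_ f0 (Σ<-last n (f ∘ suc)) ⟩
    + 0 ℤ.+ (Σ< n (f ∘ suc) ℤ.+ f (suc n))  ≡⟨ ℤ.+-identityˡ _ ⟩
    Σ< n (f ∘ suc) ℤ.+ f (suc n)      ≡⟨ cong (λ t → Σ< n (f ∘ suc) ℤ.+ t) fn ⟩
    Σ< n (f ∘ suc) ℤ.+ + 0            ≡⟨ ℤ.+-identityʳ _ ⟩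
    Σ< n (f ∘ suc)                    ∎
    where open ≡-Reasoning

  count-false : ∀ {p} xs → (∀ x → p x ≡ false) → count p xs ≡ 0
  count-false []       _  = refl
  count-false {p} (x ∷ xs) eq = trans (count-∷ p x xs) (cong₂ (λ b c → bit b + c) (eq x) (count-false xs eq))

  count-filter : ∀ p q xs → count p (filterᵇ q xs) ≡ count (λ x → q x ∧ p x) xs
  count-filter p q []       = refl
  count-filter p q (x ∷ xs) with q x
  ... | false = count-filter p q xs
  ... | true with p x
  ...   | false = count-filter p q xs
  ...   | true  = cong suc (count-filter p q xs)

  count-concatMap : ∀ {A : Set} p (f : A → List (List ℕ)) xs → + count p (concatMap f xs) ≡ sumℤ (map (λ x → + count p (f x)) xs)
  count-concatMap p f []       = refl
  count-concatMap p f (x ∷ xs) = trans (cong +_ (count-++ p (f x) (concatMap f xs))) (cong (λ t → + count p (f x) ℤ.+ t) (count-concatMap p f xs))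

  count-range : ∀ p (f : ℕ → List (List ℕ)) n → + count p (concatMap f (range1 n)) ≡ Σ< n (λ k → + count p (f (suc k)))
  count-range p f n = trans (count-concatMap p f (range1 n)) (cong sumℤ (sym (map-∘ (upTo n))))

  module _ (y : List ℕ → Bool) (t : List ℕ → ℕ) (Bs : List (List ℕ)) where

    level : ℕ → ℤ
    level k = + count (λ β → y β ∧ (t β ≡ᵇ k)) Bs

    -- For a single first component with statistic `s` only the term `j = s` survives, and none if
    -- `s` exceeds `i`.
    level-convolution : ∀ s i → + count (λ β → y β ∧ (s + t β ≡ᵇ i)) Bs ≡ Σ< (suc i) (λ j → + bit (s ≡ᵇ j) ℤ.* level (i ∸ j))
    level-convolution zero    i       = sym (trans (Σ<-suc i (λ j → + bit (0 ≡ᵇ j) ℤ.* level (i ∸ j)))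
      (trans (cong (λ u → + 1 ℤ.* level i ℤ.+ u) (Σ<-zero i (λ j _ → ℤ.*-zeroˡ (level (i ∸ suc j)))))
        (trans (ℤ.+-identityʳ _) (ℤ.*-identityˡ (level i)))))
    level-convolution (suc s) zero    = cong +_ (count-false Bs (λ β → ∧-zeroʳ (y β)))
    level-convolution (suc s) (suc i) = trans (level-convolution s i)
      (sym (trans (Σ<-suc (suc i) (λ j → + bit (suc s ≡ᵇ j) ℤ.* level (suc i ∸ j))) (ℤ.+-identityˡ _)))

    pair-convolution : ∀ (x : List ℕ → Bool) (s : List ℕ → ℕ) i As →
      sumℤ (map (λ α → + count (λ β → (x α ∧ y β) ∧ (s α + t β ≡ᵇ i)) Bs) As)
        ≡ Σ< (suc i) (λ j → + count (λ α → x α ∧ (s α ≡ᵇ j)) As ℤ.* level (i ∸ j))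
    pair-convolution x s i []       = sym (Σ<-zero (suc i) (λ j _ → ℤ.*-zeroˡ (level (i ∸ j))))
    pair-convolution x s i (α ∷ As) = begin
      + count (λ β → (x α ∧ y β) ∧ (s α + t β ≡ᵇ i)) Bs ℤ.+ sumℤ (map (λ α → + count (λ β → (x α ∧ y β) ∧ (s α + t β ≡ᵇ i)) Bs) As)
        ≡⟨ cong₂ ℤ._+_ head (pair-convolution x s i As) ⟩
      Σ< (suc i) (λ j → + bit (x α ∧ (s α ≡ᵇ j)) ℤ.* level (i ∸ j)) ℤ.+ Σ< (suc i) (λ j → + count (c j) As ℤ.* level (i ∸ j))
        ≡⟨ Σ<-+ (suc i) (λ j → + bit (x α ∧ (s α ≡ᵇ j)) ℤ.* level (i ∸ j)) (λ j → + count (c j) As ℤ.* level (i ∸ j)) ⟨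
      Σ< (suc i) (λ j → + bit (x α ∧ (s α ≡ᵇ j)) ℤ.* level (i ∸ j) ℤ.+ + count (c j) As ℤ.* level (i ∸ j))
        ≡⟨ Σ<-cong (suc i) (λ j _ → trans (sym (ℤ.*-distribʳ-+ (level (i ∸ j)) (+ bit (x α ∧ (s α ≡ᵇ j))) (+ count (c j) As)))
             (cong (λ u → + u ℤ.* level (i ∸ j)) (sym (count-∷ (c j) α As)))) ⟩
      Σ< (suc i) (λ j → + count (c j) (α ∷ As) ℤ.* level (i ∸ j)) ∎
      where
      open ≡-Reasoning
      c : ℕ → List ℕ → Bool
      c j α = x α ∧ (s α ≡ᵇ j)
      head : + count (λ β → (x α ∧ y β) ∧ (s α + t β ≡ᵇ i)) Bs ≡ Σ< (suc i) (λ j → + bit (x α ∧ (s α ≡ᵇ j)) ℤ.* level (i ∸ j))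
      head with x α
      ... | true  = level-convolution (s α) i
      ... | false = trans (cong +_ (count-false Bs (λ _ → refl))) (sym (Σ<-zero (suc i) (λ j _ → ℤ.*-zeroˡ (level (i ∸ j)))))

  module Statistic (st : List ℕ → ℕ) (additive : Additive st) where

    avoiders : List ℕ → ℕ → ℕ → ℕ
    avoiders σ n i = count (λ π → avoidsᵇ σ π ∧ (st π ≡ᵇ i)) (perms n)

    indecomposableAvoiders : List ℕ → ℕ → ℕ → ℕ
    indecomposableAvoiders σ n i = count (λ π → avoidsᵇ σ π ∧ indecomposableᵇ π ∧ (st π ≡ᵇ i)) (perms n)

    among-indecomposables : ∀ σ m i → count (λ π → avoidsᵇ σ π ∧ (st π ≡ᵇ i)) (indecomposables m) ≡ indecomposableAvoiders σ m i
    among-indecomposables σ m i = trans (count-filter (λ π → avoidsᵇ σ π ∧ (st π ≡ᵇ i)) indecomposableᵇ (perms m))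
      (count-cong (perms m) (λ {π} _ → swap (indecomposableᵇ π) (avoidsᵇ σ π) (st π ≡ᵇ i)))
      where
      swap : ∀ a b c → a ∧ (b ∧ c) ≡ b ∧ (a ∧ c)
      swap a b c = trans (sym (∧-assoc a b c)) (trans (cong (_∧ c) (∧-comm a b)) (∧-assoc b a c))

    module _ {ρ σ} (rule : SumRule ρ σ) (i : ℕ) where

      p : List ℕ → Bool
      p π = avoidsᵇ σ π ∧ (st π ≡ᵇ i)

      whole : ∀ n → count p (sumsOfSize n n) ≡ indecomposableAvoiders σ n i
      whole n rewrite n∸n≡0 n = trans (cong (count p) (singletons (indecomposables n))) (among-indecomposables σ n i)
        where
        singletons : ∀ L → concatMap (λ α → (α ++ []) ∷ []) L ≡ L
        singletons []      = refl
        singletons (α ∷ L) = cong₂ _∷_ (++-identityʳ α) (singletons L)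

      proper : ∀ m k → 1 ≤ m → 1 ≤ k → + count p (concatMap (λ α → map (α ⊕[ m ]_) (perms k)) (indecomposables m))
        ≡ Σ< (suc i) (λ j → + indecomposableAvoiders ρ m j ℤ.* + avoiders σ k (i ∸ j))
      proper m k 1≤m 1≤k = begin
        + count p (concatMap (λ α → map (α ⊕[ m ]_) (perms k)) (indecomposables m))
          ≡⟨ count-concatMap p (λ α → map (α ⊕[ m ]_) (perms k)) (indecomposables m) ⟩
        sumℤ (map (λ α → + count p (map (α ⊕[ m ]_) (perms k))) (indecomposables m))
          ≡⟨ cong sumℤ (map-cong-∈ (indecomposables m) (λ α∈ → cong +_ (split (proj₁ (∈-indecomposables m α∈))))) ⟩
        sumℤ (map (λ α → + count (λ β → (avoidsᵇ ρ α ∧ avoidsᵇ σ β) ∧ (st α + st β ≡ᵇ i)) (perms k)) (indecomposables m))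
          ≡⟨ pair-convolution (avoidsᵇ σ) st (perms k) (avoidsᵇ ρ) st i (indecomposables m) ⟩
        Σ< (suc i) (λ j → + count (λ α → avoidsᵇ ρ α ∧ (st α ≡ᵇ j)) (indecomposables m) ℤ.* + avoiders σ k (i ∸ j))
          ≡⟨ Σ<-cong (suc i) (λ j _ → cong (λ t → + t ℤ.* + avoiders σ k (i ∸ j)) (among-indecomposables ρ m j)) ⟩
        Σ< (suc i) (λ j → + indecomposableAvoiders ρ m j ℤ.* + avoiders σ k (i ∸ j)) ∎
        where
        open ≡-Reasoning
        map-cong-∈ : ∀ {f g : List ℕ → ℤ} xs → (∀ {x} → x ∈ xs → f x ≡ g x) → map f xs ≡ map g xs
        map-cong-∈ []       _  = refl
        map-cong-∈ (x ∷ xs) eq = cong₂ _∷_ (eq (here refl)) (map-cong-∈ xs (eq ∘ there))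
        split : ∀ {α} → IsPermutation m α → count p (map (α ⊕[ m ]_) (perms k)) ≡ count (λ β → (avoidsᵇ ρ α ∧ avoidsᵇ σ β) ∧ (st α + st β ≡ᵇ i)) (perms k)
        split {α} P = trans (count-map p (α ⊕[ m ]_) (perms k)) (count-cong (perms k) (λ β∈ →
          cong₂ (λ b s → b ∧ (s ≡ᵇ i)) (rule P (∈-perms⁻ β∈) 1≤k) (additive P (∈-perms⁻ β∈) 1≤m 1≤k)))

      first-component : ∀ n → + avoiders σ (suc n) i ≡ + indecomposableAvoiders σ (suc n) i
        ℤ.+ Σ< n (λ m → Σ< (suc i) (λ j → + indecomposableAvoiders ρ (suc m) j ℤ.* + avoiders σ (n ∸ m) (i ∸ j)))
      first-component n = begin
        + count p (perms (suc n))
          ≡⟨ cong +_ (count-enumerations p (enumerates-perms (suc n)) (enumerates-sums (s≤s z≤n))) ⟩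
        + count p (sums (suc n))
          ≡⟨ count-range p (sumsOfSize (suc n)) (suc n) ⟩
        Σ< (suc n) (λ m → + count p (sumsOfSize (suc n) (suc m)))
          ≡⟨ Σ<-last n (λ m → + count p (sumsOfSize (suc n) (suc m))) ⟩
        Σ< n (λ m → + count p (sumsOfSize (suc n) (suc m))) ℤ.+ + count p (sumsOfSize (suc n) (suc n))
          ≡⟨ cong₂ ℤ._+_ (Σ<-cong n (λ m m<n → proper (suc m) (n ∸ m) (s≤s z≤n) (m<n⇒0<n∸m m<n))) (cong +_ (whole (suc n))) ⟩
        rest ℤ.+ + indecomposableAvoiders σ (suc n) i
          ≡⟨ ℤ.+-comm rest (+ indecomposableAvoiders σ (suc n) i) ⟩
        + indecomposableAvoiders σ (suc n) i ℤ.+ rest ∎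
        where
        open ≡-Reasoning
        rest : ℤ
        rest = Σ< n (λ m → Σ< (suc i) (λ j → + indecomposableAvoiders ρ (suc m) j ℤ.* + avoiders σ (n ∸ m) (i ∸ j)))

  module Descents = Statistic des des-additive

  descent-decomposition : ∀ {ρ σ} → SumRule ρ σ → Agf σ ≋₂ one₂ ⊕₂ Igf σ ⊕₂ Igf ρ ⊗₂ (Agf σ ⊖₂ one₂)
  descent-decomposition {ρ} {σ} rule zero i = sym (trans (cong (λ t → (one₂ 0 i ℤ.+ + 0) ℤ.+ t)
      (trans (ℤ.+-identityʳ _) (Σ<-zero (suc i) (λ j _ → ℤ.*-zeroˡ ((Agf σ ⊖₂ one₂) 0 (i ∸ j))))))
    (trans (ℤ.+-identityʳ _) (ℤ.+-identityʳ (one₂ 0 i))))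
  descent-decomposition {ρ} {σ} rule (suc n) i = trans (Descents.first-component rule i n)
    (cong₂ ℤ._+_ (sym (ℤ.+-identityˡ (+ Icoef σ (suc n) i))) (sym (trans (Σ<-interior n term first last) (Σ<-cong n middle))))
    where
    term : ℕ → ℤ
    term m = Σ< (suc i) (λ j → Igf ρ m j ℤ.* (Agf σ ⊖₂ one₂) (suc n ∸ m) (i ∸ j))
    first : term 0 ≡ + 0
    first = Σ<-zero (suc i) (λ j _ → ℤ.*-zeroˡ ((Agf σ ⊖₂ one₂) (suc n) (i ∸ j)))
    last : term (suc n) ≡ + 0
    last = Σ<-zero (suc i) (λ j _ → trans (cong (λ t → Igf ρ (suc n) j ℤ.* (Agf σ ⊖₂ one₂) t (i ∸ j)) (n∸n≡0 n))
      (trans (cong (Igf ρ (suc n) j ℤ.*_) (ℤ.+-inverseʳ (one₂ 0 (i ∸ j)))) (ℤ.*-zeroʳ (Igf ρ (suc n) j))))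
    positive : ∀ k l → 1 ≤ k → (Agf σ ⊖₂ one₂) k l ≡ + Acoef σ k l
    positive (suc k) l _ = ℤ.+-identityʳ _
    middle : ∀ m → m < n → term (suc m) ≡ Σ< (suc i) (λ j → + Icoef ρ (suc m) j ℤ.* + Acoef σ (n ∸ m) (i ∸ j))
    middle m m<n = Σ<-cong (suc i) (λ j _ → cong (+ Icoef ρ (suc m) j ℤ.*_) (positive (n ∸ m) (i ∸ j) (m<n⇒0<n∸m m<n)))

  -- The constant statistic puts all permutations at level 0, which specialises the decomposition to
  -- `q = 1`.
  module Plain = Statistic (λ _ → 0) (λ _ _ _ _ → refl)

  avoiderSeries : List ℕ → Series
  avoiderSeries σ n = + count (avoidsᵇ σ) (perms n)

  plain-decomposition : ∀ {ρ σ} → SumRule ρ σ → avoiderSeries σ 0 ≡ + 1 →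
    avoiderSeries σ ≋ constS (+ 1) ⊕ Igf₁ σ ⊕ Igf₁ ρ ⊗ (avoiderSeries σ ⊖ constS (+ 1))
  plain-decomposition {ρ} {σ} rule σ0 zero = trans σ0 (sym (trans (cong (λ t → (+ 1 ℤ.+ + 0) ℤ.+ t)
    (trans (ℤ.+-identityʳ _) (ℤ.*-zeroˡ ((avoiderSeries σ ⊖ constS (+ 1)) 0)))) refl))
  plain-decomposition {ρ} {σ} rule σ0 (suc n) = begin
    + count (avoidsᵇ σ) (perms (suc n))
      ≡⟨ cong +_ (total σ (suc n)) ⟨
    + Plain.avoiders σ (suc n) 0
      ≡⟨ Plain.first-component rule 0 n ⟩
    + Plain.indecomposableAvoiders σ (suc n) 0 ℤ.+ Σ< n (λ m → + Plain.indecomposableAvoiders ρ (suc m) 0 ℤ.* + Plain.avoiders σ (n ∸ m) 0 ℤ.+ + 0)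
      ≡⟨ cong₂ ℤ._+_ (trans (cong +_ (total-indecomposable σ (suc n))) (sym (ℤ.+-identityˡ (+ Icount σ (suc n)))))
           (trans (Σ<-cong n middle) (sym (Σ<-interior n term first last))) ⟩
    (+ 0 ℤ.+ + Icount σ (suc n)) ℤ.+ (Igf₁ ρ ⊗ (avoiderSeries σ ⊖ constS (+ 1))) (suc n) ∎
    where
    open ≡-Reasoning
    total : ∀ σ n → Plain.avoiders σ n 0 ≡ count (avoidsᵇ σ) (perms n)
    total σ n = count-cong (perms n) (λ {π} _ → ∧-identityʳ (avoidsᵇ σ π))
    total-indecomposable : ∀ σ n → Plain.indecomposableAvoiders σ n 0 ≡ Icount σ n
    total-indecomposable σ n = count-cong (perms n) (λ {π} _ → cong (avoidsᵇ σ π ∧_) (∧-identityʳ (indecomposableᵇ π)))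
    term : ℕ → ℤ
    term m = Igf₁ ρ m ℤ.* (avoiderSeries σ ⊖ constS (+ 1)) (suc n ∸ m)
    first : term 0 ≡ + 0
    first = ℤ.*-zeroˡ ((avoiderSeries σ ⊖ constS (+ 1)) (suc n))
    last : term (suc n) ≡ + 0
    last = trans (cong (λ t → Igf₁ ρ (suc n) ℤ.* (avoiderSeries σ ⊖ constS (+ 1)) t) (n∸n≡0 n))
      (trans (cong (λ t → Igf₁ ρ (suc n) ℤ.* (t ℤ.- + 1)) σ0) (ℤ.*-zeroʳ (Igf₁ ρ (suc n))))
    positive : ∀ k → 1 ≤ k → + Plain.avoiders σ k 0 ≡ (avoiderSeries σ ⊖ constS (+ 1)) k
    positive (suc k) _ = trans (cong +_ (total σ (suc k))) (sym (ℤ.+-identityʳ _))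
    middle : ∀ m → m < n → + Plain.indecomposableAvoiders ρ (suc m) 0 ℤ.* + Plain.avoiders σ (n ∸ m) 0 ℤ.+ + 0 ≡ term (suc m)
    middle m m<n = trans (ℤ.+-identityʳ _) (cong₂ ℤ._*_ (cong +_ (total-indecomposable ρ (suc m))) (positive (n ∸ m) (m<n⇒0<n∸m m<n)))

-- The series and numbers of indecomposable avoiders.

module Enumeration where

  open import Data.Integer.Base as ℤ using (ℤ; +_)
  import Data.Integer.Properties as ℤ
  open import Data.List.Base using ([])
  open import Data.Nat.Base as ℕ using (ℕ; zero; suc; s≤s)
  open import Data.Sum.Base using (_⊎_; inj₁; inj₂)
  open import Relation.Binary.PropositionalEquality as ≡ using (_≡_)
  open import Defs
  open FormalSeries
  open StackHistories
  open BallotNumbers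
  open GeneratingFunctions
  open Combinatorics

  open ℤx.S
  open IntegralSolver ℤx.X.seriesRing
  open import Relation.Binary.Reasoning.Setoid setoid

  decompose : ∀ {ρ σ} → SumRule ρ σ → avoiderSeries σ 0 ≡ + 1 →
    avoiderSeries σ ≈ 1# + Igf₁ σ + Igf₁ ρ * (avoiderSeries σ - 1#)
  decompose {ρ} {σ} rule σ0 = trans (plain-decomposition rule σ0)
    (+-cong (+-congʳ {Igf₁ σ} (constant-nat 1)) (⊗-cong {Igf₁ ρ} {g = avoiderSeries σ ⊖ constS (+ 1)} refl
      (+-congˡ {avoiderSeries σ} (-‿cong (constant-nat 1)))))

  -- For `σ = ρ` the decomposition collapses to the renewal equation `A = 1 + JA`, where `A` is the
  -- Catalan series.
  catalan-quotient : ∀ {ρ} → SumRule ρ ρ → (∀ n → count (avoidsᵇ ρ) (perms n) ≡ ballot n 0) → Igf₁ ρ ≈ x * C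
  catalan-quotient {ρ} rule counts = renewal-quotient (begin
    C                        ≈⟨ A≈C ⟨
    A                        ≈⟨ decompose rule (≡.cong +_ (counts 0)) ⟩
    1# + J + J * (A - 1#)    ≈⟨ solve 2 (λ j a → κ 1 :+ j :+ j :* (a :- κ 1) := κ 1 :+ j :* a) refl J A ⟩
    1# + J * A               ≈⟨ +-congˡ {1#} (*-congˡ {J} A≈C) ⟩
    1# + J * C               ∎)
    where
    A J : Carrier
    A = avoiderSeries ρ
    J = Igf₁ ρ
    A≈C : A ≈ C
    A≈C n = ≡.trans (≡.cong +_ (counts n)) (≡.sym (C-ballot n))

  F-paths : ∀ n → F n ≡ paths n []
  F-paths n = ≡.trans (count-1342≡1423 n) (count-avoids1423 n)

  indecomposables≈Î : ∀ {ρ σ} → SumRule ρ ρ → SumRule ρ σ → (∀ n → count (avoidsᵇ ρ) (perms n) ≡ ballot n 0) →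
    (∀ n → count (avoidsᵇ σ) (perms n) ≡ paths n []) → Igf₁ σ ≈ Î
  indecomposables≈Î {ρ} {σ} ruleρ rule counts wilf = indecomposable-series {avoiderSeries σ} {Igf₁ σ} {Igf₁ ρ}
    (λ n → ≡.trans (≡.cong +_ (wilf n)) (≡.sym (F̂-paths n))) (catalan-quotient ruleρ counts)
    (decompose rule (≡.cong +_ (wilf 0)))

  Igf₁-2314 : Igf₁ p2314 ≈ Î
  Igf₁-2314 = indecomposables≈Î Sum231.sumRule Sum2314.sumRule₄
    (λ n → ≡.trans (count-231≡312 n) (count-avoids312 n))
    (λ n → ≡.trans (count-2314≡1423 n) (count-avoids1423 n))

  Igf₁-3124 : Igf₁ p3124 ≈ Î
  Igf₁-3124 = indecomposables≈Î Sum312.sumRule Sum3124.sumRule₄ count-avoids312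
    (λ n → ≡.trans (count-3124≡1342 n) (F-paths n))

  Igf₁≈Î : ∀ σ → σ ≡ p2314 ⊎ σ ≡ p3124 → Igf₁ σ ≈ Î
  Igf₁≈Î σ (inj₁ ≡.refl) = Igf₁-2314
  Igf₁≈Î σ (inj₂ ≡.refl) = Igf₁-3124

  Icount-one : ∀ σ → σ ≡ p2314 ⊎ σ ≡ p3124 → Icount σ 1 ≡ 1
  Icount-one σ (inj₁ ≡.refl) = ≡.refl
  Icount-one σ (inj₂ ≡.refl) = ≡.refl

  Icount-formula : ∀ σ → σ ≡ p2314 ⊎ σ ≡ p3124 → ∀ n → n ℕ.≥ 2 →
    + Icount σ n ≡ + F n ℤ.- Σ< (n ℕ.∸ 1) (λ i → + (catalan i ℕ.* F (n ℕ.∸ 1 ℕ.∸ i)))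
  Icount-formula σ σ∈ (suc zero)    (s≤s ())
  Icount-formula σ σ∈ (suc (suc m)) _ = ≡.trans (Igf₁≈Î σ σ∈ (suc (suc m))) (≡.trans (Î-coefficient m)
    (≡.cong₂ ℤ._-_ (F̂-F (suc (suc m))) (Σ<-cong (suc m) (λ i _ → ≡.trans
      (≡.cong₂ ℤ._*_ (≡.trans (C-ballot i) (≡.cong +_ (ballot-catalan i))) (F̂-F (suc m ℕ.∸ i)))
      (≡.sym (ℤ.pos-* (catalan i) (F (suc m ℕ.∸ i))))))))
    where
    F̂-F : ∀ n → F̂ n ≡ + F n
    F̂-F n = ≡.trans (F̂-paths n) (≡.cong +_ (≡.sym (F-paths n)))

open import Defs
open import Data.Nat using (ℕ; _≥_)
open import Data.Integer using (+_; -_; _-_)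
open import Data.List using (List; []; _∷_)
open import Data.Product using (_×_; _,_)
open import Data.Sum using (_⊎_)
open import Relation.Binary.PropositionalEquality using (_≡_)

theorem3p9 :
  (Agf (2 ∷ 3 ∷ 1 ∷ 4 ∷ [])
    ≋₂ one₂ ⊕₂ Igf (2 ∷ 3 ∷ 1 ∷ 4 ∷ []) ⊕₂ Igf (2 ∷ 3 ∷ 1 ∷ []) ⊗₂ (Agf (2 ∷ 3 ∷ 1 ∷ 4 ∷ []) ⊖₂ one₂))
  × (Agf (3 ∷ 1 ∷ 2 ∷ 4 ∷ [])
    ≋₂ one₂ ⊕₂ Igf (3 ∷ 1 ∷ 2 ∷ 4 ∷ []) ⊕₂ Igf (3 ∷ 1 ∷ 2 ∷ []) ⊗₂ (Agf (3 ∷ 1 ∷ 2 ∷ 4 ∷ []) ⊖₂ one₂))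
  × ((σ : List ℕ) → (σ ≡ 2 ∷ 3 ∷ 1 ∷ 4 ∷ [] ⊎ σ ≡ 3 ∷ 1 ∷ 2 ∷ 4 ∷ []) →
    -- generating function: S = √(1-4x), T = (1-8x)^{3/2}, D = 1+20x-8x²-T;
    -- I^σ(x) = ½(S+1)(32x/D - 1), with the denominator D cleared
    ((S T : Series) →
       S 0 ≡ + 1 → S ⊗ S ≋ constS (+ 1) ⊖ monoS (+ 4) 1 →
       T 0 ≡ + 1 →
       T ⊗ T ≋ (constS (+ 1) ⊖ monoS (+ 8) 1) ⊗ (constS (+ 1) ⊖ monoS (+ 8) 1) ⊗ (constS (+ 1) ⊖ monoS (+ 8) 1) →
       constS (+ 2) ⊗ Igf₁ σ ⊗ (constS (+ 1) ⊕ monoS (+ 20) 1 ⊖ monoS (+ 8) 2 ⊖ T)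
         ≋ (S ⊕ constS (+ 1)) ⊗ (monoS (+ 32) 1 ⊖ (constS (+ 1) ⊕ monoS (+ 20) 1 ⊖ monoS (+ 8) 2 ⊖ T)))
    × Icount σ 1 ≡ 1
    × ((n : ℕ) → n ≥ 2 →
         + Icount σ n ≡ + F n - Σ< (n Data.Nat.∸ 1) (λ i → + (catalan i Data.Nat.* F (n Data.Nat.∸ 1 Data.Nat.∸ i)))))
theorem3p9 =
    Combinatorics.descent-decomposition Combinatorics.Sum2314.sumRule₄
  , Combinatorics.descent-decomposition Combinatorics.Sum3124.sumRule₄
  , λ σ σ∈ → (λ S T S0 S² T0 T² →
        GeneratingFunctions.generating-function {Igf₁ σ} {S} {T} (Enumeration.Igf₁≈Î σ σ∈) S0 S² T0 T²)
      , Enumeration.Icount-one σ σ∈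
      , Enumeration.Icount-formula σ σ∈
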